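{- Let $p$ be a prime and $q$ a power of $p$. There exist uncountably many $T$-numbers in $\mathbb{F}_q((T^{ -1}))$.
   Context: $\mathbb{F}_q$ is the finite field with $q$ elements and $\mathbb{F}_q((T^{ -1}))$ is the field of Laurent series in $T^{ -1}$ over $\mathbb{F}_q$. For nonzero $\xi=\sum_{n=N}^{\infty}a_nT^{ -n}\in\mathbb{F}_q((T^{ -1}))$ with $N\in\mathbb{Z}$, $a_n\in\mathbb{F}_q$, $a_N\neq 0$, put $|\xi|:=q^{ -N}$, and $|0|:=0$. The height $H(P)$ of a polynomial $P(X)\in(\mathbb{F}_q[T])[X]$ is the maximum of the absolute values of its coefficients. For an integer $n\ge 1$ and $\xi\in\mathbb{F}_q((T^{ -1}))$, $w_n(\xi)\in\mathbb{R}\cup\{+\infty\}$ denotes the supremum of the real numbers $w$ such that $0<|P(\xi)|\le H(P)^{ -w}$ for infinitely many $P(X)\in(\mathbb{F}_q[T])[X]$ of degree (in $X$) at most $n$. Put $w(\xi):=\limsup_{n\to\infty}w_n(\xi)/n$. The Laurent series $\xi$ is called a $T$-number if $w(\xi)=+\infty$ and $w_n(\xi)<+\infty$ for all integers $n\ge 1$. -}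

module Defs where

open import Level using (Level; _⊔_; 0ℓ) renaming (suc to lsuc)
open import Algebra.Bundles using (CommutativeRing)
open import Algebra.Bundles.Raw using (RawSemiring)
import Algebra.Definitions.RawSemiring as RawSemiringOps
open import Data.Fin.Base using (Fin; toℕ)
open import Data.Fin.Properties using (nonZeroIndex)
open import Data.Integer.Base as ℤ using (ℤ; +_; -[1+_])
open import Data.List.Base using (List; []; _∷_; foldr)
open import Data.List.Relation.Unary.All using (All)
open import Data.Nat.Base as ℕ using (ℕ; zero; suc; NonZero; _∸_)
open import Data.Nat.Properties using (m^n≢0)
open import Data.Product.Base using (Σ-syntax; ∃-syntax; _×_)
open import Data.Rational.Base as ℚ using (ℚ; ↥_; ↧ₙ_; 0ℚ; 1ℚ)
open import Data.Sum.Base using (_⊎_)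
open import Data.Vec.Functional using (Vector)
open import Function.Bundles using (Inverse)
open import Relation.Binary.Core using (Rel)
open import Relation.Binary.PropositionalEquality using (_≡_; setoid)
open import Relation.Nullary.Negation using (¬_)
open import Relation.Unary using (Pred)

-- Dedekind reals, with cuts in the lowest universe.

record ℝ : Set₁ where
  field
    Lower Upper   : ℚ → Set
    lower-inh     : ∃[ r ] Lower r
    upper-inh     : ∃[ r ] Upper r
    lower-down    : ∀ {r s} → r ℚ.< s → Lower s → Lower r
    upper-up      : ∀ {r s} → r ℚ.< s → Upper r → Upper s
    lower-rounded : ∀ {r} → Lower r → ∃[ s ] (r ℚ.< s × Lower s)
    upper-rounded : ∀ {s} → Upper s → ∃[ r ] (r ℚ.< s × Upper r)
    disjoint      : ∀ {r} → ¬ (Lower r × Upper r)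
    located       : ∀ {r s} → r ℚ.< s → Lower r ⊎ Upper s

-- An extended real is represented by the set of rationals strictly below it.
-- Suprema of arbitrary sets of reals then exist constructively.  Everything
-- built below is downward closed and has no largest element.

ℝ∞ : (a : Level) → Set (lsuc a)
ℝ∞ a = ℚ → Set a

supremum : ∀ {a} → Pred ℝ a → ℝ∞ (lsuc 0ℓ ⊔ a)
supremum S r = Σ[ w ∈ ℝ ] (S w × ℝ.Lower w r)

_<+∞ : ∀ {a} → ℝ∞ a → Set a
x <+∞ = ∃[ M ] ¬ x M

_≡+∞ : ∀ {a} → ℝ∞ a → Set a
x ≡+∞ = ∀ r → x r

_÷_ : ∀ {a} → ℝ∞ a → (n : ℕ) → .{{NonZero n}} → ℝ∞ a
(x ÷ n) r = x (r ℚ.* (+ n ℚ./ 1))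

-- r < limsup x exactly when some s > r has s < x k for infinitely many k.

limsup : ∀ {a} → (ℕ → ℝ∞ a) → ℝ∞ a
limsup x r = ∃[ s ] (r ℚ.< s × (∀ N → ∃[ k ] (N ℕ.≤ k × x k s)))

module ℚ-Ops = RawSemiringOps ℚ.+-*-rawSemiring
open ℚ-Ops using () renaming (_^_ to _^ℚ_)

-- x ≤ h ^ (- r) for x ≥ 0 and h > 0, with r = m / k: the k-th power of both
-- sides is compared, that is x ^ k ≤ h ^ (- m).

_≤_^-ℚ_ : ℚ → ℚ → ℚ → Set
x ≤ h ^-ℚ r with ↥ r
... | + m      = (x ^ℚ ↧ₙ r) ℚ.* (h ^ℚ m) ℚ.≤ 1ℚ
... | -[1+ m ] = x ^ℚ ↧ₙ r ℚ.≤ h ^ℚ suc m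

-- For h ≥ 1, h ^ (- w) is the infimum of h ^ (- r) over rationals r < w, and
-- nonzero polynomials over F[T] have height ≥ 1.

_≤_^-_ : ℚ → ℚ → ℝ → Set
x ≤ h ^- w = ∀ r → ℝ.Lower w r → x ≤ h ^-ℚ r

-- Countability is enumerability by a sequence up to ≈.  The sequence may take
-- values outside S, so that the empty set is countable.

module _ {a b ℓ} {A : Set a} (_≈_ : Rel A ℓ) (S : Pred A b) where

  Countable : Set (a ⊔ b ⊔ ℓ)
  Countable = Σ[ s ∈ (ℕ → A) ] (∀ x → S x → ∃[ i ] (s i ≈ x))

  Uncountable : Set (a ⊔ b ⊔ ℓ)
  Uncountable = ¬ Countable

record FiniteField (c ℓ : Level) (q : ℕ) : Set (lsuc (c ⊔ ℓ)) where
  field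
    commutativeRing : CommutativeRing c ℓ

  open CommutativeRing commutativeRing public
    using (Carrier; _≈_; _≉_; _+_; _*_; 0#; 1#; semiring)
    renaming (setoid to ≈-setoid)

  field
    0≉1         : 0# ≉ 1#
    inverse     : ∀ x → x ≉ 0# → ∃[ y ] (x * y ≈ 1#)
    cardinality : Inverse ≈-setoid (setoid (Fin q))

  q≢0 : NonZero q
  q≢0 = nonZeroIndex (Inverse.to cardinality 0#)

module _ {c ℓ q} (F : FiniteField c ℓ q) where

  open FiniteField F
  open import Algebra.Properties.Semiring.Sum semiring using (sum)

  -- The series Σ_{i ≥ 0} coeff i · T^-(start + i).  Leading coefficients may
  -- vanish, so `start` is only a lower bound on the order in T⁻¹.

  record Laurent : Set c where
    field
      start : ℤ
      coeff : ℕ → Carrier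

  open Laurent

  -- The coefficient of T⁻ⁿ.

  infix 10 _⟨_⟩
  _⟨_⟩ : Laurent → ℤ → Carrier
  ξ ⟨ n ⟩ with n ℤ.- start ξ
  ... | + i      = coeff ξ i
  ... | -[1+ _ ] = 0#

  _≈ᴸ_ : Rel Laurent ℓ
  ξ ≈ᴸ η = ∀ n → ξ ⟨ n ⟩ ≈ η ⟨ n ⟩

  constant : Carrier → Laurent
  constant a = record { start = + 0 ; coeff = λ { zero → a ; (suc _) → 0# } }

  _+ᴸ_ : Laurent → Laurent → Laurent
  ξ +ᴸ η = record
    { start = s
    ; coeff = λ i → ξ ⟨ s ℤ.+ + i ⟩ + η ⟨ s ℤ.+ + i ⟩
    }
    where s = start ξ ℤ.⊓ start η

  _*ᴸ_ : Laurent → Laurent → Laurent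
  ξ *ᴸ η = record
    { start = start ξ ℤ.+ start η
    ; coeff = λ k → sum {suc k} (λ i → coeff ξ (toℕ i) * coeff η (k ∸ toℕ i))
    }

  laurentRawSemiring : RawSemiring c ℓ
  laurentRawSemiring = record
    { Carrier = Laurent
    ; _≈_     = _≈ᴸ_
    ; _+_     = _+ᴸ_
    ; _*_     = _*ᴸ_
    ; 0#      = constant 0#
    ; 1#      = constant 1#
    }

  open RawSemiringOps laurentRawSemiring
    using () renaming (sum to sumᴸ; _^_ to _^ᴸ_)

  -- q^(-N).

  q^-_ : ℤ → ℚ
  q^- (+ n)    = ℚ._/_ (+ 1) (q ℕ.^ n) {{m^n≢0 q n {{q≢0}}}}
  q^- -[1+ n ] = + (q ℕ.^ suc n) ℚ./ 1

  -- |ξ| = x, as a relation: the order of a series is not computable from its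
  -- coefficients.

  ∣_∣≡_ : Laurent → ℚ → Set ℓ
  ∣ ξ ∣≡ x =
      (ξ ≈ᴸ constant 0# × x ≡ 0ℚ)
    ⊎ (∃[ N ] (ξ ⟨ N ⟩ ≉ 0# × (∀ n → n ℤ.< N → ξ ⟨ n ⟩ ≈ 0#) × x ≡ q^- N))

  -- F[T]: coefficient lists, constant term first, up to trailing zeros.

  F[T] : Set c
  F[T] = List Carrier

  [T^_]_ : ℕ → F[T] → Carrier
  [T^ _     ] []      = 0#
  [T^ zero  ] (a ∷ _) = a
  [T^ suc k ] (_ ∷ f) = [T^ k ] f

  T·_ : Laurent → Laurent
  T· ξ = record { start = ℤ.pred (start ξ) ; coeff = coeff ξ }

  embed : F[T] → Laurent
  embed = foldr (λ a ξ → constant a +ᴸ (T· ξ)) (constant 0#)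

  -- Polynomials in X of degree at most n over F[T]; P i is the coefficient of
  -- X^i.

  F[T][X]≤ : ℕ → Set c
  F[T][X]≤ n = Vector F[T] (suc n)

  _≈ᴾ_ : ∀ {n} → Rel (F[T][X]≤ n) ℓ
  P ≈ᴾ Q = ∀ i k → [T^ k ] (P i) ≈ [T^ k ] (Q i)

  eval : ∀ {n} → F[T][X]≤ n → Laurent → Laurent
  eval P ξ = sumᴸ (λ i → embed (P i) *ᴸ (ξ ^ᴸ toℕ i))

  Height_≡_ : ∀ {n} → F[T][X]≤ n → ℚ → Set ℓ
  Height P ≡ h =
      (∃[ i ] ∣ embed (P i) ∣≡ h)
    × (∀ i x → ∣ embed (P i) ∣≡ x → x ℚ.≤ h)

  InfinitelyMany : ∀ {n a} → Pred (F[T][X]≤ n) a → Set (c ⊔ ℓ ⊔ a)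
  InfinitelyMany S = ∀ Qs → ∃[ P ] (S P × All (λ Q → ¬ (P ≈ᴾ Q)) Qs)

  Approximates : ∀ {n} → Laurent → ℝ → Pred (F[T][X]≤ n) ℓ
  Approximates ξ w P =
    ∃[ x ] ∃[ h ] (∣ eval P ξ ∣≡ x × Height P ≡ h × 0ℚ ℚ.< x × x ≤ h ^- w)

  exponent : ℕ → Laurent → ℝ∞ (lsuc 0ℓ ⊔ c ⊔ ℓ)
  exponent n ξ = supremum (λ w → InfinitelyMany {n} (Approximates ξ w))

  -- Indexed so that n runs over the positive integers k + 1.

  limsupExponent : Laurent → ℝ∞ (lsuc 0ℓ ⊔ c ⊔ ℓ)
  limsupExponent ξ = limsup (λ k → exponent (suc k) ξ ÷ suc k)

  IsTNumber : Pred Laurent (lsuc 0ℓ ⊔ c ⊔ ℓ)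
  IsTNumber ξ =
    limsupExponent ξ ≡+∞ × (∀ n → 1 ℕ.≤ n → exponent n ξ <+∞)

-- With u = 1/T take ξ = Σₛ c(s) u^(qˢ) for a sequence c of bits, so that
-- ξ^q has the same shape with c delayed by one.
--
-- Lower bounds.  A polynomial P(X) of degree at most n divides some linearised
-- polynomial M(X) = Σ_{i ≤ n} aᵢ X^(qⁱ) ≠ 0 of height at most H(P)^O(1), so it
-- suffices to bound |M(ξ)| from below.  For large s the terms of M(ξ) at
-- u^(qˢ) are Σᵢ aᵢ c(s - i) and do not interfere with the others.  Hence
-- |P(ξ)| ≥ H(P)^(-C) as soon as c satisfies no linear recurrence of order n on
-- long windows, which holds if in every long window there are two subwindows
-- of length 2n + 1 that differ at the centre only.
--
-- Upper bounds.  If c(s) = c(s - w) for t < s < t + 2w, then ξ - ξ^(q^w) is a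
-- rational function with denominator T^(q^t) up to u^(q^(t + 2w)).  With
-- infinitely many such t this gives w_n(ξ) ≥ n² - 1 for n = q^w.
--
-- A Toeplitz sequence c has both properties for all n and for arbitrarily
-- large w, and still leaves infinitely many bits free for a diagonal argument.

module Submission where

open import Level using (Level; _⊔_)
open import Algebra.Bundles using (CommutativeRing)
open import Data.Nat.Base as ℕ using (ℕ; zero; suc; _≤_; _<_; z≤n; s≤s; _∸_; NonZero)
import Data.Nat.Properties as ℕ
open import Data.Product.Base using (_×_; _,_; ∃-syntax; proj₁; proj₂)
open import Data.Sum.Base using (_⊎_; inj₁; inj₂)
open import Data.Empty using (⊥-elim)
open import Function.Base using (_∘_; _$_)
open import Relation.Binary.PropositionalEquality as ≡ using (_≡_; _≢_; refl)
open import Relation.Nullary using (¬_; Dec; yes; no)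
open import Data.Fin.Base as Fin using (Fin; toℕ; inject₁)
open import Relation.Binary.Definitions using (tri<; tri≈; tri>)
open import Data.Nat.Induction using (<-rec)
open import Data.Nat.Combinatorics using (_C_; nCn≡1; nCk≡n!/k![n-k]!; k![n∸k]!∣n!)
open import Data.Nat.Divisibility using (_∣_; _∤_; divides; ∣⇒≤; m∣m*n; ∣m+n∣m⇒∣n; ∣m∣n⇒∣m+n; ∣-refl; _∣?_; n∣m*n)
open import Data.Nat.DivMod using (m/n*n≡m; _/_; _%_; [m+kn]%n≡m%n; m*n%n≡0; m*n/n≡m; +-distrib-/-∣ʳ; m<n⇒m%n≡m; m≡m%n+[m/n]*n; m%n<n; m<n*o⇒m/o<n)
open import Data.Nat.Primality using (Prime; euclidsLemma; prime⇒nonZero; prime⇒nonTrivial)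
open import Data.Bool.Base using (Bool; true; false)
import Data.Fin.Properties as Fin
open import Data.Fin.Permutation using (Permutation; permutation)
open import Function.Bundles using (Inverse)
open import Relation.Nullary.Decidable using (map′; decidable-stable)
import Relation.Binary.Reasoning.Setoid as SetoidReasoning
open import Defs
import Algebra.Definitions.RawSemiring as RawSemiringOps
open import Data.Integer.Base as ℤ using (ℤ; +_; -[1+_])
import Data.Integer.Properties as ℤ
open import Data.Integer.Tactic.RingSolver using (solve-∀)
open import Data.List.Base as List using (List; []; _∷_; length; applyUpTo)
open import Data.Rational.Base as ℚ using (ℚ; 0ℚ; 1ℚ; mkℚ; ↥_; ↧_)
import Data.Nat.Coprimality as Coprimality
import Data.Rational.Properties as ℚ
open import Data.Rational.Unnormalised.Base as ℚᵘ using (mkℚᵘ; *≡*)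
import Data.Rational.Unnormalised.Properties as ℚᵘ
open import Data.List.Relation.Unary.All as All using (All; []; _∷_)
open import Data.List.Membership.Propositional.Properties using (∈-map⁺; ∈-allFin)

-- The two demands on c conflict: large exponents need long repetitions, finite ones forbid short
-- recurrences. They are reconciled by scale. Recurrences of order n are broken at place n of the
-- base 6 expansion, within a distance depending on n alone; a repetition of period 6^j serves the
-- degree q^(6^j), for which recurrences are broken at a far higher place. A gap of two periods
-- compares three consecutive blocks, hence the equal digits 1, 2, 3; with 0 passing to the next
-- place and 4 and 5 for the other tasks, the base is 6. All estimates take place in F[[u]]. A
-- polynomial whose coefficients have T-degree at most h is multiplied by u^h, and a lower bound for
-- |P(ξ)| becomes an upper bound, linear in h, for the order of a power series. That M is nonzero is
-- not shown beforehand. From U P = M, vanishing of P(ξ) to high order passes to M(ξ), forces every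
-- aᵢ to be 0 and then U to be 0, whereas U and M were not both 0. Orders of series are not
-- computable, so the argument refutes a decidable inequality between natural numbers.

-- Formal power series as a commutative ring.

module PowerSeries {c ℓ} (R : CommutativeRing c ℓ) where

  open CommutativeRing R hiding (refl)
  open CommutativeRing R using () renaming (refl to ≈-refl)
  open import Relation.Binary.Reasoning.Setoid setoid
  open import Algebra.Properties.CommutativeSemigroup +-commutativeSemigroup
    using (interchange)

  Series : Set c
  Series = ℕ → Carrier

  tail : Series → Series
  tail f = f ∘ suc

  infixl 7 _⊛_
  -- The Cauchy product, with the left factor peeled off one coefficient at a time: the ring laws
  -- become inductions on the degree, without reindexing of finite sums.
  _⊛_ : Series → Series → Series
  (f ⊛ g) zero    = f 0 * g 0
  (f ⊛ g) (suc k) = f 0 * g (suc k) + (tail f ⊛ g) k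

  const : Carrier → Series
  const a zero    = a
  const a (suc _) = 0#

  infix 4 _≋_
  _≋_ : Series → Series → Set ℓ
  f ≋ g = ∀ k → f k ≈ g k

  ⊛-cong : ∀ {f f′ g g′} → f ≋ f′ → g ≋ g′ → f ⊛ g ≋ f′ ⊛ g′
  ⊛-cong p r zero    = *-cong (p 0) (r 0)
  ⊛-cong p r (suc k) = +-cong (*-cong (p 0) (r (suc k))) (⊛-cong (p ∘ suc) r k)

  -- The defining recursion read from the right factor, with the head product swapped, so that
  -- commutativity is a single induction.
  ⊛-tailʳ : ∀ f g k → (f ⊛ g) (suc k) ≈ g 0 * f (suc k) + (f ⊛ tail g) k
  ⊛-tailʳ f g zero = begin
    f 0 * g 1 + f 1 * g 0 ≈⟨ +-comm _ _ ⟩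
    f 1 * g 0 + f 0 * g 1 ≈⟨ +-congʳ (*-comm _ _) ⟩
    g 0 * f 1 + f 0 * g 1 ∎
  ⊛-tailʳ f g (suc k) = begin
    f 0 * g (2 ℕ.+ k) + (tail f ⊛ g) (suc k)
      ≈⟨ +-congˡ (⊛-tailʳ (tail f) g k) ⟩
    f 0 * g (2 ℕ.+ k) + (g 0 * f (2 ℕ.+ k) + (tail f ⊛ tail g) k)
      ≈⟨ +-assoc _ _ _ ⟨
    f 0 * g (2 ℕ.+ k) + g 0 * f (2 ℕ.+ k) + (tail f ⊛ tail g) k
      ≈⟨ +-congʳ (+-comm _ _) ⟩
    g 0 * f (2 ℕ.+ k) + f 0 * g (2 ℕ.+ k) + (tail f ⊛ tail g) k
      ≈⟨ +-assoc _ _ _ ⟩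
    g 0 * f (2 ℕ.+ k) + (f ⊛ tail g) (suc k) ∎

  ⊛-comm : ∀ f g → f ⊛ g ≋ g ⊛ f
  ⊛-comm f g zero    = *-comm _ _
  ⊛-comm f g (suc k) = begin
    (f ⊛ g) (suc k)                   ≈⟨ ⊛-tailʳ f g k ⟩
    g 0 * f (suc k) + (f ⊛ tail g) k  ≈⟨ +-congˡ (⊛-comm f (tail g) k) ⟩
    g 0 * f (suc k) + (tail g ⊛ f) k  ∎

  ⊛-distribʳ : ∀ h f g → (λ k → f k + g k) ⊛ h ≋ (λ k → (f ⊛ h) k + (g ⊛ h) k)
  ⊛-distribʳ h f g zero    = distribʳ _ _ _
  ⊛-distribʳ h f g (suc k) = begin
    (f 0 + g 0) * h (suc k) + ((λ i → f (suc i) + g (suc i)) ⊛ h) k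
      ≈⟨ +-cong (distribʳ _ _ _) (⊛-distribʳ h (tail f) (tail g) k) ⟩
    (f 0 * h (suc k) + g 0 * h (suc k)) + ((tail f ⊛ h) k + (tail g ⊛ h) k)
      ≈⟨ interchange _ _ _ _ ⟩
    (f ⊛ h) (suc k) + (g ⊛ h) (suc k) ∎

  ⊛-scaleˡ : ∀ a f g → (λ k → a * f k) ⊛ g ≋ (λ k → a * (f ⊛ g) k)
  ⊛-scaleˡ a f g zero    = *-assoc _ _ _
  ⊛-scaleˡ a f g (suc k) = begin
    a * f 0 * g (suc k) + ((λ i → a * f (suc i)) ⊛ g) k
      ≈⟨ +-cong (*-assoc _ _ _) (⊛-scaleˡ a (tail f) g k) ⟩
    a * (f 0 * g (suc k)) + a * (tail f ⊛ g) k
      ≈⟨ distribˡ _ _ _ ⟨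
    a * (f ⊛ g) (suc k) ∎

  ⊛-assoc : ∀ f g h → (f ⊛ g) ⊛ h ≋ f ⊛ (g ⊛ h)
  ⊛-assoc f g h zero    = *-assoc _ _ _
  ⊛-assoc f g h (suc k) = begin
    f 0 * g 0 * h (suc k) + ((λ i → f 0 * g (suc i) + (tail f ⊛ g) i) ⊛ h) k
      ≈⟨ +-cong (*-assoc _ _ _) (⊛-distribʳ h (λ i → f 0 * g (suc i)) (tail f ⊛ g) k) ⟩
    f 0 * (g 0 * h (suc k)) + (((λ i → f 0 * g (suc i)) ⊛ h) k + ((tail f ⊛ g) ⊛ h) k)
      ≈⟨ +-congˡ (+-cong (⊛-scaleˡ (f 0) (tail g) h k) (⊛-assoc (tail f) g h k)) ⟩
    f 0 * (g 0 * h (suc k)) + (f 0 * (tail g ⊛ h) k + (tail f ⊛ (g ⊛ h)) k)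
      ≈⟨ +-assoc _ _ _ ⟨
    f 0 * (g 0 * h (suc k)) + f 0 * (tail g ⊛ h) k + (tail f ⊛ (g ⊛ h)) k
      ≈⟨ +-congʳ (distribˡ _ _ _) ⟨
    f 0 * (g ⊛ h) (suc k) + (tail f ⊛ (g ⊛ h)) k ∎

  ⊛-zeroˡ : ∀ g → (λ _ → 0#) ⊛ g ≋ (λ _ → 0#)
  ⊛-zeroˡ g zero    = zeroˡ _
  ⊛-zeroˡ g (suc k) = trans (+-cong (zeroˡ _) (⊛-zeroˡ g k)) (+-identityʳ _)

  ⊛-constˡ : ∀ a f → const a ⊛ f ≋ (λ k → a * f k)
  ⊛-constˡ a f zero    = ≈-refl
  ⊛-constˡ a f (suc k) = trans (+-congˡ (⊛-zeroˡ f k)) (+-identityʳ _)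

  ⊛-identityˡ : ∀ f → const 1# ⊛ f ≋ f
  ⊛-identityˡ f k = trans (⊛-constˡ 1# f k) (*-identityˡ _)

  seriesRing : CommutativeRing c ℓ
  seriesRing = record
    { Carrier = Series
    ; _≈_ = _≋_
    ; _+_ = λ f g k → f k + g k
    ; _*_ = _⊛_
    ; -_ = λ f k → - f k
    ; 0# = λ _ → 0#
    ; 1# = const 1#
    ; isCommutativeRing = record
      { isRing = record
        { +-isAbelianGroup = record
          { isGroup = record
            { isMonoid = record
              { isSemigroup = record
                { isMagma = record
                  { isEquivalence = record
                    { refl  = λ _ → ≈-refl
                    ; sym   = λ p k → sym (p k)
                    ; trans = λ p r k → trans (p k) (r k)
                    }
                  ; ∙-cong = λ p r k → +-cong (p k) (r k)
                  }
                ; assoc = λ f g h k → +-assoc _ _ _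
                }
              ; identity = (λ f k → +-identityˡ _) , (λ f k → +-identityʳ _)
              }
            ; inverse = (λ f k → -‿inverseˡ _) , (λ f k → -‿inverseʳ _)
            ; ⁻¹-cong = λ p k → -‿cong (p k)
            }
          ; comm = λ f g k → +-comm _ _
          }
        ; *-cong = ⊛-cong
        ; *-assoc = ⊛-assoc
        ; *-identity = ⊛-identityˡ
                     , (λ f k → trans (⊛-comm f (const 1#) k) (⊛-identityˡ f k))
        ; distrib = (λ f g h k → trans (⊛-comm f _ k)
                        (trans (⊛-distribʳ f g h k) (+-cong (⊛-comm g f k) (⊛-comm h f k))))
                  , ⊛-distribʳ
        }
      ; *-comm = ⊛-comm
      }
    }

  ⊛-vanish : ∀ f g k → (∀ i j → i ℕ.+ j ≡ k → f i * g j ≈ 0#) → (f ⊛ g) k ≈ 0#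
  ⊛-vanish f g zero    v = v 0 0 refl
  ⊛-vanish f g (suc k) v = trans
    (+-cong (v 0 (suc k) refl) (⊛-vanish (tail f) g k λ i j e → v (suc i) j (≡.cong suc e)))
    (+-identityʳ _)

  ⊛-single : ∀ f g i j → (∀ i′ j′ → i′ ℕ.+ j′ ≡ i ℕ.+ j → i′ ≢ i → f i′ * g j′ ≈ 0#) →
             (f ⊛ g) (i ℕ.+ j) ≈ f i * g j
  ⊛-single f g zero zero v = ≈-refl
  ⊛-single f g zero (suc j) v = trans
    (+-congˡ (⊛-vanish (tail f) g j λ i′ j′ e → v (suc i′) j′ (≡.cong suc e) λ ()))
    (+-identityʳ _)
  ⊛-single f g (suc i) j v = trans
    (+-cong (v 0 (suc (i ℕ.+ j)) refl λ ())
            (⊛-single (tail f) g i j λ i′ j′ e ne →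
               v (suc i′) j′ (≡.cong suc e) (ne ∘ ℕ.suc-injective)))
    (+-identityˡ _)

  ⊛-closed : ∀ {p} (P : Carrier → Set p) → (∀ {x y} → P x → P y → P (x + y)) →
             ∀ f g → (∀ i j → P (f i * g j)) → ∀ k → P ((f ⊛ g) k)
  ⊛-closed P P-+ f g Pfg zero    = Pfg 0 0
  ⊛-closed P P-+ f g Pfg (suc k) =
    P-+ (Pfg 0 (suc k)) (⊛-closed P P-+ (tail f) g (Pfg ∘ suc) k)

  VanishesFrom : ℕ → Series → Set ℓ
  VanishesFrom n f = ∀ k → n ≤ k → f k ≈ 0#

  -- In any product f i * g j of total degree at least m + n, either i ≥ m or j > n. Having `suc` on
  -- one side only avoids a predecessor in the conclusion.
  ⊛-vanishesFrom : ∀ {f g m n} → VanishesFrom m f → VanishesFrom (suc n) g →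
                   VanishesFrom (m ℕ.+ n) (f ⊛ g)
  ⊛-vanishesFrom {f} {g} {m} {n} vf vg k m+n≤k = ⊛-vanish f g k λ i j e → go i j e
    where
    go : ∀ i j → i ℕ.+ j ≡ k → f i * g j ≈ 0#
    go i j e with m ℕ.≤? i
    ... | yes m≤i = trans (*-congʳ (vf i m≤i)) (zeroˡ _)
    ... | no  m≰i = trans (*-congˡ (vg j n<j)) (zeroʳ _)
      where
      n<j : n < j
      n<j = ℕ.+-cancelˡ-< i n j
        (ℕ.<-≤-trans (ℕ.+-monoˡ-< n (ℕ.≰⇒> m≰i)) (ℕ.≤-trans m+n≤k (ℕ.≤-reflexive (≡.sym e))))

  ⊛-low : ∀ {f g n} → (∀ m → m < n → g m ≈ 0#) → ∀ m → m < n → (f ⊛ g) m ≈ 0#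
  ⊛-low {f} {g} vg m m<n = ⊛-vanish f g m λ i j e →
    trans (*-congˡ (vg j (ℕ.≤-<-trans (ℕ.≤-trans (ℕ.m≤n+m j i) (ℕ.≤-reflexive e)) m<n))) (zeroʳ _)

  shift : ℕ → Series → Series
  shift zero    f         = f
  shift (suc n) f zero    = 0#
  shift (suc n) f (suc k) = shift n f k

  shift-+ : ∀ n f k → shift n f (n ℕ.+ k) ≡ f k
  shift-+ zero    f k = refl
  shift-+ (suc n) f k = shift-+ n f k

  shift-< : ∀ n f k → k < n → shift n f k ≡ 0#
  shift-< (suc n) f zero    _       = refl
  shift-< (suc n) f (suc k) (s≤s p) = shift-< n f k p

  shift-cong : ∀ n {f g} → f ≋ g → shift n f ≋ shift n g
  shift-cong zero    p k       = p k
  shift-cong (suc n) p zero    = ≈-refl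
  shift-cong (suc n) p (suc k) = shift-cong n p k

  shift-⊛ : ∀ n f g → shift n f ⊛ g ≋ shift n (f ⊛ g)
  shift-⊛ zero    f g k       = ≈-refl
  shift-⊛ (suc n) f g zero    = zeroˡ _
  shift-⊛ (suc n) f g (suc k) =
    trans (+-congʳ (zeroˡ _)) (trans (+-identityˡ _) (shift-⊛ n f g k))

-- Integral domains without decidable equality.

module _ {c ℓ} (R : CommutativeRing c ℓ) where

  open CommutativeRing R

  Regular : Carrier → Set (c ⊔ ℓ)
  Regular p = ∀ u → u * p ≈ 0# → u ≈ 0#

  -- Equality of power series is not decidable. Stability under double negation replaces
  -- decidability: it permits reasoning with a lowest nonzero coefficient, which exists only up to
  -- double negation.
  record IsDomain : Set (c ⊔ ℓ) where
    field
      stable  : ∀ {x y} → ¬ ¬ (x ≈ y) → x ≈ y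
      regular : ∀ {p} → p ≉ 0# → Regular p

¬¬-least : ∀ {p} (P : ℕ → Set p) n → P n →
           ¬ ¬ (∃[ m ] (P m × (∀ i → i < m → ¬ P i)))
¬¬-least P n Pn k = go (suc n) n ℕ.≤-refl Pn
  where
  go : ∀ b i → i < b → ¬ P i
  go (suc b) i (s≤s i≤b) Pi = k (i , Pi , λ j j<i → go b j (ℕ.<-≤-trans j<i i≤b))

module _ {c ℓ} {R : CommutativeRing c ℓ} (R-domain : IsDomain R) where

  open CommutativeRing R hiding (refl)
  open PowerSeries R
  open IsDomain R-domain

  -- In degree n + i of u f, the factors u m with m < n vanish by induction and the f j with j < i
  -- by hypothesis; only u n * f i remains.
  leading-regular : ∀ {f i} → f i ≉ 0# → (∀ j → j < i → f j ≈ 0#) → Regular seriesRing f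
  leading-regular {f} {i} fi≉0 low u uf≈0 = <-rec _ λ n ih →
    regular fi≉0 (u n) $ trans (sym (⊛-single u f n i (term n λ m → ih {m}))) (uf≈0 (n ℕ.+ i))
    where
    term : ∀ n → (∀ m → m < n → u m ≈ 0#) → ∀ m j → m ℕ.+ j ≡ n ℕ.+ i → m ≢ n → u m * f j ≈ 0#
    term n ih m j e m≢n with ℕ.<-cmp m n
    ... | tri< m<n _ _ = trans (*-congʳ (ih m m<n)) (zeroˡ _)
    ... | tri≈ _ m≡n _ = ⊥-elim (m≢n m≡n)
    ... | tri> _ _ n<m = trans (*-congˡ (low j j<i)) (zeroʳ _)
      where
      j<i : j < i
      j<i = ℕ.+-cancelˡ-< n j i (ℕ.<-≤-trans (ℕ.+-monoˡ-< j n<m) (ℕ.≤-reflexive e))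

  -- Stated for an abstract domain so that it can be applied twice, to reach polynomials in X over
  -- F[[u]].
  seriesRing-domain : IsDomain seriesRing
  seriesRing-domain = record
    { stable  = λ ¬¬f≋g k → stable λ ¬p → ¬¬f≋g λ p → ¬p (p k)
    ; regular = λ {f} f≉0 u uf≈0 k → stable λ uk≉0 → f≉0 λ i → stable λ fi≉0 →
        ¬¬-least (λ i → f i ≉ 0#) i fi≉0 λ (m , fm≉0 , low) →
          uk≉0 (leading-regular fm≉0 (λ j j<m → stable (low j j<m)) u uf≈0 k)
    }

-- Polynomials and their evaluation.

-- Polynomials are series together with a bound on their degree.
module Evaluation {c ℓ} (R : CommutativeRing c ℓ) (z : CommutativeRing.Carrier R) where

  open CommutativeRing R hiding (refl)
  open CommutativeRing R using () renaming (refl to ≈-refl)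
  open PowerSeries R
  open import Algebra.Properties.Semiring.Exp semiring using (_^_)
  open import Algebra.Properties.Semiring.Sum semiring
    using (sum; sum-cong-≋; *-distribˡ-sum)
  open import Algebra.Properties.CommutativeSemigroup +-commutativeSemigroup
    using (interchange)
  open import Algebra.Properties.CommutativeSemigroup *-commutativeSemigroup
    using (x∙yz≈y∙xz)
  open import Relation.Binary.Reasoning.Setoid setoid

  evaluate : ℕ → Series → Carrier
  evaluate zero    f = 0#
  evaluate (suc n) f = f 0 + z * evaluate n (tail f)

  eval-cong : ∀ n {f g} → (∀ i → i < n → f i ≈ g i) → evaluate n f ≈ evaluate n g
  eval-cong zero    p = ≈-refl
  eval-cong (suc n) p =
    +-cong (p 0 (s≤s z≤n)) (*-congˡ (eval-cong n λ i i<n → p (suc i) (s≤s i<n)))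

  eval-0 : ∀ n → evaluate n (λ _ → 0#) ≈ 0#
  eval-0 zero    = ≈-refl
  eval-0 (suc n) = trans (+-congˡ (trans (*-congˡ (eval-0 n)) (zeroʳ _))) (+-identityʳ _)

  eval-+ : ∀ n f g → evaluate n (λ i → f i + g i) ≈ evaluate n f + evaluate n g
  eval-+ zero    f g = sym (+-identityʳ _)
  eval-+ (suc n) f g = begin
    f 0 + g 0 + z * evaluate n (λ i → f (suc i) + g (suc i))
      ≈⟨ +-congˡ (*-congˡ (eval-+ n (tail f) (tail g))) ⟩
    f 0 + g 0 + z * (evaluate n (tail f) + evaluate n (tail g))
      ≈⟨ +-congˡ (distribˡ _ _ _) ⟩
    f 0 + g 0 + (z * evaluate n (tail f) + z * evaluate n (tail g))
      ≈⟨ interchange _ _ _ _ ⟩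
    evaluate (suc n) f + evaluate (suc n) g ∎

  eval-scale : ∀ n a f → evaluate n (λ i → a * f i) ≈ a * evaluate n f
  eval-scale zero    a f = sym (zeroʳ _)
  eval-scale (suc n) a f = begin
    a * f 0 + z * evaluate n (λ i → a * f (suc i))  ≈⟨ +-congˡ (*-congˡ (eval-scale n a (tail f))) ⟩
    a * f 0 + z * (a * evaluate n (tail f))         ≈⟨ +-congˡ (x∙yz≈y∙xz _ _ _) ⟩
    a * f 0 + a * (z * evaluate n (tail f))         ≈⟨ distribˡ _ _ _ ⟨
    a * evaluate (suc n) f ∎

  eval-≥ : ∀ {n f} m → VanishesFrom n f → evaluate (n ℕ.+ m) f ≈ evaluate n f
  eval-≥ {zero} {f} m v = trans (eval-cong m λ i _ → v i z≤n) (eval-0 m)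
  eval-≥ {suc n} {f} m v = +-congˡ (*-congˡ (eval-≥ {n} m λ k n≤k → v (suc k) (s≤s n≤k)))

  eval-⊛ : ∀ m n {f g} → VanishesFrom m f → VanishesFrom n g →
           evaluate (m ℕ.+ n) (f ⊛ g) ≈ evaluate m f * evaluate n g
  eval-⊛ zero n {f} {g} vf vg = begin
    evaluate n (f ⊛ g)       ≈⟨ eval-cong n (λ i _ → trans (⊛-cong (λ k → vf k z≤n) (λ _ → ≈-refl) i) (⊛-zeroˡ g i)) ⟩
    evaluate n (λ _ → 0#)    ≈⟨ eval-0 n ⟩
    0#                   ≈⟨ zeroˡ _ ⟨
    0# * evaluate n g        ∎
  eval-⊛ (suc m) n {f} {g} vf vg = begin
    f 0 * g 0 + z * evaluate (m ℕ.+ n) (λ i → f 0 * g (suc i) + (tail f ⊛ g) i)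
      ≈⟨ +-congˡ (*-congˡ (eval-+ (m ℕ.+ n) (λ i → f 0 * g (suc i)) (tail f ⊛ g))) ⟩
    f 0 * g 0 + z * (evaluate (m ℕ.+ n) (λ i → f 0 * g (suc i)) + evaluate (m ℕ.+ n) (tail f ⊛ g))
      ≈⟨ +-congˡ (distribˡ _ _ _) ⟩
    f 0 * g 0 + (z * evaluate (m ℕ.+ n) (λ i → f 0 * g (suc i)) + z * evaluate (m ℕ.+ n) (tail f ⊛ g))
      ≈⟨ +-assoc _ _ _ ⟨
    evaluate (suc m ℕ.+ n) (λ i → f 0 * g i) + z * evaluate (m ℕ.+ n) (tail f ⊛ g)
      ≈⟨ +-cong head (*-congˡ (eval-⊛ m n (λ k m≤k → vf (suc k) (s≤s m≤k)) vg)) ⟩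
    f 0 * evaluate n g + z * (evaluate m (tail f) * evaluate n g)
      ≈⟨ +-congˡ (*-assoc _ _ _) ⟨
    f 0 * evaluate n g + z * evaluate m (tail f) * evaluate n g
      ≈⟨ distribʳ _ _ _ ⟨
    evaluate (suc m) f * evaluate n g ∎
    where
    head : evaluate (suc m ℕ.+ n) (λ i → f 0 * g i) ≈ f 0 * evaluate n g
    head = begin
      evaluate (suc m ℕ.+ n) (λ i → f 0 * g i) ≈⟨ eval-scale (suc m ℕ.+ n) (f 0) g ⟩
      f 0 * evaluate (suc m ℕ.+ n) g           ≡⟨ ≡.cong (λ k → f 0 * evaluate k g) (ℕ.+-comm (suc m) n) ⟩
      f 0 * evaluate (n ℕ.+ suc m) g           ≈⟨ *-congˡ (eval-≥ (suc m) vg) ⟩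
      f 0 * evaluate n g                       ∎

  monomial : ℕ → Carrier → Series
  monomial e a = shift e (const a)

  eval-monomial : ∀ n e a → e < n → evaluate n (monomial e a) ≈ a * z ^ e
  eval-monomial (suc n) zero a _ = begin
    a + z * evaluate n (λ _ → 0#) ≈⟨ +-congˡ (trans (*-congˡ (eval-0 n)) (zeroʳ _)) ⟩
    a + 0#                    ≈⟨ +-identityʳ _ ⟩
    a                         ≈⟨ *-identityʳ _ ⟨
    a * 1#                    ∎
  eval-monomial (suc n) (suc e) a (s≤s e<n) = begin
    0# + z * evaluate n (monomial e a)  ≈⟨ +-identityˡ _ ⟩
    z * evaluate n (monomial e a)       ≈⟨ *-congˡ (eval-monomial n e a e<n) ⟩
    z * (a * z ^ e)                 ≈⟨ x∙yz≈y∙xz _ _ _ ⟩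
    a * z ^ suc e                   ∎

  eval-sum : ∀ n f → evaluate n f ≈ sum {n} (λ i → f (toℕ i) * z ^ toℕ i)
  eval-sum zero    f = ≈-refl
  eval-sum (suc n) f = +-cong (sym (*-identityʳ _)) (begin
    z * evaluate n (tail f)
      ≈⟨ *-congˡ (eval-sum n (tail f)) ⟩
    z * sum {n} (λ i → f (suc (toℕ i)) * z ^ toℕ i)
      ≈⟨ *-distribˡ-sum z (λ (i : Fin n) → f (suc (toℕ i)) * z ^ toℕ i) ⟩
    sum {n} (λ i → z * (f (suc (toℕ i)) * z ^ toℕ i))
      ≈⟨ sum-cong-≋ (λ (i : Fin n) → x∙yz≈y∙xz z (f (suc (toℕ i))) (z ^ toℕ i)) ⟩
    sum {n} (λ i → f (suc (toℕ i)) * z ^ suc (toℕ i)) ∎)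

-- Additivity of the Frobenius map.

prime∣k!⇒≤ : ∀ {p} → Prime p → ∀ k → p ∣ k ℕ.! → p ≤ k
prime∣k!⇒≤ pr zero p∣1 = ⊥-elim (ℕ.<⇒≱ (ℕ.nonTrivial⇒n>1 _ {{prime⇒nonTrivial pr}}) (∣⇒≤ p∣1))
prime∣k!⇒≤ pr (suc k) p∣ with euclidsLemma (suc k) (k ℕ.!) pr p∣
... | inj₁ p∣1+k = ∣⇒≤ p∣1+k
... | inj₂ p∣k!  = ℕ.m≤n⇒m≤1+n (prime∣k!⇒≤ pr k p∣k!)

-- The prime p divides p! = (p C k) k! (p - k)!, but neither of the two factorials on the right,
-- whose arguments are below p.
prime∣pCk : ∀ {p} → Prime p → ∀ {k} → 0 < k → k < p → p ∣ p C k
prime∣pCk {p@(suc p-1)} pr {k} 0<k k<p with euclidsLemma (p C k) (k ℕ.! ℕ.* (p ∸ k) ℕ.!) pr p∣product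
  where
  instance _ = ℕ._!*_!≢0 k (p ∸ k)
  p∣product : p ∣ (p C k) ℕ.* (k ℕ.! ℕ.* (p ∸ k) ℕ.!)
  p∣product = ≡.subst (p ∣_)
    (≡.sym (≡.trans (≡.cong (ℕ._* (k ℕ.! ℕ.* (p ∸ k) ℕ.!)) (nCk≡n!/k![n-k]! (ℕ.<⇒≤ k<p)))
                    (m/n*n≡m (k![n∸k]!∣n! (ℕ.<⇒≤ k<p)))))
    (m∣m*n (p-1 ℕ.!))
... | inj₁ p∣C = p∣C
... | inj₂ p∣d with euclidsLemma (k ℕ.!) ((p ∸ k) ℕ.!) pr p∣d
...   | inj₁ p∣k! = ⊥-elim (ℕ.<⇒≱ k<p (prime∣k!⇒≤ pr k p∣k!))
...   | inj₂ p∣r! = ⊥-elim (ℕ.<⇒≱ (ℕ.∸-monoʳ-< 0<k (ℕ.<⇒≤ k<p)) (prime∣k!⇒≤ pr (p ∸ k) p∣r!))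

module Frobenius {c ℓ} (R : CommutativeRing c ℓ) {p} (p-prime : Prime p) where

  open CommutativeRing R hiding (refl)
  open import Algebra.Properties.Semiring.Exp semiring
  open import Algebra.Properties.Semiring.Mult semiring using (×-homo-1)
    renaming (_×_ to _·_; ×-assocˡ to ·-assocˡ; ×-congʳ to ·-congʳ)
  open import Algebra.Properties.Semiring.Sum semiring using (sum; sum-cong-≋; sum-init-last; sum-replicate-zero)
  open import Algebra.Properties.CommutativeSemiring.Binomial commutativeSemiring
    using (binomialTerm; theorem)
  open import Relation.Binary.Reasoning.Setoid setoid

  module _ (char : ∀ x → p · x ≈ 0#) where

    ∣⇒·≈0 : ∀ {n} → p ∣ n → ∀ x → n · x ≈ 0#
    ∣⇒·≈0 (divides m refl) x = begin
      (m ℕ.* p) · x  ≡⟨ ≡.cong (_· x) (ℕ.*-comm m p) ⟩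
      (p ℕ.* m) · x  ≈⟨ ·-assocˡ x p m ⟨
      p · (m · x)    ≈⟨ char (m · x) ⟩
      0#             ∎

    ^p-distrib-+ : ∀ x y → (x + y) ^ p ≈ x ^ p + y ^ p
    ^p-distrib-+ x y = go p refl
      where
      -- With a variable in place of p, the exponent can be matched as `suc k`, which exposes the
      -- first and the last binomial term.
      go : ∀ k → k ≡ p → (x + y) ^ k ≈ x ^ k + y ^ k
      go zero    0≡p = ⊥-elim (ℕ.≢-nonZero⁻¹ p {{prime⇒nonZero p-prime}} (≡.sym 0≡p))
      go (suc k) refl = begin
        (x + y) ^ suc k
          ≈⟨ theorem (suc k) x y ⟩
        term Fin.zero + sum (λ i → term (Fin.suc i))
          ≈⟨ +-cong first (sum-init-last (λ i → term (Fin.suc i))) ⟩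
        y ^ suc k + (sum (λ i → term (Fin.suc (inject₁ i))) + term (Fin.suc (Fin.fromℕ k)))
          ≈⟨ +-congˡ (+-cong (trans (sum-cong-≋ middle) (sum-replicate-zero k)) last) ⟩
        y ^ suc k + (0# + x ^ suc k)
          ≈⟨ +-congˡ (+-identityˡ _) ⟩
        y ^ suc k + x ^ suc k
          ≈⟨ +-comm _ _ ⟩
        x ^ suc k + y ^ suc k ∎
        where
        term = binomialTerm x y (suc k)
        first : term Fin.zero ≈ y ^ suc k
        first = trans (×-homo-1 _) (*-identityˡ _)
        middle : ∀ i → term (Fin.suc (inject₁ i)) ≈ 0#
        middle i = ∣⇒·≈0 (prime∣pCk p-prime (s≤s z≤n)
          (s≤s (≡.subst (_< k) (≡.sym (Fin.toℕ-inject₁ i)) (Fin.toℕ<n i)))) _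
        last : term (Fin.suc (Fin.fromℕ k)) ≈ x ^ suc k
        last rewrite Fin.toℕ-fromℕ k | nCn≡1 (suc k) | ℕ.n∸n≡0 k =
          trans (×-homo-1 _) (*-identityʳ _)

    ^pᵉ-distrib-+ : ∀ e x y → (x + y) ^ (p ℕ.^ e) ≈ x ^ (p ℕ.^ e) + y ^ (p ℕ.^ e)
    ^pᵉ-distrib-+ zero    x y = trans (*-identityʳ _) (sym (+-cong (*-identityʳ _) (*-identityʳ _)))
    ^pᵉ-distrib-+ (suc e) x y = begin
      (x + y) ^ (p ℕ.* pᵉ)             ≈⟨ ^-assocʳ (x + y) p pᵉ ⟨
      ((x + y) ^ p) ^ pᵉ               ≈⟨ ^-congˡ pᵉ (^p-distrib-+ x y) ⟩
      (x ^ p + y ^ p) ^ pᵉ             ≈⟨ ^pᵉ-distrib-+ e (x ^ p) (y ^ p) ⟩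
      (x ^ p) ^ pᵉ + (y ^ p) ^ pᵉ      ≈⟨ +-cong (^-assocʳ x p pᵉ) (^-assocʳ y p pᵉ) ⟩
      x ^ (p ℕ.* pᵉ) + y ^ (p ℕ.* pᵉ)  ∎
      where pᵉ = p ℕ.^ e

-- Arithmetic of finite fields.

module FieldProperties {c ℓ q} (F : FiniteField c ℓ q) where

  open FiniteField F
  open CommutativeRing commutativeRing hiding (refl; _≈_; _≉_; _+_; _*_; 0#; 1#; semiring; Carrier)
  open import Algebra.Properties.Semiring.Exp semiring
  open import Algebra.Properties.Semiring.Mult semiring using (×1-homo-*)
    renaming (_×_ to _·_; ×-assoc-* to ·-assoc-*; ×-congʳ to ·-congʳ; ×-homo-1 to ·-homo-1)
  open import Algebra.Properties.CommutativeMonoid.Sum +-commutativeMonoid using (sum; sum-cong-≋; ∑-distrib-+; sum-permute; sum-replicate)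
  open import Algebra.Properties.Group +-group using (identityʳ-unique)
  open import Relation.Binary.Reasoning.Setoid setoid

  open Inverse cardinality public using (to; from; to-cong)

  from-to : ∀ x → from (to x) ≈ x
  from-to x = Inverse.inverseʳ cardinality refl

  to-from : ∀ i → to (from i) ≡ i
  to-from i = Inverse.inverseˡ cardinality (CommutativeRing.refl commutativeRing)

  to-injective : ∀ {x y} → to x ≡ to y → x ≈ y
  to-injective {x} {y} e = trans (sym (from-to x)) (trans (reflexive (≡.cong from e)) (from-to y))

  infix 4 _≈?_
  _≈?_ : ∀ x y → Dec (x ≈ y)
  x ≈? y = map′ to-injective to-cong (to x Fin.≟ to y)

  field-domain : IsDomain commutativeRing
  field-domain = record
    { stable  = decidable-stable (_ ≈? _)
    ; regular = λ {p} p≉0 u up≈0 → let (r , pr≈1) = inverse p p≉0 in begin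
        u            ≈⟨ *-identityʳ u ⟨
        u * 1#       ≈⟨ *-congˡ pr≈1 ⟨
        u * (p * r)  ≈⟨ *-assoc _ _ _ ⟨
        u * p * r    ≈⟨ *-congʳ up≈0 ⟩
        0# * r       ≈⟨ zeroˡ r ⟩
        0#           ∎
    }

  -- Translation by 1 permutes the field, so adding up all elements in both
  -- orders shows q · 1 = 0.
  q·1≈0 : q · 1# ≈ 0#
  q·1≈0 = identityʳ-unique (sum from) (q · 1#) $ sym $ begin
    sum from                        ≈⟨ sum-permute from π ⟩
    sum (λ i → from (to (from i + 1#)))   ≈⟨ sum-cong-≋ (λ i → from-to (from i + 1#)) ⟩
    sum (λ i → from i + 1#)         ≈⟨ ∑-distrib-+ from (λ _ → 1#) ⟩
    sum from + sum {q} (λ _ → 1#)   ≈⟨ +-congˡ (sum-replicate q) ⟩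
    sum from + q · 1#               ∎
    where
    cancel : ∀ {a b} x → a + b ≈ 0# → x + a + b ≈ x
    cancel x e = trans (+-assoc _ _ _) (trans (+-congˡ e) (+-identityʳ x))
    back : ∀ a b i → a + b ≈ 0# → to (from (to (from i + a)) + b) ≡ i
    back a b i e = ≡.trans (to-cong (trans (+-congʳ (from-to _)) (cancel _ e))) (to-from i)
    π : Permutation q q
    π = permutation (λ i → to (from i + 1#)) (λ i → to (from i + - 1#))
      (λ i → back (- 1#) 1# i (-‿inverseˡ 1#))
      (λ i → back 1# (- 1#) i (-‿inverseʳ 1#))

  -- Since pᵉ · 1 is the e-th power of p · 1, a nonzero p · 1 could be cancelled factor by factor
  -- until 1 = 0.
  pᵉ·1≈0⇒p·1≈0 : ∀ p e → (p ℕ.^ e) · 1# ≈ 0# → p · 1# ≈ 0#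
  pᵉ·1≈0⇒p·1≈0 p zero    h = ⊥-elim (0≉1 (sym (trans (sym (·-homo-1 1#)) h)))
  pᵉ·1≈0⇒p·1≈0 p (suc e) h with p · 1# ≈? 0#
  ... | yes p·1≈0 = p·1≈0
  ... | no  p·1≉0 = pᵉ·1≈0⇒p·1≈0 p e (IsDomain.regular field-domain p·1≉0 _
          (trans (*-comm _ _) (trans (sym (×1-homo-* p (p ℕ.^ e))) h)))

  characteristic : ∀ {p e} → q ≡ p ℕ.^ e → ∀ x → p · x ≈ 0#
  characteristic {p} {e} refl x = begin
    p · x         ≈⟨ ·-congʳ p (*-identityˡ x) ⟨
    p · (1# * x)  ≈⟨ ·-assoc-* p 1# x ⟨
    p · 1# * x    ≈⟨ *-congʳ (pᵉ·1≈0⇒p·1≈0 p e q·1≈0) ⟩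
    0# * x        ≈⟨ zeroˡ x ⟩
    0#            ∎

-- The q-th power of a power series.

module FrobeniusSeries {c ℓ} (R : CommutativeRing c ℓ) (q : ℕ) .{{_ : NonZero q}} where

  open CommutativeRing R hiding (refl)
  open PowerSeries R
  module S where
    open CommutativeRing seriesRing public
    open import Algebra.Properties.Semiring.Exp (CommutativeRing.semiring seriesRing) public
  open import Algebra.Properties.Semiring.Exp semiring
  module S-Reasoning = SetoidReasoning S.setoid

  const-^ : ∀ a n → const a S.^ n ≋ const (a ^ n)
  const-^ a zero    = S.refl
  const-^ a (suc n) = begin
    const a ⊛ const a S.^ n      ≈⟨ S.*-congˡ {const a} (const-^ a n) ⟩
    const a ⊛ const (a ^ n)      ≈⟨ ⊛-constˡ a (const (a ^ n)) ⟩
    (λ k → a * const (a ^ n) k)     ≈⟨ (λ { zero → CommutativeRing.refl R ; (suc _) → zeroʳ a }) ⟩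
    const (a ^ suc n)               ∎
    where open S-Reasoning

  shift-^ : ∀ f n → shift 1 f S.^ n ≋ shift n (f S.^ n)
  shift-^ f zero    = S.refl
  shift-^ f (suc n) = begin
    shift 1 f ⊛ shift 1 f S.^ n        ≈⟨ S.*-congˡ {shift 1 f} (shift-^ f n) ⟩
    shift 1 f ⊛ shift n (f S.^ n)      ≈⟨ shift-⊛ 1 f (shift n (f S.^ n)) ⟩
    shift 1 (f ⊛ shift n (f S.^ n))    ≈⟨ shift-cong 1 (⊛-comm f (shift n (f S.^ n))) ⟩
    shift 1 (shift n (f S.^ n) ⊛ f)    ≈⟨ shift-cong 1 (shift-⊛ n (f S.^ n) f) ⟩
    shift 1 (shift n (f S.^ n ⊛ f))    ≈⟨ shift-cong 1 (shift-cong n (⊛-comm (f S.^ n) f)) ⟩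
    shift 1 (shift n (f S.^ suc n))    ≈⟨ (λ { zero → CommutativeRing.refl R ; (suc _) → CommutativeRing.refl R }) ⟩
    shift (suc n) (f S.^ suc n)        ∎
    where open S-Reasoning

  module _ (^q-distrib-+ : ∀ f g → (f S.+ g) S.^ q ≋ f S.^ q S.+ g S.^ q) where

    -- Raising f = f 0 + u `tail f` to the power q gives a recursion for the coefficients of f^q in
    -- steps of q, from which the two lemmas below follow.
    ^q-tail : ∀ f → f S.^ q ≋ const (f 0 ^ q) S.+ shift q (tail f S.^ q)
    ^q-tail f = begin
      f S.^ q
        ≈⟨ S.^-congˡ q split ⟩
      (const (f 0) S.+ shift 1 (tail f)) S.^ q
        ≈⟨ ^q-distrib-+ (const (f 0)) (shift 1 (tail f)) ⟩
      const (f 0) S.^ q S.+ shift 1 (tail f) S.^ q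
        ≈⟨ S.+-cong (const-^ (f 0) q) (shift-^ (tail f) q) ⟩
      const (f 0 ^ q) S.+ shift q (tail f S.^ q) ∎
      where
      open S-Reasoning
      split : f ≋ const (f 0) S.+ shift 1 (tail f)
      split zero    = sym (+-identityʳ _)
      split (suc k) = sym (+-identityˡ _)

    private
      0<q : 0 < q
      0<q = ℕ.>-nonZero⁻¹ q

      const-≢0 : ∀ a {k} → 0 < k → const a k ≡ 0#
      const-≢0 a {suc k} _ = refl

    ^q-multiple : ∀ f j → (f S.^ q) (j ℕ.* q) ≈ f j ^ q
    ^q-multiple f zero    = trans (^q-tail f 0)
      (trans (+-congˡ (reflexive (shift-< q _ 0 0<q))) (+-identityʳ _))
    ^q-multiple f (suc j) = trans (^q-tail f (q ℕ.+ j ℕ.* q)) (trans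
      (+-cong (reflexive (const-≢0 _ (ℕ.<-≤-trans 0<q (ℕ.m≤m+n q (j ℕ.* q)))))
              (trans (reflexive (shift-+ q _ (j ℕ.* q))) (^q-multiple (tail f) j)))
      (+-identityˡ _))

    ^q-nonmultiple : ∀ m f → q ∤ m → (f S.^ q) m ≈ 0#
    ^q-nonmultiple = <-rec _ λ m ih f q∤m → trans (^q-tail f m) (trans
      (+-cong (reflexive (const-≢0 _ (positive m q∤m))) (shifted m ih f q∤m))
      (+-identityˡ _))
      where
      positive : ∀ m → q ∤ m → 0 < m
      positive zero    q∤0 = ⊥-elim (q∤0 (divides 0 refl))
      positive (suc m) _   = s≤s z≤n
      shifted : ∀ m → (∀ {k} → k < m → ∀ f → q ∤ k → (f S.^ q) k ≈ 0#) → ∀ f → q ∤ m →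
                shift q (tail f S.^ q) m ≈ 0#
      shifted m ih f q∤m with m ℕ.<? q
      ... | yes m<q = reflexive (shift-< q _ m m<q)
      ... | no  m≮q = ≡.subst (λ k → shift q (tail f S.^ q) k ≈ 0#) (ℕ.m+[n∸m]≡n q≤m) (trans
              (reflexive (shift-+ q _ (m ∸ q)))
              (ih (ℕ.∸-monoʳ-< 0<q q≤m) (tail f) λ q∣m∸q →
                q∤m (≡.subst (q ∣_) (ℕ.m+[n∸m]≡n q≤m) (∣m∣n⇒∣m+n ∣-refl q∣m∸q))))
        where q≤m = ℕ.≮⇒≥ m≮q

-- The Toeplitz word.

-- A Toeplitz sequence in base 6: the value at (d + 6 y) 6ᵏ depends only on
-- the lowest nonzero digit d and its place k.  Blocks of length 6ᵏ differ at
-- their first letter at most.  Those starting with digit 1, 2, 3 agree, digit 4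
-- against digit 1 rules out short linear recurrences, and digit 5 carries the
-- arbitrary bits x.
module Toeplitz (x : ℕ → Bool) where

  digit : ℕ → ℕ → Bool
  digit k 4 = true
  digit k 5 = x k
  digit k _ = false

  -- The first argument is fuel, the second the current place.
  search      : ℕ → ℕ → ℕ → Bool
  search-step : ℕ → ℕ → ℕ → ℕ → Bool
  search zero    k s = false
  search (suc n) k s = search-step n k (s / 6) (s % 6)
  search-step n k s zero    = search n (suc k) s
  search-step n k s (suc d) = digit k (suc d)

  toeplitz : ℕ → Bool
  toeplitz s = search s 0 s

  private
    place : ∀ m k → m ℕ.* 6 ℕ.^ suc k ≡ m ℕ.* 6 ℕ.^ k ℕ.* 6
    place m k = ≡.trans (≡.cong (m ℕ.*_) (ℕ.*-comm 6 (6 ℕ.^ k))) (≡.sym (ℕ.*-assoc m (6 ℕ.^ k) 6))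

    unfold : ∀ n l s {t d} → s / 6 ≡ t → s % 6 ≡ d → search (suc n) l s ≡ search-step n l t d
    unfold n l s refl refl = refl

    search-digit : ∀ k {n} l y d → k < n → suc d < 6 →
                   search n l ((suc d ℕ.+ y ℕ.* 6) ℕ.* 6 ℕ.^ k) ≡ digit (l ℕ.+ k) (suc d)
    search-digit zero {suc n} l y d _ d<6 = begin
      search (suc n) l ((suc d ℕ.+ y ℕ.* 6) ℕ.* 1)
        ≡⟨ ≡.cong (search (suc n) l) (ℕ.*-identityʳ (suc d ℕ.+ y ℕ.* 6)) ⟩
      search (suc n) l (suc d ℕ.+ y ℕ.* 6)
        ≡⟨ unfold n l (suc d ℕ.+ y ℕ.* 6) refl (≡.trans ([m+kn]%n≡m%n (suc d) y 6) (m<n⇒m%n≡m d<6)) ⟩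
      digit l (suc d)
        ≡⟨ ≡.cong (λ k → digit k (suc d)) (ℕ.+-identityʳ l) ⟨
      digit (l ℕ.+ 0) (suc d) ∎
      where open ≡.≡-Reasoning
    search-digit (suc k) {suc n} l y d (s≤s k<n) d<6 = begin
      search (suc n) l (m ℕ.* 6 ℕ.^ suc k)
        ≡⟨ unfold n l (m ℕ.* 6 ℕ.^ suc k) (≡.trans (≡.cong (_/ 6) (place m k)) (m*n/n≡m (m ℕ.* 6 ℕ.^ k) 6))
                      (≡.trans (≡.cong (_% 6) (place m k)) (m*n%n≡0 (m ℕ.* 6 ℕ.^ k) 6)) ⟩
      search n (suc l) (m ℕ.* 6 ℕ.^ k)
        ≡⟨ search-digit k (suc l) y d k<n d<6 ⟩
      digit (suc l ℕ.+ k) (suc d)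
        ≡⟨ ≡.cong (λ k → digit k (suc d)) (ℕ.+-suc l k) ⟨
      digit (l ℕ.+ suc k) (suc d) ∎
      where
      open ≡.≡-Reasoning
      m = suc d ℕ.+ y ℕ.* 6

    -- Adding a multiple of 6ᵏ leaves the lowest k digits unchanged, and one of these is nonzero, so
    -- the search stops before it can notice. The two runs have different fuel; k is enough for
    -- both.
    search-periodic : ∀ k {m n} l s y → k ≤ m → k ≤ n → 6 ℕ.^ k ∤ s →
                      search m l (s ℕ.+ y ℕ.* 6 ℕ.^ k) ≡ search n l s
    search-periodic zero l s y _ _ ∤s = ⊥-elim (∤s (divides s (≡.sym (ℕ.*-identityʳ s))))
    search-periodic (suc k) {suc m} {suc n} l s y (s≤s k≤m) (s≤s k≤n) ∤s = begin
      search (suc m) l (s ℕ.+ y ℕ.* 6 ℕ.^ suc k)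
        ≡⟨ unfold m l (s ℕ.+ y ℕ.* 6 ℕ.^ suc k) quotient remainder ⟩
      search-step m l (s / 6 ℕ.+ y ℕ.* 6 ℕ.^ k) (s % 6)
        ≡⟨ step (s % 6) refl ⟩
      search-step n l (s / 6) (s % 6) ∎
      where
      open ≡.≡-Reasoning
      t = y ℕ.* 6 ℕ.^ k
      remainder : (s ℕ.+ y ℕ.* 6 ℕ.^ suc k) % 6 ≡ s % 6
      remainder = ≡.trans (≡.cong (λ a → (s ℕ.+ a) % 6) (place y k)) ([m+kn]%n≡m%n s t 6)
      quotient : (s ℕ.+ y ℕ.* 6 ℕ.^ suc k) / 6 ≡ s / 6 ℕ.+ t
      quotient = ≡.trans (≡.cong (λ a → (s ℕ.+ a) / 6) (place y k))
        (≡.trans (+-distrib-/-∣ʳ s (n∣m*n t)) (≡.cong (s / 6 ℕ.+_) (m*n/n≡m t 6)))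
      step : ∀ d → s % 6 ≡ d → search-step m l (s / 6 ℕ.+ t) d ≡ search-step n l (s / 6) d
      step (suc d) _   = refl
      step zero s%6≡0 = search-periodic k (suc l) (s / 6) y k≤m k≤n λ where
        (divides r e) → ∤s (divides r (begin
          s                        ≡⟨ m≡m%n+[m/n]*n s 6 ⟩
          s % 6 ℕ.+ s / 6 ℕ.* 6    ≡⟨ ≡.cong₂ (λ a b → a ℕ.+ b ℕ.* 6) s%6≡0 e ⟩
          r ℕ.* 6 ℕ.^ k ℕ.* 6      ≡⟨ place r k ⟨
          r ℕ.* 6 ℕ.^ suc k        ∎))

  n<6^n : ∀ n → n < 6 ℕ.^ n
  n<6^n zero    = s≤s z≤n
  n<6^n (suc n) = ℕ.≤-trans (s≤s (n<6^n n)) (ℕ.+-mono-≤ (ℕ.m^n>0 6 n) (ℕ.m≤m+n (6 ℕ.^ n) _))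

  toeplitz-digit : ∀ k y d → suc d < 6 → toeplitz ((suc d ℕ.+ y ℕ.* 6) ℕ.* 6 ℕ.^ k) ≡ digit k (suc d)
  toeplitz-digit k y d d<6 =
    search-digit k 0 y d (ℕ.<-≤-trans (n<6^n k) (ℕ.m≤m+n (6 ℕ.^ k) _)) d<6

  -- The fuel of `toeplitz s` is s itself, so `k ≤ s` is what lets the search inspect k places.
  toeplitz-periodic : ∀ k s y → k ≤ s → 6 ℕ.^ k ∤ s → toeplitz (s ℕ.+ y ℕ.* 6 ℕ.^ k) ≡ toeplitz s
  toeplitz-periodic k s y k≤s ∤s = search-periodic k 0 s y (ℕ.≤-trans k≤s (ℕ.m≤m+n s _)) k≤s ∤s

-- Lacunary series with exponents q^s.

module Lacunary {c ℓ} (R : CommutativeRing c ℓ) {q : ℕ} (2≤q : 2 ≤ q) where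

  open CommutativeRing R hiding (refl)
  open PowerSeries R
  private instance
    q≢0 : NonZero q
    q≢0 = ℕ.>-nonZero (ℕ.<-trans (s≤s z≤n) 2≤q)
  open FrobeniusSeries R q
  open import Algebra.Properties.Semiring.Exp semiring

  q^-mono-< : ∀ {m n} → m < n → q ℕ.^ m < q ℕ.^ n
  q^-mono-< = ℕ.^-monoʳ-< q 2≤q

  q^-mono-≤ : ∀ {m n} → m ≤ n → q ℕ.^ m ≤ q ℕ.^ n
  q^-mono-≤ = ℕ.^-monoʳ-≤ q

  2q^n≤q^[1+n] : ∀ n → q ℕ.^ n ℕ.+ q ℕ.^ n ≤ q ℕ.^ suc n
  2q^n≤q^[1+n] n = ≡.subst (_≤ q ℕ.^ suc n) (≡.cong (q ℕ.^ n ℕ.+_) (ℕ.+-identityʳ _)) (ℕ.*-monoˡ-≤ (q ℕ.^ n) 2≤q)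

  n<q^n : ∀ n → n < q ℕ.^ n
  n<q^n zero    = s≤s z≤n
  n<q^n (suc n) = ℕ.≤-trans (s≤s (n<q^n n))
    (ℕ.≤-trans (ℕ.+-monoˡ-≤ (q ℕ.^ n) (ℕ.m^n>0 q n)) (2q^n≤q^[1+n] n))

  q^-injective : ∀ {m n} → q ℕ.^ m ≡ q ℕ.^ n → m ≡ n
  q^-injective {m} {n} e with ℕ.<-cmp m n
  ... | tri< m<n _ _ = ⊥-elim (ℕ.<⇒≢ (q^-mono-< m<n) e)
  ... | tri≈ _ m≡n _ = m≡n
  ... | tri> _ _ n<m = ⊥-elim (ℕ.<⇒≢ (q^-mono-< n<m) (≡.sym e))

  log? : ∀ m → Dec (∃[ s ] (q ℕ.^ s ≡ m))
  log? m with Fin.any? (λ (s : Fin (suc m)) → q ℕ.^ toℕ s ℕ.≟ m)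
  ... | yes (s , e) = yes (toℕ s , e)
  ... | no  none    = no λ { (s , refl) → none
          (Fin.fromℕ< (s<1+q^s s) , ≡.cong (q ℕ.^_) (Fin.toℕ-fromℕ< (s<1+q^s s))) }
    where
    s<1+q^s : ∀ s → s < suc (q ℕ.^ s)
    s<1+q^s s = ℕ.<-trans (n<q^n s) (ℕ.n<1+n _)

  -- Σₛ a s u^(qˢ)
  lacunary : Series → Series
  lacunary a m with log? m
  ... | yes (s , _) = a s
  ... | no  _       = 0#

  lacunary-power : ∀ a s → lacunary a (q ℕ.^ s) ≡ a s
  lacunary-power a s with log? (q ℕ.^ s)
  ... | yes (t , e) = ≡.cong a (q^-injective e)
  ... | no  none    = ⊥-elim (none (s , refl))

  lacunary-other : ∀ a m → (∀ s → q ℕ.^ s ≢ m) → lacunary a m ≡ 0#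
  lacunary-other a m none with log? m
  ... | yes (s , e) = ⊥-elim (none s e)
  ... | no  _       = refl

  lacunary-elim : ∀ {p} (P : ℕ → Carrier → Set p) a → (∀ s → P (q ℕ.^ s) (a s)) →
                  (∀ m → (∀ s → q ℕ.^ s ≢ m) → P m 0#) → ∀ m → P m (lacunary a m)
  lacunary-elim P a power other m with log? m
  ... | yes (s , refl) = power s
  ... | no  none       = other m λ s e → none (s , e)

  lacunary-cong : ∀ {a b} → a ≋ b → lacunary a ≋ lacunary b
  lacunary-cong {a} {b} p = lacunary-elim (λ m x → x ≈ lacunary b m) a
    (λ s → trans (p s) (reflexive (≡.sym (lacunary-power b s))))
    (λ m none → reflexive (≡.sym (lacunary-other b m none)))

  -- The gaps around q^(s + 1) are at least α: below it, i + q^t < 2 q^s ≤ q^(s + 1); above it, q^t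
  -- ≥ 2 q^(s + 1) > j + q^(s + 1). So no other power of u in the lacunary series reaches this
  -- degree.
  ⊛-lacunary : ∀ {g α} a s j → VanishesFrom α g → α ≤ q ℕ.^ s → j < α →
               (g ⊛ lacunary a) (j ℕ.+ q ℕ.^ suc s) ≈ g j * a (suc s)
  ⊛-lacunary {g} {α} a s j vg α≤q^s j<α = trans
    (⊛-single g (lacunary a) j (q ℕ.^ suc s) cross)
    (*-congˡ (reflexive (lacunary-power a (suc s))))
    where
    clash : ∀ i t → i < α → i ≢ j → i ℕ.+ q ℕ.^ t ≢ j ℕ.+ q ℕ.^ suc s
    clash i t i<α i≢j e with ℕ.<-cmp t (suc s)
    ... | tri≈ _ refl _ = i≢j (ℕ.+-cancelʳ-≡ _ i j e)
    ... | tri< (s≤s t≤s) _ _ = ℕ.<-irrefl e (begin-strict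
            i ℕ.+ q ℕ.^ t            <⟨ ℕ.+-mono-<-≤ (ℕ.<-≤-trans i<α α≤q^s) (q^-mono-≤ t≤s) ⟩
            q ℕ.^ s ℕ.+ q ℕ.^ s      ≤⟨ 2q^n≤q^[1+n] s ⟩
            q ℕ.^ suc s              ≤⟨ ℕ.m≤n+m _ j ⟩
            j ℕ.+ q ℕ.^ suc s        ∎)
      where open ℕ.≤-Reasoning
    ... | tri> _ _ s<t = ℕ.<-irrefl (≡.sym e) (begin-strict
            j ℕ.+ q ℕ.^ suc s             <⟨ ℕ.+-monoˡ-< (q ℕ.^ suc s) (ℕ.<-≤-trans j<α (ℕ.≤-trans α≤q^s (q^-mono-≤ (ℕ.n≤1+n s)))) ⟩
            q ℕ.^ suc s ℕ.+ q ℕ.^ suc s   ≤⟨ 2q^n≤q^[1+n] (suc s) ⟩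
            q ℕ.^ (2 ℕ.+ s)               ≤⟨ q^-mono-≤ s<t ⟩
            q ℕ.^ t                       ≤⟨ ℕ.m≤n+m _ i ⟩
            i ℕ.+ q ℕ.^ t                 ∎)
      where open ℕ.≤-Reasoning
    cross : ∀ i m → i ℕ.+ m ≡ j ℕ.+ q ℕ.^ suc s → i ≢ j → g i * lacunary a m ≈ 0#
    cross i m e i≢j with α ℕ.≤? i
    ... | yes α≤i = trans (*-congʳ (vg i α≤i)) (zeroˡ _)
    ... | no  α≰i = trans (*-congˡ (reflexive (lacunary-other a m λ t q^t≡m →
            clash i t (ℕ.≰⇒> α≰i) i≢j (≡.trans (≡.cong (i ℕ.+_) q^t≡m) e)))) (zeroʳ _)

  module _ (^q-distrib-+ : ∀ f g → (f S.+ g) S.^ q ≋ f S.^ q S.+ g S.^ q) where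

    -- The q-th power sends u^(qˢ) to u^(qˢ⁺¹) and fixes the coefficients, which amounts to delaying
    -- a by one.
    lacunary-^q : ∀ {a} → (∀ s → a s ^ q ≈ a s) → lacunary a S.^ q ≋ lacunary (shift 1 a)
    lacunary-^q {a} a^q≈a m with q ∣? m
    ... | no q∤m = trans (^q-nonmultiple ^q-distrib-+ m (lacunary a) q∤m)
      (sym (lacunary-elim (λ m x → q ∤ m → x ≈ 0#) (shift 1 a)
        -- The exponent q^0 = 1 is the only power of q not divisible by q, and the delayed sequence
        -- is 0 there.
        (λ { zero _ → CommutativeRing.refl R ; (suc s) q∤ → ⊥-elim (q∤ (m∣m*n (q ℕ.^ s))) })
        (λ _ _ _ → CommutativeRing.refl R) m q∤m))
    ... | yes (divides j refl) = trans (^q-multiple ^q-distrib-+ (lacunary a) j)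
      (lacunary-elim (λ j x → x ^ q ≈ lacunary (shift 1 a) (j ℕ.* q)) a
        (λ s → trans (a^q≈a s) (reflexive (≡.sym (≡.trans
          (≡.cong (lacunary (shift 1 a)) (ℕ.*-comm (q ℕ.^ s) q)) (lacunary-power (shift 1 a) (suc s))))))
        (λ j none → trans 0^q≈0 (reflexive (≡.sym (lacunary-other (shift 1 a) (j ℕ.* q) (notPower j none)))))
        j)
      where
      0^q≈0 : 0# ^ q ≈ 0#
      0^q≈0 = trans (^-congʳ 0# (≡.sym (ℕ.suc-pred q))) (zeroˡ _)
      notPower : ∀ j → (∀ s → q ℕ.^ s ≢ j) → ∀ s → q ℕ.^ s ≢ j ℕ.* q
      notPower (suc j) none zero    e = ℕ.<⇒≱ 2≤q (ℕ.≤-trans (ℕ.m≤m+n q _) (ℕ.≤-reflexive (≡.sym e)))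
      notPower j none (suc s) e =
        none s (ℕ.*-cancelʳ-≡ (q ℕ.^ s) j q (≡.trans (ℕ.*-comm (q ℕ.^ s) q) e))

    lacunary-^q^ : ∀ {a} → (∀ s → a s ^ q ≈ a s) → ∀ i →
                   lacunary a S.^ (q ℕ.^ i) ≋ lacunary (shift i a)
    lacunary-^q^ {a} a^q≈a zero    = S.*-identityʳ (lacunary a)
    lacunary-^q^ {a} a^q≈a (suc i) = begin
      lacunary a S.^ (q ℕ.* q ℕ.^ i)    ≡⟨ ≡.cong (lacunary a S.^_) (ℕ.*-comm q (q ℕ.^ i)) ⟩
      lacunary a S.^ (q ℕ.^ i ℕ.* q)    ≈⟨ S.^-assocʳ (lacunary a) (q ℕ.^ i) q ⟨
      (lacunary a S.^ (q ℕ.^ i)) S.^ q  ≈⟨ S.^-congˡ q (lacunary-^q^ a^q≈a i) ⟩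
      lacunary (shift i a) S.^ q        ≈⟨ lacunary-^q (fixed i) ⟩
      lacunary (shift 1 (shift i a))    ≈⟨ lacunary-cong (λ { zero → CommutativeRing.refl R ; (suc _) → CommutativeRing.refl R }) ⟩
      lacunary (shift (suc i) a)        ∎
      where
      open S-Reasoning
      fixed : ∀ i s → shift i a s ^ q ≈ shift i a s
      fixed zero    s       = a^q≈a s
      fixed (suc i) zero    = trans (^-congʳ 0# (≡.sym (ℕ.suc-pred q))) (zeroˡ _)
      fixed (suc i) (suc s) = fixed i s

-- Solving underdetermined systems by counting.

module Collision {c ℓ q} (F : FiniteField c ℓ q) (2≤q : 2 ≤ q) where

  open FieldProperties F using (to; from; from-to; to-from; to-cong; to-injective)
  open FiniteField F hiding (_+_; _*_)
  open CommutativeRing commutativeRing using (sym; trans; reflexive)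

  funToFin-cong : ∀ {m n} {f g : Fin m → Fin n} → (∀ i → f i ≡ g i) → Fin.funToFin f ≡ Fin.funToFin g
  funToFin-cong {zero}  p = refl
  funToFin-cong {suc m} p = ≡.cong₂ Fin.combine (p Fin.zero) (funToFin-cong (p ∘ Fin.suc))

  extend : ∀ V → (Fin V → Fin q) → ℕ → Carrier
  extend V x v with v ℕ.<? V
  ... | yes v<V = from (x (Fin.fromℕ< v<V))
  ... | no  _   = 0#

  to-extend : ∀ {V} x (i : Fin V) → to (extend V x (toℕ i)) ≡ x i
  to-extend {V} x i with toℕ i ℕ.<? V
  ... | yes i<V = ≡.trans (to-from _) (≡.cong x (Fin.fromℕ<-toℕ i i<V))
  ... | no  i≮V = ⊥-elim (i≮V (Fin.toℕ<n i))

  -- There are q^V assignments and only q^E outcomes. The pigeonhole principle replaces elimination: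
  -- for a linear system, the difference of two colliding assignments is a nonzero solution.
  collision : ∀ {E V} → E < V → (Φ : (ℕ → Carrier) → ℕ → Carrier) →
              ∃[ x ] ∃[ y ] (¬ (∀ v → v < V → x v ≈ y v) × (∀ e → e < E → Φ x e ≈ Φ y e))
  collision {E} {V} E<V Φ with Fin.pigeonhole (ℕ.^-monoʳ-< q 2≤q E<V) code
    where
    code : Fin (q ℕ.^ V) → Fin (q ℕ.^ E)
    code i = Fin.funToFin λ (e : Fin E) → to (Φ (extend V (Fin.finToFun i)) (toℕ e))
  ... | i , j , i<j , same = extend V (Fin.finToFun i) , extend V (Fin.finToFun j) , distinct , equal
    where
    distinct : ¬ (∀ v → v < V → extend V (Fin.finToFun i) v ≈ extend V (Fin.finToFun j) v)
    distinct p = ℕ.<⇒≢ i<j (≡.cong toℕ (≡.trans (≡.sym (Fin.funToFin-finToFin {V} i)) (≡.trans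
      (funToFin-cong λ k → ≡.trans (≡.sym (to-extend (Fin.finToFun i) k))
        (≡.trans (to-cong (p (toℕ k) (Fin.toℕ<n k))) (to-extend (Fin.finToFun j) k)))
      (Fin.funToFin-finToFin {V} j))))
    equal : ∀ e → e < E → Φ (extend V (Fin.finToFun i)) e ≈ Φ (extend V (Fin.finToFun j)) e
    equal e e<E = ≡.subst (λ e → Φ (extend V (Fin.finToFun i)) e ≈ Φ (extend V (Fin.finToFun j)) e)
      (Fin.toℕ-fromℕ< e<E)
      (to-injective (≡.trans (≡.sym (Fin.finToFun-funToFin _ k))
        (≡.trans (≡.cong (λ c → Fin.finToFun c k) same) (Fin.finToFun-funToFin _ k))))
      where k = Fin.fromℕ< e<E

-- A rows × width array stored in the sequence x from position offset on.
module _ {a} {A : Set a} (0A : A) where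

  abstract
    block : ℕ → ℕ → ℕ → (ℕ → A) → ℕ → ℕ → A
    block offset rows width x i k with i ℕ.<? rows | k ℕ.<? width
    ... | yes _ | yes _ = x (offset ℕ.+ (k ℕ.+ i ℕ.* width))
    ... | _     | _     = 0A

    block-rows : ∀ o r w x i k → r ≤ i → block o r w x i k ≡ 0A
    block-rows o r w x i k r≤i with i ℕ.<? r | k ℕ.<? w
    ... | yes i<r | yes _ = ⊥-elim (ℕ.<⇒≱ i<r r≤i)
    ... | yes _   | no  _ = refl
    ... | no  _   | yes _ = refl
    ... | no  _   | no  _ = refl

    block-width : ∀ o r w x i k → w ≤ k → block o r w x i k ≡ 0A
    block-width o r w x i k w≤k with i ℕ.<? r | k ℕ.<? w
    ... | yes _   | yes k<w = ⊥-elim (ℕ.<⇒≱ k<w w≤k)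
    ... | yes _   | no  _ = refl
    ... | no  _   | yes _ = refl
    ... | no  _   | no  _ = refl

    block-inside : ∀ o r w x i k → i < r → k < w → block o r w x i k ≡ x (o ℕ.+ (k ℕ.+ i ℕ.* w))
    block-inside o r w x i k i<r k<w with i ℕ.<? r | k ℕ.<? w
    ... | yes _   | yes _   = refl
    ... | yes _   | no  k≮w = ⊥-elim (k≮w k<w)
    ... | no  i≮r | _       = ⊥-elim (i≮r i<r)

    block-onto : ∀ o r w .{{_ : NonZero w}} {v} → v < r ℕ.* w →
                 ∃[ i ] ∃[ k ] (∀ x → block o r w x i k ≡ x (o ℕ.+ v))
    block-onto o r w {v} v<rw = v / w , v % w , λ x → ≡.trans
      (block-inside o r w x (v / w) (v % w) (m<n*o⇒m/o<n v<rw) (m%n<n v w))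
      (≡.cong (λ v → x (o ℕ.+ v)) (≡.sym (m≡m%n+[m/n]*n v w)))

-- Linearised multiples of a polynomial.

-- Ore: every polynomial f divides a linearised polynomial Σᵢ aᵢ X^(qⁱ).  The
-- bounds on U and the aᵢ are chosen such that U f = Σᵢ aᵢ X^(qⁱ) is a linear
-- system over F with more unknowns than equations.
module OreMultiple {c ℓ q} (F : FiniteField c ℓ q) (2≤q : 2 ≤ q) where

  open FiniteField F using (commutativeRing)
  open CommutativeRing commutativeRing hiding (refl)
  private module R = CommutativeRing commutativeRing
  module A = PowerSeries commutativeRing
  𝔸 : CommutativeRing c ℓ
  𝔸 = A.seriesRing
  module 𝔸 = CommutativeRing 𝔸
  module X = PowerSeries 𝔸
  module 𝔸[X] = CommutativeRing X.seriesRing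

  linearised : ℕ → (ℕ → A.Series) → X.Series
  linearised zero    a = λ _ → 𝔸.0#
  linearised (suc m) a = linearised m a 𝔸[X].+ X.shift (q ℕ.^ m) (X.const (a m))

  shift-const-vanishesFrom : ∀ e a → X.VanishesFrom (suc e) (X.shift e (X.const a))
  shift-const-vanishesFrom zero    a (suc k) _         = 𝔸.refl
  shift-const-vanishesFrom (suc e) a (suc k) (s≤s e<k) = shift-const-vanishesFrom e a k e<k

  shift-const-closed : ∀ {p} (P : A.Series → Set p) → P 𝔸.0# → ∀ e {a} → P a → ∀ k → P (X.shift e (X.const a) k)
  shift-const-closed P P0 zero    Pa zero    = Pa
  shift-const-closed P P0 zero    Pa (suc k) = P0
  shift-const-closed P P0 (suc e) Pa zero    = P0
  shift-const-closed P P0 (suc e) Pa (suc k) = shift-const-closed P P0 e Pa k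

  linearised-vanishesFrom : ∀ m a N → (∀ i → i < m → q ℕ.^ i < N) → X.VanishesFrom N (linearised m a)
  linearised-vanishesFrom zero    a N h k N≤k = 𝔸.refl
  linearised-vanishesFrom (suc m) a N h k N≤k = 𝔸.trans
    (𝔸.+-cong (linearised-vanishesFrom m a N (λ i i<m → h i (ℕ.m≤n⇒m≤1+n i<m)) k N≤k)
              (shift-const-vanishesFrom (q ℕ.^ m) (a m) k (ℕ.≤-trans (h m ℕ.≤-refl) N≤k)))
    (𝔸.+-identityˡ _)

  vanishesFrom-+ : ∀ {n f g} → A.VanishesFrom n f → A.VanishesFrom n g → A.VanishesFrom n (f 𝔸.+ g)
  vanishesFrom-+ vf vg k n≤k = trans (+-cong (vf k n≤k) (vg k n≤k)) (+-identityˡ _)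

  linearised-width : ∀ m a α → (∀ i → A.VanishesFrom α (a i)) → ∀ k → A.VanishesFrom α (linearised m a k)
  linearised-width zero    a α h k = λ _ _ → R.refl
  linearised-width (suc m) a α h k = vanishesFrom-+ (linearised-width m a α h k)
    (shift-const-closed (A.VanishesFrom α) (λ _ _ → R.refl) (q ℕ.^ m) (h m) k)

  linearised-0 : ∀ m a → (∀ i → i < m → a i 𝔸.≈ 𝔸.0#) → linearised m a 𝔸[X].≈ 𝔸[X].0#
  linearised-0 zero    a h k = 𝔸.refl
  linearised-0 (suc m) a h k = 𝔸.trans
    (𝔸.+-cong (linearised-0 m a (λ i i<m → h i (ℕ.m≤n⇒m≤1+n i<m)) k)
              (shift-const-closed (𝔸._≈ 𝔸.0#) 𝔸.refl (q ℕ.^ m) (h m ℕ.≤-refl) k))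
    (𝔸.+-identityˡ _)

  open import Algebra.Properties.Ring 𝔸.ring as 𝔸-Ring using ()
  open import Algebra.Properties.Ring 𝔸[X].ring as 𝔸[X]-Ring using ()
  open import Algebra.Properties.CommutativeSemigroup 𝔸.+-commutativeSemigroup
    using (interchange)

  linearised-difference : ∀ m a b →
    linearised m (λ i → a i 𝔸.- b i) 𝔸[X].≈ linearised m a 𝔸[X].- linearised m b
  linearised-difference zero    a b k = 𝔸.sym (𝔸.-‿inverseʳ 𝔸.0#)
  linearised-difference (suc m) a b k = 𝔸.trans
    (𝔸.+-cong (linearised-difference m a b k) (shifted (q ℕ.^ m) k))
    (𝔸.trans (interchange _ _ _ _) (𝔸.+-congˡ (𝔸-Ring.-‿+-comm _ _)))
    where
    shifted : ∀ e k → X.shift e (X.const (a m 𝔸.- b m)) k 𝔸.≈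
                      X.shift e (X.const (a m)) k 𝔸.- X.shift e (X.const (b m)) k
    shifted zero    zero    = 𝔸.refl
    shifted zero    (suc k) = 𝔸.sym (𝔸.-‿inverseʳ 𝔸.0#)
    shifted (suc e) zero    = 𝔸.sym (𝔸.-‿inverseʳ 𝔸.0#)
    shifted (suc e) (suc k) = shifted e k

  -- With D = q^n, the coefficients of U are allowed u-degree (D + 1) h and those of f have degree
  -- at most h. Products then have degree at most (D + 2) h, and one more counts the constant term.
  width : ℕ → ℕ → ℕ
  width n h = suc ((2 ℕ.+ q ℕ.^ n) ℕ.* h)

  module _ (n h : ℕ) (f : X.Series)
           (deg-X : X.VanishesFrom (suc n) f) (deg-u : ∀ i → A.VanishesFrom (suc h) (f i)) where

    private
      D r β α : ℕ
      D = q ℕ.^ n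
      r = suc (D ∸ n)
      β = suc (suc D ℕ.* h)
      α = width n h

    α≡β+h : α ≡ β ℕ.+ h
    α≡β+h = ≡.cong suc (ℕ.+-comm h (suc D ℕ.* h))

    n≤D : n ≤ D
    n≤D = ℕ.<⇒≤ (Lacunary.n<q^n commutativeRing 2≤q n)

    r+n≡1+D : r ℕ.+ n ≡ suc D
    r+n≡1+D = ≡.cong suc (ℕ.m∸n+n≡m n≤D)

    -- U has r coefficients in X with β unknowns each, M has n + 1 with α each, and U f - M has D +
    -- 1 coefficients with α equations each. As r + n = D + 1 and α = β + h, the surplus of unknowns
    -- is α - r h > 0.
    equations<unknowns : suc D ℕ.* α < r ℕ.* β ℕ.+ suc n ℕ.* α
    equations<unknowns = begin-strict
      suc D ℕ.* α                            ≡⟨ ≡.cong (ℕ._* α) r+n≡1+D ⟨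
      (r ℕ.+ n) ℕ.* α                        ≡⟨ ℕ.*-distribʳ-+ α r n ⟩
      r ℕ.* α ℕ.+ n ℕ.* α                    ≡⟨ ≡.cong (λ a → r ℕ.* a ℕ.+ n ℕ.* α) α≡β+h ⟩
      r ℕ.* (β ℕ.+ h) ℕ.+ n ℕ.* α            ≡⟨ ≡.cong (ℕ._+ n ℕ.* α) (ℕ.*-distribˡ-+ r β h) ⟩
      r ℕ.* β ℕ.+ r ℕ.* h ℕ.+ n ℕ.* α        ≡⟨ ℕ.+-assoc (r ℕ.* β) (r ℕ.* h) (n ℕ.* α) ⟩
      r ℕ.* β ℕ.+ (r ℕ.* h ℕ.+ n ℕ.* α)      <⟨ ℕ.+-monoʳ-< (r ℕ.* β) (ℕ.+-monoˡ-< (n ℕ.* α) rh<α) ⟩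
      r ℕ.* β ℕ.+ suc n ℕ.* α                ∎
      where
      open ℕ.≤-Reasoning
      rh<α : r ℕ.* h < α
      rh<α = s≤s (ℕ.*-monoˡ-≤ h (ℕ.≤-trans (s≤s (ℕ.m∸n≤m D n)) (ℕ.n≤1+n (suc D))))

    Uₓ aₓ : (ℕ → Carrier) → X.Series
    Uₓ = block 0# 0 r β
    aₓ = block 0# (r ℕ.* β) (suc n) α

    defect : (ℕ → Carrier) → X.Series
    defect x = Uₓ x X.⊛ f 𝔸[X].- linearised (suc n) (aₓ x)

    deg-X-U : ∀ x → X.VanishesFrom r (Uₓ x)
    deg-X-U x i r≤i k = reflexive (block-rows 0# 0 r β x i k r≤i)

    ε-inverse : ∀ {x y} → x ≈ 0# → y ≈ 0# → x - y ≈ 0#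
    ε-inverse x≈0 y≈0 = trans (+-cong x≈0 (-‿cong y≈0)) (-‿inverseʳ 0#)

    defect-X : ∀ x → X.VanishesFrom (suc D) (defect x)
    defect-X x i D<i k = ε-inverse
      (X.⊛-vanishesFrom (deg-X-U x) deg-X i (≡.subst (_≤ i) (≡.sym r+n≡1+D) D<i) k)
      (linearised-vanishesFrom (suc n) (aₓ x) (suc D)
        (λ { i (s≤s i≤n) → s≤s (ℕ.^-monoʳ-≤ q {{ℕ.>-nonZero (ℕ.<-trans (s≤s z≤n) 2≤q)}} i≤n) }) i D<i k)

    defect-u : ∀ x i → A.VanishesFrom α (defect x i)
    defect-u x i k α≤k = ε-inverse
      (X.⊛-closed (A.VanishesFrom α) vanishesFrom-+ (Uₓ x) f term i k α≤k)
      (linearised-width (suc n) (aₓ x) α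
        (λ i k α≤k → reflexive (block-width 0# (r ℕ.* β) (suc n) α x i k α≤k)) i k α≤k)
      where
      term : ∀ i j → A.VanishesFrom α (Uₓ x i A.⊛ f j)
      term i j k α≤k = A.⊛-vanishesFrom
        (λ k β≤k → reflexive (block-width 0# 0 r β x i k β≤k)) (deg-u j) k
        (≡.subst (_≤ k) α≡β+h α≤k)

    -- `nontrivial` excludes only that U and a vanish together, which is exactly what distinct
    -- assignments provide. For nonzero f it suffices, since a = 0 gives U f = 0 and hence U = 0.
    record Multiple : Set (c ⊔ ℓ) where
      field
        U a         : X.Series
        U-vanishes  : X.VanishesFrom r U
        a-vanishes  : ∀ i → A.VanishesFrom α (a i)
        identity    : U X.⊛ f 𝔸[X].≈ linearised (suc n) a
        nontrivial  : ¬ (U 𝔸[X].≈ 𝔸[X].0# × (∀ i → i < suc n → a i 𝔸.≈ 𝔸.0#))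

    -- The defect is additive in the assignment, so equal defects of x and y mean that their
    -- difference satisfies U f = M. Division by α with remainder enumerates the equations
    -- coefficient by coefficient.
    fromCollision : ∀ x y → ¬ (∀ v → v < r ℕ.* β ℕ.+ suc n ℕ.* α → x v ≈ y v) →
                    (∀ e → e < suc D ℕ.* α → defect x (e / α) (e % α) ≈ defect y (e / α) (e % α)) →
                    Multiple
    fromCollision x y x≉y same = record
      { U = Uₓ x 𝔸[X].- Uₓ y
      ; a = aₓ x 𝔸[X].- aₓ y
      ; U-vanishes = λ i r≤i k → ε-inverse (deg-X-U x i r≤i k) (deg-X-U y i r≤i k)
      ; a-vanishes = λ i k α≤k → ε-inverse (reflexive (block-width 0# (r ℕ.* β) (suc n) α x i k α≤k))
                                           (reflexive (block-width 0# (r ℕ.* β) (suc n) α y i k α≤k))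
      ; identity = identity
      ; nontrivial = λ (U≈0 , a≈0) → x≉y (entry U≈0 a≈0)
      }
      where
      defect-same : defect x 𝔸[X].≈ defect y
      defect-same i k with i ℕ.<? suc D | k ℕ.<? α
      ... | no  i≮ | _      = trans (defect-X x i (ℕ.≮⇒≥ i≮) k) (sym (defect-X y i (ℕ.≮⇒≥ i≮) k))
      ... | yes _  | no k≮α = trans (defect-u x i k (ℕ.≮⇒≥ k≮α)) (sym (defect-u y i k (ℕ.≮⇒≥ k≮α)))
      ... | yes i≤D | yes k<α = ≡.subst₂ (λ i k → defect x i k ≈ defect y i k) row column
              (same (k ℕ.+ i ℕ.* α) (ℕ.<-≤-trans (ℕ.+-monoˡ-< (i ℕ.* α) k<α) (ℕ.*-monoˡ-≤ α i≤D)))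
        where
        column : (k ℕ.+ i ℕ.* α) % α ≡ k
        column = ≡.trans ([m+kn]%n≡m%n k i α) (m<n⇒m%n≡m k<α)
        row : (k ℕ.+ i ℕ.* α) / α ≡ i
        row = ℕ.*-cancelʳ-≡ _ i α (ℕ.+-cancelˡ-≡ k _ _ (≡.trans
          (≡.cong (ℕ._+ (k ℕ.+ i ℕ.* α) / α ℕ.* α) (≡.sym column))
          (≡.sym (m≡m%n+[m/n]*n (k ℕ.+ i ℕ.* α) α))))

      identity : (Uₓ x 𝔸[X].- Uₓ y) X.⊛ f 𝔸[X].≈ linearised (suc n) (aₓ x 𝔸[X].- aₓ y)
      identity = begin
        (Uₓ x 𝔸[X].- Uₓ y) X.⊛ f
          ≈⟨ 𝔸[X].distribʳ f (Uₓ x) (𝔸[X].- Uₓ y) ⟩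
        Uf 𝔸[X].+ (𝔸[X].- Uₓ y) X.⊛ f
          ≈⟨ 𝔸[X].+-congˡ {Uf} (𝔸[X]-Ring.-‿distribˡ-* (Uₓ y) f) ⟨
        Uf 𝔸[X].- U′f
          ≈⟨ exchange Uf M U′f M′ defect-same ⟩
        M 𝔸[X].- M′
          ≈⟨ linearised-difference (suc n) (aₓ x) (aₓ y) ⟨
        linearised (suc n) (aₓ x 𝔸[X].- aₓ y) ∎
        where
        open SetoidReasoning 𝔸[X].setoid
        Uf = Uₓ x X.⊛ f
        U′f = Uₓ y X.⊛ f
        M = linearised (suc n) (aₓ x)
        M′ = linearised (suc n) (aₓ y)
        exchange : ∀ a b c d → a 𝔸[X].- b 𝔸[X].≈ c 𝔸[X].- d → a 𝔸[X].- c 𝔸[X].≈ b 𝔸[X].- d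
        exchange a b c d e = begin
          a 𝔸[X].- c                                    ≈⟨ 𝔸[X].+-congʳ {𝔸[X].- c} (𝔸[X]-Ring.//-rightDividesˡ b a) ⟨
          (a 𝔸[X].- b 𝔸[X].+ b) 𝔸[X].- c                ≈⟨ 𝔸[X].+-congʳ {𝔸[X].- c} (𝔸[X].+-congʳ {b} e) ⟩
          (c 𝔸[X].- d 𝔸[X].+ b) 𝔸[X].- c                ≈⟨ 𝔸[X].+-congʳ {𝔸[X].- c} (𝔸[X].+-assoc c (𝔸[X].- d) b) ⟩
          (c 𝔸[X].+ (𝔸[X].- d 𝔸[X].+ b)) 𝔸[X].- c       ≈⟨ 𝔸[X]-Ring.xyx⁻¹≈y c (𝔸[X].- d 𝔸[X].+ b) ⟩
          𝔸[X].- d 𝔸[X].+ b                             ≈⟨ 𝔸[X].+-comm (𝔸[X].- d) b ⟩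
          b 𝔸[X].- d                                    ∎

      ≈-from-difference : ∀ {a b} → a - b ≈ 0# → a ≈ b
      ≈-from-difference {a} {b} = x-y≈0⇒x≈y a b
        where
        open import Algebra.Properties.Group +-group using () renaming (x∙y⁻¹≈ε⇒x≈y to x-y≈0⇒x≈y)

      entry : (Uₓ x 𝔸[X].- Uₓ y) 𝔸[X].≈ 𝔸[X].0# →
              (∀ i → i < suc n → (aₓ x 𝔸[X].- aₓ y) i 𝔸.≈ 𝔸.0#) →
              ∀ v → v < r ℕ.* β ℕ.+ suc n ℕ.* α → x v ≈ y v
      entry U≈0 a≈0 v v<V with v ℕ.<? r ℕ.* β
      ... | yes v<rβ = let (i , k , hit) = block-onto 0# 0 r β v<rβ in
              trans (reflexive (≡.sym (hit x))) (trans (≈-from-difference (U≈0 i k)) (reflexive (hit y)))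
      ... | no  v≮rβ = ≡.subst (λ v → x v ≈ y v) (ℕ.m+[n∸m]≡n (ℕ.≮⇒≥ v≮rβ))
              (trans (reflexive (≡.sym (hit x))) (trans (≈-from-difference (aₓ-same i k)) (reflexive (hit y))))
        where
        onto = block-onto 0# (r ℕ.* β) (suc n) α {v ∸ r ℕ.* β}
          (ℕ.+-cancelˡ-< (r ℕ.* β) _ _ (≡.subst (_< r ℕ.* β ℕ.+ suc n ℕ.* α) (≡.sym (ℕ.m+[n∸m]≡n (ℕ.≮⇒≥ v≮rβ))) v<V))
        i = proj₁ onto
        k = proj₁ (proj₂ onto)
        hit = proj₂ (proj₂ onto)
        aₓ-same : ∀ i → (aₓ x 𝔸[X].- aₓ y) i 𝔸.≈ 𝔸.0#
        aₓ-same i with i ℕ.<? suc n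
        ... | yes i≤n = a≈0 i i≤n
        ... | no  i≰n = λ k → ε-inverse (reflexive (block-rows 0# (r ℕ.* β) (suc n) α x i k (ℕ.≮⇒≥ i≰n)))
                                        (reflexive (block-rows 0# (r ℕ.* β) (suc n) α y i k (ℕ.≮⇒≥ i≰n)))

    multiple : Multiple
    multiple =
      let (x , y , x≉y , same) =
            Collision.collision F 2≤q equations<unknowns (λ x e → defect x (e / α) (e % α))
      in fromCollision x y x≉y same

-- Upper bounds for orders of polynomial values at ζ.

∃-power : ∀ {b} → 2 ≤ b → ∀ n → 1 ≤ n → ∃[ r ] (n ≤ b ℕ.^ r × b ℕ.^ r ≤ b ℕ.* n)
∃-power {b} 2≤b (suc zero)    _ = 0 , ℕ.≤-refl , ℕ.≤-trans (ℕ.≤-trans (s≤s z≤n) 2≤b) (ℕ.≤-reflexive (≡.sym (ℕ.*-identityʳ b)))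
∃-power {b} 2≤b (suc n@(suc _)) _ with ∃-power 2≤b n (s≤s z≤n)
... | r , n≤b^r , b^r≤bn with ℕ.m≤n⇒m<n∨m≡n n≤b^r
...   | inj₁ n<b^r = r , n<b^r , ℕ.≤-trans b^r≤bn (ℕ.*-monoʳ-≤ b (ℕ.n≤1+n n))
...   | inj₂ n≡b^r = suc r
        , ℕ.≤-trans (ℕ.+-monoˡ-≤ n (s≤s z≤n)) (ℕ.≤-trans (ℕ.≤-reflexive (≡.cong (n ℕ.+_) (≡.sym (ℕ.+-identityʳ n))))
            (ℕ.≤-trans (ℕ.*-monoˡ-≤ n 2≤b) (ℕ.≤-reflexive (≡.cong (b ℕ.*_) n≡b^r))))
        , ℕ.≤-trans (ℕ.≤-reflexive (≡.cong (b ℕ.*_) (≡.sym n≡b^r))) (ℕ.*-monoʳ-≤ b (ℕ.n≤1+n n))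

module OrderBound {c ℓ} {p e q : ℕ} (p-prime : Prime p) (1≤e : 1 ≤ e) (q≡p^e : q ≡ p ℕ.^ e)
                  (F : FiniteField c ℓ q) (bits : ℕ → Bool) where

  open FiniteField F using (commutativeRing)
  open CommutativeRing commutativeRing hiding (refl)
  private module R = CommutativeRing commutativeRing

  2≤q : 2 ≤ q
  2≤q = ℕ.≤-trans (ℕ.nonTrivial⇒n>1 p {{prime⇒nonTrivial p-prime}})
    (ℕ.≤-trans (ℕ.≤-reflexive (≡.sym (ℕ.^-identityʳ p)))
      (ℕ.≤-trans (ℕ.^-monoʳ-≤ p {{prime⇒nonZero p-prime}} 1≤e) (ℕ.≤-reflexive (≡.sym q≡p^e))))

  instance
    q≢0 : NonZero q
    q≢0 = ℕ.>-nonZero (ℕ.<-trans (s≤s z≤n) 2≤q)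

  open OreMultiple F 2≤q public
  open Lacunary commutativeRing 2≤q public
  open FrobeniusSeries commutativeRing q using (module S)
  open FieldProperties F using (field-domain; characteristic; _≈?_)
  open Toeplitz bits public
  open import Algebra.Properties.Semiring.Mult 𝔸.semiring renaming (_×_ to _·_) using ()
  open import Algebra.Properties.Semiring.Mult semiring renaming (_×_ to _·′_) using ()
  open import Algebra.Properties.Semiring.Exp semiring using (_^_; ^-congʳ)

  ^q-distrib-+ : ∀ f g → (f S.+ g) S.^ q A.≋ f S.^ q S.+ g S.^ q
  ^q-distrib-+ f g = ≡.subst (λ q → (f S.+ g) S.^ q A.≋ f S.^ q S.+ g S.^ q) (≡.sym q≡p^e)
    (Frobenius.^pᵉ-distrib-+ 𝔸 p-prime char e f g)
    where
    pointwise : ∀ n f k → (n · f) k ≡ n ·′ f k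
    pointwise zero    f k = refl
    pointwise (suc n) f k = ≡.cong (λ x → f k + x) (pointwise n f k)
    char : ∀ f → p · f 𝔸.≈ 𝔸.0#
    char f k = trans (reflexive (pointwise p f k)) (characteristic {p} {e} q≡p^e (f k))

  ι : Bool → Carrier
  ι false = 0#
  ι true  = 1#

  -- Letters fixed by the q-th power make ζ^q a pure delay of the word.
  ι-^q : ∀ b → ι b ^ q ≈ ι b
  ι-^q false = trans (^-congʳ 0# (≡.sym (ℕ.suc-pred q))) (zeroˡ _)
  ι-^q true  = 1^ q
    where
    1^ : ∀ n → 1# ^ n ≈ 1#
    1^ zero    = R.refl
    1^ (suc n) = trans (*-identityˡ _) (1^ n)

  word : A.Series
  word s = ι (toeplitz s)

  ζ : A.Series
  ζ = lacunary word

  ζ-^ : ∀ i → ζ S.^ (q ℕ.^ i) A.≋ lacunary (A.shift i word)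
  ζ-^ = lacunary-^q^ ^q-distrib-+ (ι-^q ∘ toeplitz)

  open Evaluation 𝔸 ζ public

  partialSum : ℕ → A.Series → Carrier
  partialSum zero    g = 0#
  partialSum (suc m) g = partialSum m g + g m

  partialSum-cong : ∀ m {g g′} → (∀ i → i < m → g i ≈ g′ i) → partialSum m g ≈ partialSum m g′
  partialSum-cong zero    h = R.refl
  partialSum-cong (suc m) h = +-cong (partialSum-cong m λ i i<m → h i (ℕ.m≤n⇒m≤1+n i<m)) (h m ℕ.≤-refl)

  partialSum-perturb : ∀ m {g g′ i₀ d} → i₀ < m → (∀ i → i < m → i ≢ i₀ → g′ i ≈ g i) → g′ i₀ ≈ g i₀ + d →
                       partialSum m g′ ≈ partialSum m g + d
  partialSum-perturb (suc m) {g} {g′} {i₀} {d} (s≤s i₀≤m) same differ with ℕ.m≤n⇒m<n∨m≡n i₀≤m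
  ... | inj₁ i₀<m = begin
    partialSum m g′ + g′ m       ≈⟨ +-cong (partialSum-perturb m i₀<m (λ i i<m → same i (ℕ.m≤n⇒m≤1+n i<m)) differ)
                                           (same m ℕ.≤-refl (ℕ.<⇒≢ i₀<m ∘ ≡.sym)) ⟩
    partialSum m g + d + g m     ≈⟨ +-assoc _ _ _ ⟩
    partialSum m g + (d + g m)   ≈⟨ +-congˡ (+-comm _ _) ⟩
    partialSum m g + (g m + d)   ≈⟨ +-assoc _ _ _ ⟨
    partialSum m g + g m + d     ∎
    where open SetoidReasoning setoid
  ... | inj₂ refl = trans
    (+-cong (partialSum-cong m λ i i<m → same i (ℕ.m≤n⇒m≤1+n i<m) (ℕ.<⇒≢ i<m)) differ)
    (sym (+-assoc _ _ _))

  -- At exponents near q^(1+s) distinct powers of u do not interfere, so a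
  -- linearised polynomial at ζ acts as a linear recurrence on the word.
  evaluate-linearised : ∀ N m a {α} s j → (∀ i → i < m → q ℕ.^ i < N) → (∀ i → A.VanishesFrom α (a i)) →
    α ≤ q ℕ.^ s → j < α →
    evaluate N (linearised m a) (j ℕ.+ q ℕ.^ suc s) ≈ partialSum m (λ i → a i j * A.shift i word (suc s))
  evaluate-linearised N zero    a s j <N va α≤ j<α = eval-0 N _
  evaluate-linearised N (suc m) a s j <N va α≤ j<α = begin
    evaluate N (linearised (suc m) a) k
      ≈⟨ eval-+ N (linearised m a) (X.shift (q ℕ.^ m) (X.const (a m))) k ⟩
    evaluate N (linearised m a) k + evaluate N (monomial (q ℕ.^ m) (a m)) k
      ≈⟨ +-cong (evaluate-linearised N m a s j (λ i i<m → <N i (ℕ.m≤n⇒m≤1+n i<m)) va α≤ j<α)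
                (eval-monomial N (q ℕ.^ m) (a m) (<N m ℕ.≤-refl) k) ⟩
    partialSum m _ + (a m A.⊛ ζ S.^ (q ℕ.^ m)) k
      ≈⟨ +-congˡ (trans (A.⊛-cong (λ _ → R.refl) (ζ-^ m) k) (⊛-lacunary (A.shift m word) s j (va m) α≤ j<α)) ⟩
    partialSum (suc m) (λ i → a i j * A.shift i word (suc s)) ∎
    where
    open SetoidReasoning setoid
    k = j ℕ.+ q ℕ.^ suc s

  module _ (n r : ℕ) where

    private
      w s₁ s₂ : ℕ
      w  = 6 ℕ.^ n
      -- Digits 1 and 4 in place n carry different letters. `suc r` keeps both positions at least 2
      -- n, so that a whole window fits to the left of each.
      s₁ = (1 ℕ.+ suc r ℕ.* 6) ℕ.* w
      s₂ = (4 ℕ.+ suc r ℕ.* 6) ℕ.* w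

      n<w : n < w
      n<w = n<6^n n

      s₂≡s₁+3w : s₂ ≡ s₁ ℕ.+ 3 ℕ.* w
      s₂≡s₁+3w = ≡.trans (≡.cong (ℕ._* w) (ℕ.+-comm 3 (1 ℕ.+ suc r ℕ.* 6))) (ℕ.*-distribʳ-+ w (1 ℕ.+ suc r ℕ.* 6) 3)

      n+n≤s₁ : n ℕ.+ n ≤ s₁
      n+n≤s₁ = ℕ.+-mono-≤ (ℕ.<⇒≤ n<w) (ℕ.≤-trans (ℕ.<⇒≤ n<w) (ℕ.m≤m+n w _))

    word-s₁ : word s₁ ≈ 0#
    word-s₁ = reflexive (≡.cong ι (toeplitz-digit n (suc r) 0 (s≤s (s≤s z≤n))))

    word-s₂ : word s₂ ≈ 1#
    word-s₂ = reflexive (≡.cong ι (toeplitz-digit n (suc r) 3 (s≤s (s≤s (s≤s (s≤s (s≤s z≤n)))))))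

    -- The position s₁ + i₀ - i lies at nonzero distance at most n < w from the multiple s₁ of w. So
    -- it is no multiple of w, and moving it by 3 w does not change its letter.
    word-near : ∀ {i i₀} → i ≤ n → i₀ ≤ n → i ≢ i₀ → word (s₂ ℕ.+ i₀ ∸ i) ≈ word (s₁ ℕ.+ i₀ ∸ i)
    word-near {i} {i₀} i≤n i₀≤n i≢i₀ = reflexive (≡.cong ι (≡.trans
      (≡.cong toeplitz moved) (toeplitz-periodic n (s₁ ℕ.+ i₀ ∸ i) 3 n≤ notMultiple)))
      where
      i≤s₁ : i ≤ s₁
      i≤s₁ = ℕ.≤-trans i≤n (ℕ.m+n≤o⇒m≤o n n+n≤s₁)
      i≤s₁+i₀ : i ≤ s₁ ℕ.+ i₀
      i≤s₁+i₀ = ℕ.≤-trans i≤s₁ (ℕ.m≤m+n s₁ i₀)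
      n≤ : n ≤ s₁ ℕ.+ i₀ ∸ i
      n≤ = ℕ.m+n≤o⇒m≤o∸n n (ℕ.≤-trans (ℕ.+-monoʳ-≤ n i≤n) (ℕ.≤-trans n+n≤s₁ (ℕ.m≤m+n s₁ i₀)))
      moved : s₂ ℕ.+ i₀ ∸ i ≡ s₁ ℕ.+ i₀ ∸ i ℕ.+ 3 ℕ.* w
      moved = begin
        s₂ ℕ.+ i₀ ∸ i                  ≡⟨ ≡.cong (λ s → s ℕ.+ i₀ ∸ i) s₂≡s₁+3w ⟩
        s₁ ℕ.+ 3 ℕ.* w ℕ.+ i₀ ∸ i      ≡⟨ ≡.cong (_∸ i) (ℕ.+-assoc s₁ (3 ℕ.* w) i₀) ⟩
        s₁ ℕ.+ (3 ℕ.* w ℕ.+ i₀) ∸ i    ≡⟨ ≡.cong (λ t → s₁ ℕ.+ t ∸ i) (ℕ.+-comm (3 ℕ.* w) i₀) ⟩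
        s₁ ℕ.+ (i₀ ℕ.+ 3 ℕ.* w) ∸ i    ≡⟨ ≡.cong (_∸ i) (ℕ.+-assoc s₁ i₀ (3 ℕ.* w)) ⟨
        s₁ ℕ.+ i₀ ℕ.+ 3 ℕ.* w ∸ i      ≡⟨ ℕ.+-∸-comm (3 ℕ.* w) i≤s₁+i₀ ⟩
        s₁ ℕ.+ i₀ ∸ i ℕ.+ 3 ℕ.* w      ∎
        where open ≡.≡-Reasoning
      w∣s₁ : w ∣ s₁
      w∣s₁ = divides (1 ℕ.+ suc r ℕ.* 6) refl
      small : ∀ {d} → 0 < d → d ≤ n → w ∤ d
      small {suc d} _ d≤n w∣d = ℕ.<⇒≱ n<w (ℕ.≤-trans (∣⇒≤ w∣d) d≤n)
      notMultiple : w ∤ s₁ ℕ.+ i₀ ∸ i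
      notMultiple w∣ with ℕ.<-cmp i i₀
      ... | tri≈ _ i≡i₀ _ = i≢i₀ i≡i₀
      ... | tri< i<i₀ _ _ = small (ℕ.m<n⇒0<n∸m i<i₀) (ℕ.≤-trans (ℕ.m∸n≤m i₀ i) i₀≤n)
              (∣m+n∣m⇒∣n (≡.subst (w ∣_) (ℕ.+-∸-assoc s₁ (ℕ.<⇒≤ i<i₀)) w∣) w∣s₁)
      ... | tri> _ _ i₀<i = small (ℕ.m<n⇒0<n∸m i₀<i) (ℕ.≤-trans (ℕ.m∸n≤m i i₀) i≤n)
              (∣m+n∣m⇒∣n (≡.subst (w ∣_) (≡.sym split) w∣s₁) w∣)
        where
        split : s₁ ℕ.+ i₀ ∸ i ℕ.+ (i ∸ i₀) ≡ s₁
        split = ℕ.+-cancelʳ-≡ i₀ _ _ (begin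
          s₁ ℕ.+ i₀ ∸ i ℕ.+ (i ∸ i₀) ℕ.+ i₀    ≡⟨ ℕ.+-assoc (s₁ ℕ.+ i₀ ∸ i) (i ∸ i₀) i₀ ⟩
          s₁ ℕ.+ i₀ ∸ i ℕ.+ (i ∸ i₀ ℕ.+ i₀)    ≡⟨ ≡.cong (s₁ ℕ.+ i₀ ∸ i ℕ.+_) (ℕ.m∸n+n≡m (ℕ.<⇒≤ i₀<i)) ⟩
          s₁ ℕ.+ i₀ ∸ i ℕ.+ i                  ≡⟨ ℕ.m∸n+n≡m i≤s₁+i₀ ⟩
          s₁ ℕ.+ i₀                            ∎)
          where open ≡.≡-Reasoning

    private
      shift-word : ∀ {i s} → i ≤ s → A.shift i word s ≡ word (s ∸ i)
      shift-word {i} {s} i≤s = ≡.trans (≡.cong (A.shift i word) (≡.sym (ℕ.m+[n∸m]≡n i≤s))) (A.shift-+ i word (s ∸ i))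

    -- The windows of the word around s₁ and s₂ differ at the centre only.
    no-recurrence : ∀ {a : A.Series} {i₀} → i₀ < suc n →
      partialSum (suc n) (λ i → a i * A.shift i word (s₁ ℕ.+ i₀)) ≈ 0# →
      partialSum (suc n) (λ i → a i * A.shift i word (s₂ ℕ.+ i₀)) ≈ 0# → a i₀ ≈ 0#
    no-recurrence {a} {i₀} (s≤s i₀≤n) sum₁≈0 sum₂≈0 = begin
      a i₀                         ≈⟨ +-identityˡ _ ⟨
      0# + a i₀                    ≈⟨ +-congʳ sum₁≈0 ⟨
      -- Evaluating at distance i₀ from the centre puts the central letter into term i₀. It changes
      -- from 0 to 1 there, so the sums differ by exactly a i₀.
      partialSum (suc n) (λ i → a i * A.shift i word (s₁ ℕ.+ i₀)) + a i₀
        ≈⟨ partialSum-perturb (suc n) (s≤s i₀≤n)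
             (λ { i (s≤s i≤n) i≢i₀ → *-congˡ (near i i≤n i≢i₀) }) centre ⟨
      partialSum (suc n) (λ i → a i * A.shift i word (s₂ ℕ.+ i₀)) ≈⟨ sum₂≈0 ⟩
      0#                           ∎
      where
      open SetoidReasoning setoid
      s₁≤s₂ : s₁ ≤ s₂
      s₁≤s₂ = ℕ.≤-trans (ℕ.m≤m+n s₁ _) (ℕ.≤-reflexive (≡.sym s₂≡s₁+3w))
      n≤s₁ : n ≤ s₁
      n≤s₁ = ℕ.m+n≤o⇒m≤o n n+n≤s₁
      near : ∀ i → i ≤ n → i ≢ i₀ → A.shift i word (s₂ ℕ.+ i₀) ≈ A.shift i word (s₁ ℕ.+ i₀)
      near i i≤n i≢i₀ = begin
        A.shift i word (s₂ ℕ.+ i₀)   ≡⟨ shift-word (ℕ.≤-trans (ℕ.≤-trans i≤n (ℕ.≤-trans n≤s₁ s₁≤s₂)) (ℕ.m≤m+n s₂ i₀)) ⟩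
        word (s₂ ℕ.+ i₀ ∸ i)         ≈⟨ word-near i≤n i₀≤n i≢i₀ ⟩
        word (s₁ ℕ.+ i₀ ∸ i)         ≡⟨ shift-word (ℕ.≤-trans (ℕ.≤-trans i≤n n≤s₁) (ℕ.m≤m+n s₁ i₀)) ⟨
        A.shift i word (s₁ ℕ.+ i₀)   ∎
      at-centre : ∀ s → A.shift i₀ word (s ℕ.+ i₀) ≡ word s
      at-centre s = ≡.trans (shift-word (ℕ.m≤n+m i₀ s)) (≡.cong word (ℕ.m+n∸n≡m s i₀))
      centre : a i₀ * A.shift i₀ word (s₂ ℕ.+ i₀) ≈ a i₀ * A.shift i₀ word (s₁ ℕ.+ i₀) + a i₀
      centre = begin
        a i₀ * A.shift i₀ word (s₂ ℕ.+ i₀)         ≈⟨ *-congˡ (trans (reflexive (at-centre s₂)) word-s₂) ⟩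
        a i₀ * 1#                                  ≈⟨ *-identityʳ _ ⟩
        a i₀                                       ≈⟨ +-identityˡ _ ⟨
        0# + a i₀                                  ≈⟨ +-congʳ (trans (*-congˡ (trans (reflexive (at-centre s₁)) word-s₁)) (zeroʳ _)) ⟨
        a i₀ * A.shift i₀ word (s₁ ℕ.+ i₀) + a i₀  ∎

  -- The factor by which q^s grows while s runs through one period 6^(n + 1), which contains both a
  -- digit 1 and a digit 4 in place n.
  base : ℕ → ℕ
  base n = q ℕ.^ 6 ℕ.^ suc n

  -- If the bound failed, U(ζ) f(ζ) = M(ζ) would vanish far enough for the recurrences at both
  -- windows. Then every aᵢ is 0, so U f = 0 and U = 0, against `nontrivial`. The value U(ζ) needs
  -- no estimate, being a power series.
  order-bound : ∀ n h (f : X.Series) → X.VanishesFrom (suc n) f → (∀ i → A.VanishesFrom (suc h) (f i)) →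
                ¬ (f 𝔸[X].≈ 𝔸[X].0#) → ∀ ν →
                (∀ m → m < ν → evaluate (suc n) f m ≈ 0#) →
                ν ≤ width n h ℕ.+ base n ℕ.^ 3 ℕ.* width n h
  order-bound n h f deg-X deg-u f≉0 ν low with ν ℕ.≤? width n h ℕ.+ base n ℕ.^ 3 ℕ.* width n h
  ... | yes ν≤ = ν≤
  ... | no  ν≰ = ⊥-elim (nontrivial (U≈0 , a≈0))
    where
    open Multiple (multiple n h f deg-X deg-u) using (U; a; U-vanishes; a-vanishes; identity; nontrivial)
    α = width n h
    B = base n
    u = suc (q ℕ.^ n ∸ n)

    2≤B : 2 ≤ B
    2≤B = ℕ.≤-trans 2≤q (ℕ.≤-trans (ℕ.≤-reflexive (≡.sym (ℕ.^-identityʳ q))) (ℕ.^-monoʳ-≤ q (ℕ.m^n>0 6 (suc n))))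

    -- α ≤ B^r makes the powers of u separate beyond q^(r 6^(n + 1)); B^r ≤ B α keeps the bound
    -- linear in α. Two further periods hold the windows, whence B^3.
    power = ∃-power 2≤B α (s≤s z≤n)
    r = proj₁ power

    vanishing : ∀ m → m < ν → evaluate (u ℕ.+ suc n) (linearised (suc n) a) m ≈ 0#
    vanishing m m<ν = begin
      evaluate (u ℕ.+ suc n) (linearised (suc n) a) m ≈⟨ eval-cong (u ℕ.+ suc n) (λ i _ → identity i) m ⟨
      evaluate (u ℕ.+ suc n) (U X.⊛ f) m              ≈⟨ eval-⊛ u (suc n) U-vanishes deg-X m ⟩
      (evaluate u U A.⊛ evaluate (suc n) f) m         ≈⟨ A.⊛-low low m m<ν ⟩
      0#                                              ∎
      where open SetoidReasoning setoid

    exponents : ∀ i → i < suc n → q ℕ.^ i < u ℕ.+ suc n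
    exponents i (s≤s i≤n) = s≤s (ℕ.≤-trans (ℕ.^-monoʳ-≤ q i≤n)
      (ℕ.≤-trans (ℕ.≤-reflexive (≡.sym (ℕ.m∸n+n≡m (ℕ.<⇒≤ (n<q^n n))))) (ℕ.+-monoʳ-≤ (q ℕ.^ n ∸ n) (ℕ.n≤1+n n))))

    B^ : ∀ k → B ℕ.^ k ≡ q ℕ.^ (k ℕ.* 6 ℕ.^ suc n)
    B^ k = ≡.trans (ℕ.^-*-assoc q (6 ℕ.^ suc n) k) (≡.cong (q ℕ.^_) (ℕ.*-comm (6 ℕ.^ suc n) k))

    -- Each j below α yields a scalar recurrence of its own, formed by the coefficients of u^j in
    -- the aᵢ. It is needed for d = 1 and d = 4.
    recurrence : ∀ {i₀ j} d → i₀ < suc n → j < α → 1 ≤ d → d ≤ 4 →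
      partialSum (suc n) (λ i → a i j * A.shift i word ((d ℕ.+ suc r ℕ.* 6) ℕ.* 6 ℕ.^ n ℕ.+ i₀)) ≈ 0#
    recurrence {i₀} {j} d (s≤s i₀≤n) j<α 1≤d d≤4 =
      ≡.subst (λ s → partialSum (suc n) (λ i → a i j * A.shift i word s) ≈ 0#) 1+s≡
        (trans (sym (evaluate-linearised (u ℕ.+ suc n) (suc n) a s j exponents a-vanishes α≤q^s j<α))
               (vanishing _ (ℕ.<-≤-trans below (ℕ.≰⇒≥ ν≰))))
      where
      6ⁿ t s : ℕ
      6ⁿ = 6 ℕ.^ n
      t = (d ℕ.+ suc r ℕ.* 6) ℕ.* 6ⁿ ℕ.+ i₀
      -- `evaluate-linearised` reads the exponent q^(s + 1) but compares α with q^s, so t must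
      -- strictly exceed r 6^(n + 1); d ≥ 1 supplies the extra unit.
      s = t ∸ 1
      split : ∀ d r → (d ℕ.+ r ℕ.* 6) ℕ.* 6ⁿ ≡ d ℕ.* 6ⁿ ℕ.+ r ℕ.* 6 ℕ.^ suc n
      split d r = ≡.trans (ℕ.*-distribʳ-+ 6ⁿ d (r ℕ.* 6)) (≡.cong (d ℕ.* 6ⁿ ℕ.+_) (ℕ.*-assoc r 6 6ⁿ))
      lower : suc (r ℕ.* 6 ℕ.^ suc n) ≤ t
      lower = begin
        1 ℕ.+ r ℕ.* 6 ℕ.^ suc n                  ≤⟨ ℕ.+-mono-≤ (ℕ.*-mono-≤ 1≤d (ℕ.m^n>0 6 n)) (ℕ.m≤n+m _ (6 ℕ.^ suc n)) ⟩
        d ℕ.* 6ⁿ ℕ.+ suc r ℕ.* 6 ℕ.^ suc n        ≡⟨ split d (suc r) ⟨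
        (d ℕ.+ suc r ℕ.* 6) ℕ.* 6ⁿ                ≤⟨ ℕ.m≤m+n _ i₀ ⟩
        t                                        ∎
        where open ℕ.≤-Reasoning
      upper : t ≤ (2 ℕ.+ r) ℕ.* 6 ℕ.^ suc n
      upper = begin
        (d ℕ.+ suc r ℕ.* 6) ℕ.* 6ⁿ ℕ.+ i₀                  ≤⟨ ℕ.+-monoʳ-≤ _ (ℕ.≤-trans i₀≤n (ℕ.<⇒≤ (n<6^n n))) ⟩
        (d ℕ.+ suc r ℕ.* 6) ℕ.* 6ⁿ ℕ.+ 6ⁿ                   ≡⟨ ℕ.+-comm _ 6ⁿ ⟩
        (suc d ℕ.+ suc r ℕ.* 6) ℕ.* 6ⁿ                     ≡⟨ split (suc d) (suc r) ⟩
        -- The offset i₀ < 6^n costs at most one more block, and d + 1 ≤ 6 blocks fit into one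
        -- period.
        suc d ℕ.* 6ⁿ ℕ.+ suc r ℕ.* 6 ℕ.^ suc n             ≤⟨ ℕ.+-monoˡ-≤ _ (ℕ.*-monoˡ-≤ 6ⁿ (s≤s (ℕ.m≤n⇒m≤1+n d≤4))) ⟩
        (2 ℕ.+ r) ℕ.* 6 ℕ.^ suc n                         ∎
        where open ℕ.≤-Reasoning
      1+s≡ : suc s ≡ t
      1+s≡ = ℕ.m+[n∸m]≡n (ℕ.≤-trans (s≤s z≤n) lower)
      α≤q^s : α ≤ q ℕ.^ s
      α≤q^s = begin
        α                              ≤⟨ proj₁ (proj₂ power) ⟩
        B ℕ.^ r                        ≡⟨ B^ r ⟩
        q ℕ.^ (r ℕ.* 6 ℕ.^ suc n)      ≤⟨ ℕ.^-monoʳ-≤ q (ℕ.s≤s⁻¹ (ℕ.≤-trans lower (ℕ.≤-reflexive (≡.sym 1+s≡)))) ⟩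
        q ℕ.^ s                        ∎
        where open ℕ.≤-Reasoning
      below : j ℕ.+ q ℕ.^ suc s < α ℕ.+ B ℕ.^ 3 ℕ.* α
      below = begin-strict
        j ℕ.+ q ℕ.^ suc s                            <⟨ ℕ.+-monoˡ-< _ j<α ⟩
        α ℕ.+ q ℕ.^ suc s                            ≤⟨ ℕ.+-monoʳ-≤ α (ℕ.^-monoʳ-≤ q (ℕ.≤-trans (ℕ.≤-reflexive 1+s≡) upper)) ⟩
        α ℕ.+ q ℕ.^ ((2 ℕ.+ r) ℕ.* 6 ℕ.^ suc n)      ≡⟨ ≡.cong (α ℕ.+_) (B^ (2 ℕ.+ r)) ⟨
        α ℕ.+ B ℕ.^ (2 ℕ.+ r)                        ≡⟨ ≡.cong (α ℕ.+_) (ℕ.^-distribˡ-+-* B 2 r) ⟩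
        α ℕ.+ B ℕ.^ 2 ℕ.* B ℕ.^ r                    ≤⟨ ℕ.+-monoʳ-≤ α (ℕ.*-monoʳ-≤ (B ℕ.^ 2) (proj₂ (proj₂ power))) ⟩
        α ℕ.+ B ℕ.^ 2 ℕ.* (B ℕ.* α)                  ≡⟨ ≡.cong (α ℕ.+_) (ℕ.*-assoc (B ℕ.^ 2) B α) ⟨
        α ℕ.+ B ℕ.^ 2 ℕ.* B ℕ.* α                    ≡⟨ ≡.cong (λ b → α ℕ.+ b ℕ.* α) (ℕ.*-comm (B ℕ.^ 2) B) ⟩
        α ℕ.+ B ℕ.^ 3 ℕ.* α                          ∎
        where open ℕ.≤-Reasoning

    a≈0 : ∀ i → i < suc n → a i 𝔸.≈ 𝔸.0#
    a≈0 i i≤n j with j ℕ.<? α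
    ... | yes j<α = no-recurrence n r {λ i → a i j} i≤n
            (recurrence 1 i≤n j<α ℕ.≤-refl (s≤s z≤n)) (recurrence 4 i≤n j<α (s≤s z≤n) ℕ.≤-refl)
    ... | no  j≮α = a-vanishes i j (ℕ.≮⇒≥ j≮α)

    U≈0 : U 𝔸[X].≈ 𝔸[X].0#
    U≈0 = IsDomain.regular (seriesRing-domain (seriesRing-domain field-domain)) f≉0 U
      (𝔸[X].trans identity (linearised-0 (suc n) a a≈0))

-- Laurent series in 1/T as shifted power series in u.

module LaurentSeries {c ℓ q} (F : FiniteField c ℓ q) where

  open FiniteField F using (commutativeRing)
  open CommutativeRing commutativeRing hiding (refl)
  private module R = CommutativeRing commutativeRing
  open FieldProperties F using (_≈?_)
  open PowerSeries commutativeRing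
  private
    𝔸 = seriesRing
    module 𝔸 = CommutativeRing 𝔸
  open Laurent
  open RawSemiringOps (laurentRawSemiring F) using () renaming (sum to sumᴸ; _^_ to _^ᴸ_)
  open import Algebra.Properties.Semiring.Sum 𝔸.semiring using () renaming (sum to ∑)
  open import Algebra.Properties.Semiring.Sum semiring using (sum)
  open import Algebra.Properties.Semiring.Exp 𝔸.semiring using (_^_)

  private
    i-j+j≡i : ∀ i j → i ℤ.- j ℤ.+ j ≡ i
    i-j+j≡i = solve-∀

  at : Laurent F → ℤ → Carrier
  at = _⟨_⟩ F

  coef : Series → ℤ → Carrier
  coef f (+ k)    = f k
  coef f -[1+ _ ] = 0#

  at-coef : ∀ ξ n → at ξ n ≡ coef (coeff ξ) (n ℤ.- start ξ)
  at-coef ξ n with n ℤ.- start ξ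
  ... | + i      = refl
  ... | -[1+ _ ] = refl

  coef-cong : ∀ {f g} → f ≋ g → ∀ n → coef f n ≈ coef g n
  coef-cong p (+ k)    = p k
  coef-cong p -[1+ _ ] = R.refl

  coef-<0 : ∀ f {n} → n ℤ.< + 0 → coef f n ≡ 0#
  coef-<0 f ℤ.-<+ = refl
  coef-<0 f (ℤ.+<+ ())

  coef-⊖ : ∀ f {m n} → m < n → coef f (m ℤ.⊖ n) ≡ 0#
  coef-⊖ f {m} {n} m<n = coef-<0 f
    (≡.subst (ℤ._< + 0) (≡.sym (ℤ.⊖-< m<n)) (ℤ.neg-mono-< (ℤ.+<+ (ℕ.m<n⇒0<n∸m m<n))))

  coef-const-0 : ∀ n → coef (const 0#) n ≈ 0#
  coef-const-0 (+ zero)  = R.refl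
  coef-const-0 (+ suc _) = R.refl
  coef-const-0 -[1+ _ ]  = R.refl

  coef-0 : ∀ n → coef (λ _ → 0#) n ≈ 0#
  coef-0 (+ _)    = R.refl
  coef-0 -[1+ _ ] = R.refl

  at-< : ∀ ξ {n} → n ℤ.< start ξ → at ξ n ≡ 0#
  at-< ξ {n} n<s = ≡.trans (at-coef ξ n) (coef-<0 (coeff ξ)
    (≡.subst (n ℤ.- start ξ ℤ.<_) (ℤ.+-inverseʳ (start ξ)) (ℤ.+-monoˡ-< (ℤ.- start ξ) n<s)))

  at-+ : ∀ ξ η n → at (_+ᴸ_ F ξ η) n ≈ at ξ n + at η n
  at-+ ξ η n with n ℤ.- (start ξ ℤ.⊓ start η) in eq
  ... | + i      = reflexive (≡.cong (λ m → at ξ m + at η m) (≡.trans (≡.cong (ℤ._+_ s) (≡.sym eq)) (cancel s n)))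
    where
    s = start ξ ℤ.⊓ start η
    cancel : ∀ s n → s ℤ.+ (n ℤ.- s) ≡ n
    cancel = solve-∀
  ... | -[1+ i ] = sym (trans (+-cong (reflexive (at-< ξ (ℤ.<-≤-trans n<s (ℤ.i⊓j≤i _ _))))
                                      (reflexive (at-< η (ℤ.<-≤-trans n<s (ℤ.i⊓j≤j (start ξ) _)))))
                              (+-identityˡ 0#))
    where
    s = start ξ ℤ.⊓ start η
    n<s : n ℤ.< s
    n<s = ≡.subst₂ ℤ._<_ (i-j+j≡i n s) (ℤ.+-identityˡ s)
            (ℤ.+-monoˡ-< s (≡.subst (ℤ._< + 0) (≡.sym eq) ℤ.-<+))

  at-T· : ∀ ξ n → at (T·_ F ξ) n ≡ at ξ (ℤ.suc n)
  at-T· ξ n = ≡.trans (at-coef (T·_ F ξ) n)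
    (≡.trans (≡.cong (coef (coeff ξ)) (move n (start ξ))) (≡.sym (at-coef ξ (ℤ.suc n))))
    where
    move : ∀ n s → n ℤ.- (ℤ.- + 1 ℤ.+ s) ≡ (+ 1 ℤ.+ n) ℤ.- s
    move = solve-∀

  at-constant : ∀ a n → at (constant F a) n ≡ coef (const a) n
  at-constant a n = ≡.trans (at-coef (constant F a) n)
    (≡.trans (≡.cong (coef (coeff (constant F a))) (ℤ.+-identityʳ n)) (same n))
    where
    same : ∀ n → coef (coeff (constant F a)) n ≡ coef (const a) n
    same (+ zero)  = refl
    same (+ suc _) = refl
    same -[1+ _ ]  = refl

  T^[_]_ : ℕ → F[T] F → Carrier
  T^[ k ] g = [T^_]_ F k g

  reverseCoef : F[T] F → ℤ → Carrier
  reverseCoef g (+ zero)  = T^[ 0 ] g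
  reverseCoef g (+ suc _) = 0#
  reverseCoef g -[1+ k ]  = T^[ suc k ] g

  at-embed : ∀ g n → at (embed F g) n ≈ reverseCoef g n
  at-embed [] n = trans (reflexive (at-constant 0# n)) (zero′ n)
    where
    zero′ : ∀ n → coef (const 0#) n ≈ reverseCoef [] n
    zero′ (+ zero)  = R.refl
    zero′ (+ suc _) = R.refl
    zero′ -[1+ _ ]  = R.refl
  at-embed (a ∷ g) n = begin
    at (embed F (a ∷ g)) n                              ≈⟨ at-+ (constant F a) (T·_ F (embed F g)) n ⟩
    at (constant F a) n + at (T·_ F (embed F g)) n      ≈⟨ +-cong (reflexive (at-constant a n)) (reflexive (at-T· (embed F g) n)) ⟩
    coef (const a) n + at (embed F g) (ℤ.suc n)         ≈⟨ +-congˡ (at-embed g (ℤ.suc n)) ⟩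
    coef (const a) n + reverseCoef g (ℤ.suc n)          ≈⟨ step n ⟩
    reverseCoef (a ∷ g) n                               ∎
    where
    open SetoidReasoning setoid hiding (start)
    step : ∀ n → coef (const a) n + reverseCoef g (ℤ.suc n) ≈ reverseCoef (a ∷ g) n
    step (+ zero)     = +-identityʳ a
    step (+ suc n)    = +-identityʳ 0#
    step -[1+ zero ]  = +-identityˡ _
    step -[1+ suc k ] = +-identityˡ _

  -- ξ = Tᵈ f(1/T)
  Rep : ℕ → Laurent F → Series → Set ℓ
  Rep d ξ f = ∀ n → at ξ n ≈ coef f (n ℤ.+ + d)

  coef-shift : ∀ b f m → coef (shift b f) (m ℤ.+ + b) ≡ coef f m
  coef-shift b f (+ m)    = ≡.trans (≡.cong (shift b f) (ℕ.+-comm m b)) (shift-+ b f m)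
  coef-shift b f -[1+ m ] with suc m ℕ.≤? b
  ... | yes m<b = ≡.trans (≡.cong (coef (shift b f)) (ℤ.⊖-≥ m<b))
                          (shift-< b f _ (ℕ.∸-monoʳ-< (s≤s z≤n) m<b))
  ... | no  m≮b = coef-⊖ (shift b f) (ℕ.≰⇒> m≮b)

  -- The offset start + d may have either sign. Writing it as a - b with natural a and b turns `Rep`
  -- into an equation of power series, which can be multiplied.
  Aligned : ℕ → Laurent F → Series → Set ℓ
  Aligned d ξ f = ∃[ a ] ∃[ b ] (+ a ≡ start ξ ℤ.+ + d ℤ.+ + b × shift a (coeff ξ) ≋ shift b f)

  shift-coef : ∀ b f k → shift b f k ≡ coef f (+ k ℤ.- + b)
  shift-coef b f k = ≡.trans (≡.cong (coef (shift b f)) (≡.sym (i-j+j≡i (+ k) (+ b)))) (coef-shift b f (+ k ℤ.- + b))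

  rep⇒aligned : ∀ {d ξ f} → Rep d ξ f → Aligned d ξ f
  rep⇒aligned {d} {ξ} {f} rep = go (start ξ ℤ.+ + d) refl
    where
    open SetoidReasoning setoid hiding (start)
    move₁ : ∀ k s d → k ℤ.- (s ℤ.+ d) ≡ k ℤ.- d ℤ.- s
    move₁ = solve-∀
    move₂ : ∀ k s → k ≡ k ℤ.+ s ℤ.- s
    move₂ = solve-∀
    go : ∀ δ → start ξ ℤ.+ + d ≡ δ → Aligned d ξ f
    go (+ a) eq = a , 0 , ≡.sym (≡.trans (ℤ.+-identityʳ _) eq) , λ k → begin
      shift a (coeff ξ) k                          ≡⟨ shift-coef a (coeff ξ) k ⟩
      coef (coeff ξ) (+ k ℤ.- + a)                 ≡⟨ ≡.cong (λ a → coef (coeff ξ) (+ k ℤ.- a)) eq ⟨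
      coef (coeff ξ) (+ k ℤ.- (start ξ ℤ.+ + d))   ≡⟨ ≡.cong (coef (coeff ξ)) (move₁ (+ k) (start ξ) (+ d)) ⟩
      coef (coeff ξ) (+ k ℤ.- + d ℤ.- start ξ)     ≡⟨ at-coef ξ (+ k ℤ.- + d) ⟨
      at ξ (+ k ℤ.- + d)                           ≈⟨ rep (+ k ℤ.- + d) ⟩
      coef f (+ k ℤ.- + d ℤ.+ + d)                 ≡⟨ ≡.cong (coef f) (i-j+j≡i (+ k) (+ d)) ⟩
      f k                                          ∎
    go -[1+ a ] eq = 0 , suc a , ≡.sym (≡.trans (≡.cong (ℤ._+ + suc a) eq) (ℤ.+-inverseˡ (+ suc a))) , λ k → begin
      coeff ξ k                                    ≡⟨ ≡.cong (coef (coeff ξ)) (move₂ (+ k) (start ξ)) ⟩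
      coef (coeff ξ) (+ k ℤ.+ start ξ ℤ.- start ξ) ≡⟨ at-coef ξ (+ k ℤ.+ start ξ) ⟨
      at ξ (+ k ℤ.+ start ξ)                       ≈⟨ rep (+ k ℤ.+ start ξ) ⟩
      coef f (+ k ℤ.+ start ξ ℤ.+ + d)             ≡⟨ ≡.cong (coef f) (ℤ.+-assoc (+ k) (start ξ) (+ d)) ⟩
      coef f (+ k ℤ.+ (start ξ ℤ.+ + d))           ≡⟨ ≡.cong (λ a → coef f (+ k ℤ.+ a)) eq ⟩
      coef f (+ k ℤ.- + suc a)                     ≡⟨ shift-coef (suc a) f k ⟨
      shift (suc a) f k                            ∎

  aligned⇒rep : ∀ {d ξ f} → Aligned d ξ f → Rep d ξ f
  aligned⇒rep {d} {ξ} {f} (a , b , eq , p) n = begin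
    at ξ n                                               ≡⟨ at-coef ξ n ⟩
    coef (coeff ξ) (n ℤ.- start ξ)                       ≡⟨ coef-shift a (coeff ξ) (n ℤ.- start ξ) ⟨
    coef (shift a (coeff ξ)) (n ℤ.- start ξ ℤ.+ + a)     ≈⟨ coef-cong p (n ℤ.- start ξ ℤ.+ + a) ⟩
    coef (shift b f) (n ℤ.- start ξ ℤ.+ + a)             ≡⟨ ≡.cong (λ a → coef (shift b f) (n ℤ.- start ξ ℤ.+ a)) eq ⟩
    coef (shift b f) (n ℤ.- start ξ ℤ.+ (start ξ ℤ.+ + d ℤ.+ + b)) ≡⟨ ≡.cong (coef (shift b f)) (move n (start ξ) (+ d) (+ b)) ⟩
    coef (shift b f) (n ℤ.+ + d ℤ.+ + b)                 ≡⟨ coef-shift b f (n ℤ.+ + d) ⟩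
    coef f (n ℤ.+ + d)                                   ∎
    where
    open SetoidReasoning setoid hiding (start)
    move : ∀ n s d b → n ℤ.- s ℤ.+ (s ℤ.+ d ℤ.+ b) ≡ n ℤ.+ d ℤ.+ b
    move = solve-∀

  shift-shift : ∀ a b f → shift a (shift b f) ≋ shift (a ℕ.+ b) f
  shift-shift zero    b f k       = R.refl
  shift-shift (suc a) b f zero    = R.refl
  shift-shift (suc a) b f (suc k) = shift-shift a b f k

  shift-⊛-shift : ∀ a b f g → shift a f ⊛ shift b g ≋ shift (a ℕ.+ b) (f ⊛ g)
  shift-⊛-shift a b f g = begin
    shift a f ⊛ shift b g      ≈⟨ shift-⊛ a f (shift b g) ⟩
    shift a (f ⊛ shift b g)    ≈⟨ shift-cong a (⊛-comm f (shift b g)) ⟩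
    shift a (shift b g ⊛ f)    ≈⟨ shift-cong a (shift-⊛ b g f) ⟩
    shift a (shift b (g ⊛ f))  ≈⟨ shift-cong a (shift-cong b (⊛-comm g f)) ⟩
    shift a (shift b (f ⊛ g))  ≈⟨ shift-shift a b (f ⊛ g) ⟩
    shift (a ℕ.+ b) (f ⊛ g)    ∎
    where open SetoidReasoning 𝔸.setoid hiding (start)

  coeff-* : ∀ ξ η → coeff (_*ᴸ_ F ξ η) ≋ coeff ξ ⊛ coeff η
  coeff-* ξ η k = go k (coeff ξ)
    where
    go : ∀ k f → sum {suc k} (λ i → f (toℕ i) * coeff η (k ∸ toℕ i)) ≈ (f ⊛ coeff η) k
    go zero    f = +-identityʳ _
    go (suc k) f = +-congˡ (go k (tail f))

  rep-* : ∀ {d d′ ξ η f g} → Rep d ξ f → Rep d′ η g → Rep (d ℕ.+ d′) (_*ᴸ_ F ξ η) (f ⊛ g)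
  rep-* {d} {d′} {ξ} {η} {f} {g} rf rg = aligned⇒rep (combine (rep⇒aligned rf) (rep⇒aligned rg))
    where
    open SetoidReasoning 𝔸.setoid hiding (start)
    move : ∀ s d b s′ d′ b′ → (s ℤ.+ d ℤ.+ b) ℤ.+ (s′ ℤ.+ d′ ℤ.+ b′) ≡ (s ℤ.+ s′) ℤ.+ (d ℤ.+ d′) ℤ.+ (b ℤ.+ b′)
    move = solve-∀
    combine : Aligned d ξ f → Aligned d′ η g → Aligned (d ℕ.+ d′) (_*ᴸ_ F ξ η) (f ⊛ g)
    combine (a , b , eq , p) (a′ , b′ , eq′ , p′) = a ℕ.+ a′ , b ℕ.+ b′
      , ≡.trans (≡.cong₂ ℤ._+_ eq eq′) (move (start ξ) (+ d) (+ b) (start η) (+ d′) (+ b′))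
      , (begin
          shift (a ℕ.+ a′) (coeff (_*ᴸ_ F ξ η))       ≈⟨ shift-cong (a ℕ.+ a′) (coeff-* ξ η) ⟩
          shift (a ℕ.+ a′) (coeff ξ ⊛ coeff η)        ≈⟨ shift-⊛-shift a a′ (coeff ξ) (coeff η) ⟨
          shift a (coeff ξ) ⊛ shift a′ (coeff η)      ≈⟨ ⊛-cong p p′ ⟩
          shift b f ⊛ shift b′ g                      ≈⟨ shift-⊛-shift b b′ f g ⟩
          shift (b ℕ.+ b′) (f ⊛ g)                    ∎)

  coef-+ : ∀ f g n → coef (f 𝔸.+ g) n ≈ coef f n + coef g n
  coef-+ f g (+ _)    = R.refl
  coef-+ f g -[1+ _ ] = sym (+-identityˡ 0#)

  rep-^ : ∀ {ξ f} → Rep 0 ξ f → ∀ n → Rep 0 (ξ ^ᴸ n) (f ^ n)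
  rep-^ r zero    n = trans (reflexive (at-constant 1# n)) (reflexive (≡.cong (coef (const 1#)) (≡.sym (ℤ.+-identityʳ n))))
  rep-^ r (suc i) = rep-* r (rep-^ r i)

  rep-∑ : ∀ {d n} (ξs : Fin n → Laurent F) (fs : Fin n → Series) → (∀ i → Rep d (ξs i) (fs i)) →
          Rep d (sumᴸ ξs) (∑ fs)
  rep-∑ {d} {zero}  ξs fs r n =
    trans (reflexive (at-constant 0# n)) (trans (coef-const-0 n) (sym (coef-0 (n ℤ.+ + d))))
  rep-∑ {d} {suc k} ξs fs r n = begin
    at (sumᴸ ξs) n
      ≈⟨ at-+ (ξs Fin.zero) (sumᴸ (ξs ∘ Fin.suc)) n ⟩
    at (ξs Fin.zero) n + at (sumᴸ (ξs ∘ Fin.suc)) n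
      ≈⟨ +-cong (r Fin.zero n) (rep-∑ (ξs ∘ Fin.suc) (fs ∘ Fin.suc) (r ∘ Fin.suc) n) ⟩
    coef (fs Fin.zero) (n ℤ.+ + d) + coef (∑ (fs ∘ Fin.suc)) (n ℤ.+ + d)
      ≈⟨ coef-+ (fs Fin.zero) (∑ (fs ∘ Fin.suc)) (n ℤ.+ + d) ⟨
    coef (∑ fs) (n ℤ.+ + d) ∎
    where open SetoidReasoning setoid hiding (start)

  rep-cong : ∀ {d ξ f g} → f ≋ g → Rep d ξ f → Rep d ξ g
  rep-cong {d} p r n = trans (r n) (coef-cong p (n ℤ.+ + d))

  DegreeAtMost : ℕ → F[T] F → Set ℓ
  DegreeAtMost h g = ∀ k → h < k → T^[ k ] g ≈ 0#

  -- This is u^h g(1/u), the reversed polynomial; its constant term is the coefficient of T^h.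
  homogenise : ℕ → F[T] F → Series
  homogenise h g k with k ℕ.≤? h
  ... | yes _ = T^[ h ∸ k ] g
  ... | no  _ = 0#

  homogenise-≤ : ∀ h g {k} → k ≤ h → homogenise h g k ≡ T^[ h ∸ k ] g
  homogenise-≤ h g {k} k≤h with k ℕ.≤? h
  ... | yes _   = refl
  ... | no  k≰h = ⊥-elim (k≰h k≤h)

  homogenise-> : ∀ h g {k} → h < k → homogenise h g k ≡ 0#
  homogenise-> h g {k} h<k with k ℕ.≤? h
  ... | yes k≤h = ⊥-elim (ℕ.<⇒≱ h<k k≤h)
  ... | no  _   = refl

  rep-embed : ∀ {h g} → DegreeAtMost h g → Rep h (embed F g) (homogenise h g)
  rep-embed {h} {g} deg n = trans (at-embed g n) (go n)
    where
    go : ∀ n → reverseCoef g n ≈ coef (homogenise h g) (n ℤ.+ + h)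
    go (+ zero)  = reflexive (≡.sym (≡.trans (homogenise-≤ h g ℕ.≤-refl) (≡.cong (T^[_] g) (ℕ.n∸n≡0 h))))
    go (+ suc n) = reflexive (≡.sym (homogenise-> h g (s≤s (ℕ.m≤n+m h n))))
    go -[1+ k ] with suc k ℕ.≤? h
    ... | yes k<h = reflexive (≡.sym (≡.trans (≡.cong (coef (homogenise h g)) (ℤ.⊖-≥ k<h))
            (≡.trans (homogenise-≤ h g (ℕ.m∸n≤m h (suc k))) (≡.cong (T^[_] g) (ℕ.m∸[m∸n]≡n k<h)))))
    ... | no  k≮h = trans (deg (suc k) (ℕ.≰⇒> k≮h)) (reflexive (≡.sym (coef-⊖ (homogenise h g) (ℕ.≰⇒> k≮h))))

  homogeniseP : ∀ {n} → ℕ → F[T][X]≤ F n → ℕ → Series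
  homogeniseP {n} h P i with i ℕ.<? suc n
  ... | yes i≤n = homogenise h (P (Fin.fromℕ< i≤n))
  ... | no  _   = λ _ → 0#

  homogeniseP-toℕ : ∀ {n} h (P : F[T][X]≤ F n) i → homogeniseP h P (toℕ i) ≡ homogenise h (P i)
  homogeniseP-toℕ {n} h P i with toℕ i ℕ.<? suc n
  ... | yes i≤n = ≡.cong (homogenise h ∘ P) (Fin.fromℕ<-toℕ i i≤n)
  ... | no  i≰n = ⊥-elim (i≰n (Fin.toℕ<n i))

  homogeniseP-> : ∀ {n} h (P : F[T][X]≤ F n) i → n < i → homogeniseP h P i ≡ (λ _ → 0#)
  homogeniseP-> {n} h P i n<i with i ℕ.<? suc n
  ... | yes (s≤s i≤n) = ⊥-elim (ℕ.<⇒≱ n<i i≤n)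
  ... | no  _         = refl

  homogeniseP-deg : ∀ {n} h (P : F[T][X]≤ F n) i → VanishesFrom (suc h) (homogeniseP h P i)
  homogeniseP-deg {n} h P i k h<k with i ℕ.<? suc n
  ... | yes i≤n = reflexive (homogenise-> h _ h<k)
  ... | no  _   = R.refl

  -- All coefficients are scaled by the same u^h, and ξ itself is already a power series z in u, so
  -- P(ξ) is T^h times the value of the scaled polynomial at z.
  rep-eval : ∀ {n h ξ z} (P : F[T][X]≤ F n) → (∀ i → DegreeAtMost h (P i)) → Rep 0 ξ z →
             Rep h (eval F P ξ) (Evaluation.evaluate 𝔸 z (suc n) (homogeniseP h P))
  rep-eval {n} {h} {ξ} {z} P deg r = rep-cong {h} {eval F P ξ}
    (𝔸.sym (Evaluation.eval-sum 𝔸 z (suc n) (homogeniseP h P)))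
    (rep-∑ {h} (λ i → _*ᴸ_ F (embed F (P i)) (ξ ^ᴸ toℕ i)) (λ (i : Fin (suc n)) → homogeniseP h P (toℕ i) ⊛ z ^ toℕ i) term)
    where
    term : ∀ i → Rep h (_*ᴸ_ F (embed F (P i)) (ξ ^ᴸ toℕ i)) (homogeniseP h P (toℕ i) ⊛ z ^ toℕ i)
    term i = ≡.subst₂ (λ d f → Rep d (_*ᴸ_ F (embed F (P i)) (ξ ^ᴸ toℕ i)) (f ⊛ z ^ toℕ i))
      (ℕ.+-identityʳ h) (≡.sym (homogeniseP-toℕ h P i)) (rep-* (rep-embed (deg i)) (rep-^ r (toℕ i)))

  OrderAt : Series → ℕ → Set ℓ
  OrderAt f ν = f ν ≉ 0# × (∀ m → m < ν → f m ≈ 0#)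

  order⇒abs : ∀ {d ξ f ν} → Rep d ξ f → OrderAt f ν → ∣_∣≡_ F ξ (q^-_ F (+ ν ℤ.- + d))
  order⇒abs {d} {ξ} {f} {ν} r (fν≉0 , low) = inj₂ (+ ν ℤ.- + d
    , (λ z → fν≉0 (trans (sym (trans (r (+ ν ℤ.- + d)) (reflexive (≡.cong (coef f) (i-j+j≡i (+ ν) (+ d)))))) z))
    , (λ n n<N → trans (r n) (below (n ℤ.+ + d) (≡.subst (n ℤ.+ + d ℤ.<_) (i-j+j≡i (+ ν) (+ d)) (ℤ.+-monoˡ-< (+ d) n<N))))
    , refl)
    where
    below : ∀ m → m ℤ.< + ν → coef f m ≈ 0#
    below (+ m)    (ℤ.+<+ m<ν) = low m m<ν
    below -[1+ _ ] _           = R.refl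

  abs⇒order : ∀ {d ξ f x} → Rep d ξ f → ∣_∣≡_ F ξ x →
              (f ≋ 𝔸.0# × x ≡ 0ℚ) ⊎ (∃[ N ] ∃[ ν ] (OrderAt f ν × + ν ≡ N ℤ.+ + d × x ≡ q^-_ F N))
  abs⇒order {d} {ξ} {f} r (inj₁ (ξ≈0 , x≡0)) = inj₁ ((λ k → begin
      f k                              ≡⟨ ≡.cong (coef f) (i-j+j≡i (+ k) (+ d)) ⟨
      coef f (+ k ℤ.- + d ℤ.+ + d)     ≈⟨ r (+ k ℤ.- + d) ⟨
      at ξ (+ k ℤ.- + d)               ≈⟨ ξ≈0 (+ k ℤ.- + d) ⟩
      at (constant F 0#) (+ k ℤ.- + d) ≡⟨ at-constant 0# (+ k ℤ.- + d) ⟩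
      coef (const 0#) (+ k ℤ.- + d)    ≈⟨ coef-const-0 (+ k ℤ.- + d) ⟩
      0#                               ∎) , x≡0)
    where
    open SetoidReasoning setoid hiding (start)
  abs⇒order {d} {ξ} {f} r (inj₂ (N , ξN≉0 , low , x≡)) = inj₂ (N , go (N ℤ.+ + d) refl)
    where
    go : ∀ m → N ℤ.+ + d ≡ m → ∃[ ν ] (OrderAt f ν × + ν ≡ N ℤ.+ + d × _)
    go -[1+ _ ] eq = ⊥-elim (ξN≉0 (trans (r N) (reflexive (≡.cong (coef f) eq))))
    go (+ ν)    eq = ν
      , ((λ fν≈0 → ξN≉0 (trans (r N) (trans (reflexive (≡.cong (coef f) eq)) fν≈0)))
        , λ m m<ν → trans (sym (trans (r (+ m ℤ.- + d)) (reflexive (≡.cong (coef f) (i-j+j≡i (+ m) (+ d))))))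
            (low (+ m ℤ.- + d) (≡.subst (+ m ℤ.- + d ℤ.<_)
              (≡.trans (≡.cong (ℤ._- + d) (≡.sym eq)) (back N (+ d))) (ℤ.+-monoˡ-< (ℤ.- + d) (ℤ.+<+ m<ν)))))
      , ≡.sym eq , x≡
      where
      back : ∀ N d → N ℤ.+ d ℤ.- d ≡ N
      back = solve-∀

  -- Unlike the order of a series, the degree is computable: coefficient lists are finite and
  -- equality in F is decidable.
  zero-or-degree : ∀ g → (∀ k → T^[ k ] g ≈ 0#) ⊎ (∃[ k ] (T^[ k ] g ≉ 0# × DegreeAtMost k g))
  zero-or-degree [] = inj₁ λ _ → R.refl
  zero-or-degree (a ∷ g) with zero-or-degree g
  ... | inj₂ (k , gk≉0 , deg) = inj₂ (suc k , gk≉0 , λ { (suc j) (s≤s k<j) → deg j k<j })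
  ... | inj₁ g≈0 with a ≈? 0#
  ...   | yes a≈0 = inj₁ λ { zero → a≈0 ; (suc k) → g≈0 k }
  ...   | no  a≉0 = inj₂ (0 , a≉0 , λ { (suc j) _ → g≈0 j })

  dehomogenise : ℕ → Series → F[T] F
  dehomogenise h f = applyUpTo (λ k → f (h ∸ k)) (suc h)

  T^-applyUpTo-< : ∀ (g : Series) n {k} → k < n → T^[ k ] (applyUpTo g n) ≡ g k
  T^-applyUpTo-< g (suc n) {zero}  _         = refl
  T^-applyUpTo-< g (suc n) {suc k} (s≤s k<n) = T^-applyUpTo-< (tail g) n k<n

  T^-≥length : ∀ g {k} → length g ≤ k → T^[ k ] g ≡ 0#
  T^-≥length []      _         = refl
  T^-≥length (a ∷ g) {suc k} (s≤s l≤k) = T^-≥length g l≤k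

  dehomogenise-degree : ∀ h f → DegreeAtMost h (dehomogenise h f)
  dehomogenise-degree h f k h<k = reflexive (T^-≥length (dehomogenise h f)
    (≡.subst (_≤ k) (≡.sym (length-applyUpTo (λ k → f (h ∸ k)) (suc h))) h<k))
    where open import Data.List.Properties using (length-applyUpTo)

  homogenise-dehomogenise : ∀ {h f} → VanishesFrom (suc h) f → homogenise h (dehomogenise h f) ≋ f
  homogenise-dehomogenise {h} {f} vf k with k ℕ.≤? h
  ... | yes k≤h = reflexive (≡.trans (T^-applyUpTo-< (λ k → f (h ∸ k)) (suc h) (s≤s (ℕ.m∸n≤m h k)))
                                     (≡.cong f (ℕ.m∸[m∸n]≡n k≤h)))
  ... | no  k≰h = sym (vf k (ℕ.≰⇒> k≰h))

-- Rational numbers, cuts and powers of q.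

⌜_⌝ : ℕ → ℚ
⌜ n ⌝ = mkℚ (+ n) 0 (Coprimality.sym (Coprimality.1-coprimeTo n))

-- `+ n / 1` passes through a gcd and is stuck for a variable n. `⌜ n ⌝` exposes its numerator and
-- denominator, so that `_≤_^-ℚ_` reduces at it.
/1≡⌜⌝ : ∀ n → + n ℚ./ 1 ≡ ⌜ n ⌝
/1≡⌜⌝ n = ℚ.normalize-coprime (Coprimality.sym (Coprimality.1-coprimeTo n))

⌜⌝-* : ∀ m n → ⌜ m ℕ.* n ⌝ ≡ ⌜ m ⌝ ℚ.* ⌜ n ⌝
⌜⌝-* m n = ℚ.toℚᵘ-injective (ℚᵘ.≃-trans (*≡* (≡.cong (ℤ._* + 1) (ℤ.pos-* m n)))
                                         (ℚᵘ.≃-sym (ℚ.toℚᵘ-homo-* ⌜ m ⌝ ⌜ n ⌝)))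

⌜⌝-mono-≤ : ∀ {m n} → m ≤ n → ⌜ m ⌝ ℚ.≤ ⌜ n ⌝
⌜⌝-mono-≤ m≤n = ℚ.*≤* (ℤ.*-monoʳ-≤-nonNeg (+ 1) (ℤ.+≤+ m≤n))

⌜⌝-mono-< : ∀ {m n} → m < n → ⌜ m ⌝ ℚ.< ⌜ n ⌝
⌜⌝-mono-< m<n = ℚ.*<* (ℤ.*-monoʳ-<-pos (+ 1) (ℤ.+<+ m<n))

⌜⌝-cancel-≤ : ∀ {m n} → ⌜ m ⌝ ℚ.≤ ⌜ n ⌝ → m ≤ n
⌜⌝-cancel-≤ {m} {n} m≤n = ℕ.≮⇒≥ λ n<m → ℚ.<-irrefl refl (ℚ.<-≤-trans (⌜⌝-mono-< n<m) m≤n)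

1/d*d≡1 : ∀ d .{{_ : NonZero d}} → (+ 1 ℚ./ d) ℚ.* ⌜ d ⌝ ≡ 1ℚ
1/d*d≡1 (suc d) = ℚ.toℚᵘ-injective (ℚᵘ.≃-trans (ℚ.toℚᵘ-homo-* (+ 1 ℚ./ suc d) ⌜ suc d ⌝)
  (ℚᵘ.≃-trans (ℚᵘ.*-congʳ {mkℚᵘ (+ suc d) 0} (ℚ.toℚᵘ-fromℚᵘ (mkℚᵘ (+ 1) d)))
    (*≡* (begin
      + 1 ℤ.* + suc d ℤ.* + 1        ≡⟨ ℤ.*-identityʳ _ ⟩
      + 1 ℤ.* + suc d                ≡⟨ ≡.cong (λ k → + 1 ℤ.* + k) (ℕ.*-identityʳ (suc d)) ⟨
      + 1 ℤ.* + (suc d ℕ.* 1)        ∎))))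
  where open ≡.≡-Reasoning

<⌜⌝ : ∀ r → ∃[ n ] r ℚ.< ⌜ n ⌝
<⌜⌝ r = suc ℤ.∣ ↥ r ∣ , ℚ.*<* (ℤ.<-≤-trans (≡.subst (ℤ._< + suc ℤ.∣ ↥ r ∣) (≡.sym (ℤ.*-identityʳ (↥ r))) (below (↥ r)))
  (≡.subst (ℤ._≤ + suc ℤ.∣ ↥ r ∣ ℤ.* ↧ r) (ℤ.*-identityʳ _)
    (ℤ.*-monoˡ-≤-nonNeg (+ suc ℤ.∣ ↥ r ∣) (ℤ.+≤+ (s≤s z≤n)))))
  where
  below : ∀ i → i ℤ.< + suc ℤ.∣ i ∣
  below (+ n)    = ℤ.+<+ (ℕ.n<1+n n)
  below -[1+ n ] = ℤ.-<+

rational : ℚ → ℝ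
rational s = record
  { Lower = ℚ._< s
  ; Upper = s ℚ.<_
  ; lower-inh = s ℚ.- 1ℚ , ≡.subst (s ℚ.- 1ℚ ℚ.<_) (ℚ.+-identityʳ s) (ℚ.+-monoʳ-< s (ℚ.negative⁻¹ (ℚ.- 1ℚ)))
  ; upper-inh = s ℚ.+ 1ℚ , ≡.subst (ℚ._< s ℚ.+ 1ℚ) (ℚ.+-identityʳ s) (ℚ.+-monoʳ-< s (ℚ.positive⁻¹ 1ℚ))
  ; lower-down = ℚ.<-trans
  ; upper-up = λ r<t s<r → ℚ.<-trans s<r r<t
  ; lower-rounded = λ r<s → let (m , r<m , m<s) = ℚ.<-dense r<s in m , r<m , m<s
  ; upper-rounded = λ s<r → let (m , s<m , m<r) = ℚ.<-dense s<r in m , m<r , s<m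
  ; disjoint = λ (r<s , s<r) → ℚ.<-asym r<s s<r
  ; located = located
  }
  where
  located : ∀ {r t} → r ℚ.< t → r ℚ.< s ⊎ s ℚ.< t
  located {r} {t} r<t with ℚ.<-cmp r s
  ... | tri< r<s _ _  = inj₁ r<s
  ... | tri≈ _ refl _ = inj₂ r<t
  ... | tri> _ _ s<r  = inj₂ (ℚ.<-trans s<r r<t)

module AbsoluteValues {c ℓ q} (F : FiniteField c ℓ q) (2≤q : 2 ≤ q) where

  private
    instance
      q≢0 : NonZero q
      q≢0 = FiniteField.q≢0 F
    infix 8 _^_
    _^_ = ℚ-Ops._^_

  pow : ℕ → ℚ
  pow n = ⌜ q ℕ.^ n ⌝

  pow-+ : ∀ m n → pow (m ℕ.+ n) ≡ pow m ℚ.* pow n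
  pow-+ m n = ≡.trans (≡.cong ⌜_⌝ (ℕ.^-distribˡ-+-* q m n)) (⌜⌝-* (q ℕ.^ m) (q ℕ.^ n))

  pow-mono-≤ : ∀ {m n} → m ≤ n → pow m ℚ.≤ pow n
  pow-mono-≤ m≤n = ⌜⌝-mono-≤ (ℕ.^-monoʳ-≤ q m≤n)

  pow-cancel-≤ : ∀ {m n} → pow m ℚ.≤ pow n → m ≤ n
  pow-cancel-≤ {m} {n} p = ℕ.≮⇒≥ λ n<m → ℕ.<⇒≱ (ℕ.^-monoʳ-< q 2≤q n<m) (⌜⌝-cancel-≤ p)

  pow-positive : ∀ n → ℚ.Positive (pow n)
  pow-positive n = ℚ.positive (⌜⌝-mono-< (ℕ.m^n>0 q n))

  pow-nonNegative : ∀ n → ℚ.NonNegative (pow n)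
  pow-nonNegative n = ℚ.pos⇒nonNeg (pow n) {{pow-positive n}}

  pow-^ : ∀ n k → pow n ^ k ≡ pow (n ℕ.* k)
  pow-^ n zero    = ≡.cong pow (≡.sym (ℕ.*-zeroʳ n))
  pow-^ n (suc k) = ≡.trans (≡.cong (pow n ℚ.*_) (pow-^ n k))
    (≡.trans (≡.sym (pow-+ n (n ℕ.* k))) (≡.cong pow (≡.sym (ℕ.*-suc n k))))

  abs : ℤ → ℚ
  abs = q^-_ F

  abs-negative : ∀ n → abs (ℤ.- + n) ≡ pow n
  abs-negative zero    = refl
  abs-negative (suc n) = /1≡⌜⌝ (q ℕ.^ suc n)

  abs*pow≡1 : ∀ n → abs (+ n) ℚ.* pow n ≡ 1ℚ
  abs*pow≡1 n = 1/d*d≡1 (q ℕ.^ n) {{ℕ.m^n≢0 q n}}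

  abs-positive : ∀ N → 0ℚ ℚ.< abs N
  abs-positive (+ n)    = ℚ.*-cancelʳ-<-nonNeg (pow n) {{pow-nonNegative n}}
    (≡.subst₂ ℚ._<_ (≡.sym (ℚ.*-zeroˡ (pow n))) (≡.sym (abs*pow≡1 n)) (ℚ.positive⁻¹ 1ℚ))
  abs-positive -[1+ n ] = ≡.subst (0ℚ ℚ.<_) (≡.sym (abs-negative (suc n))) (ℚ.positive⁻¹ _ {{pow-positive (suc n)}})

  abs-≤1 : ∀ n → abs (+ n) ℚ.≤ 1ℚ
  abs-≤1 n = ℚ.*-cancelʳ-≤-pos (pow n) {{pow-positive n}} (≡.subst₂ ℚ._≤_ (≡.sym (abs*pow≡1 n)) (≡.sym (ℚ.*-identityˡ _))
    (pow-mono-≤ {0} {n} z≤n))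

  abs-≤pow : ∀ {N h} → ℤ.- + h ℤ.≤ N → abs N ℚ.≤ pow h
  abs-≤pow {+ n}      {h} _ = ℚ.≤-trans (abs-≤1 n) (pow-mono-≤ {0} {h} z≤n)
  abs-≤pow { -[1+ n ]} {suc h} (ℤ.-≤- n≤h) = ≡.subst (ℚ._≤ pow (suc h)) (≡.sym (abs-negative (suc n))) (pow-mono-≤ (s≤s n≤h))
  abs-≤pow { -[1+ n ]} {zero} ()

  abs*pow≤1 : ∀ N m → abs N ℚ.* pow m ℚ.≤ 1ℚ → + m ℤ.≤ N
  abs*pow≤1 (+ n) m p = ℤ.+≤+ (pow-cancel-≤ (begin
    pow m                              ≡⟨ ℚ.*-identityˡ _ ⟨
    1ℚ ℚ.* pow m                       ≡⟨ ≡.cong (ℚ._* pow m) (abs*pow≡1 n) ⟨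
    abs (+ n) ℚ.* pow n ℚ.* pow m      ≡⟨ ≡.trans (ℚ.*-assoc (abs (+ n)) (pow n) (pow m)) (≡.trans (≡.cong (abs (+ n) ℚ.*_) (ℚ.*-comm (pow n) (pow m))) (≡.sym (ℚ.*-assoc (abs (+ n)) (pow m) (pow n)))) ⟩
    abs (+ n) ℚ.* pow m ℚ.* pow n      ≤⟨ ℚ.*-monoʳ-≤-nonNeg (pow n) {{pow-nonNegative n}} p ⟩
    1ℚ ℚ.* pow n                       ≡⟨ ℚ.*-identityˡ _ ⟩
    pow n                              ∎))
    where open ℚ.≤-Reasoning
  abs*pow≤1 -[1+ n ] m p = ⊥-elim (ℕ.<⇒≱ (s≤s z≤n) (pow-cancel-≤ {suc n ℕ.+ m} {0}
    (≡.subst (ℚ._≤ 1ℚ) (≡.trans (≡.cong (ℚ._* pow m) (abs-negative (suc n))) (≡.sym (pow-+ (suc n) m))) p)))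

  abs-^*pow : ∀ n k → abs (+ n) ^ k ℚ.* pow (n ℕ.* k) ≡ 1ℚ
  abs-^*pow n k = ≡.trans (≡.cong (abs (+ n) ^ k ℚ.*_) (≡.sym (pow-^ n k)))
    (≡.trans (≡.sym (^-distrib (abs (+ n)) (pow n) k)) (≡.trans (≡.cong (_^ k) (abs*pow≡1 n)) (1^ k)))
    where
    open import Algebra.Properties.CommutativeSemigroup
      (CommutativeRing.*-commutativeSemigroup ℚ.+-*-commutativeRing) using (interchange)
    ^-distrib : ∀ x y k → (x ℚ.* y) ^ k ≡ x ^ k ℚ.* y ^ k
    ^-distrib x y zero    = refl
    ^-distrib x y (suc k) = ≡.trans (≡.cong (x ℚ.* y ℚ.*_) (^-distrib x y k)) (interchange x y (x ^ k) (y ^ k))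
    1^ : ∀ k → 1ℚ ^ k ≡ 1ℚ
    1^ zero    = refl
    1^ (suc k) = ≡.trans (ℚ.*-identityˡ _) (1^ k)

  abs-^-nonNegative : ∀ n k → ℚ.NonNegative (abs (+ n) ^ k)
  abs-^-nonNegative n k = ℚ.nonNegative (ℚ.*-cancelʳ-≤-pos {0ℚ} {abs (+ n) ^ k} (pow (n ℕ.* k)) {{pow-positive (n ℕ.* k)}}
    (≡.subst₂ ℚ._≤_ (≡.sym (ℚ.*-zeroˡ (pow (n ℕ.* k)))) (≡.sym (abs-^*pow n k)) (ℚ.nonNegative⁻¹ 1ℚ)))

  -- For r = m / k < W, comparing k-th powers requires h m ≤ n k, and h m ≤ h W k ≤ n k. For
  -- negative r the left side is at most 1 and the right side at least 1.
  approximation-≤ : ∀ {W h n} → W ℕ.* h ≤ n → _≤_^-_ (abs (+ n)) (pow h) (rational ⌜ W ⌝)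
  approximation-≤ {W} {h} {n} Wh≤n r@(mkℚ (+ m) k-1 _) r<W = begin
    abs (+ n) ^ k ℚ.* pow h ^ m              ≡⟨ ≡.cong (abs (+ n) ^ k ℚ.*_) (pow-^ h m) ⟩
    abs (+ n) ^ k ℚ.* pow (h ℕ.* m)          ≤⟨ ℚ.*-monoˡ-≤-nonNeg (abs (+ n) ^ k) {{abs-^-nonNegative n k}} (pow-mono-≤ hm≤nk) ⟩
    abs (+ n) ^ k ℚ.* pow (n ℕ.* k)          ≡⟨ abs-^*pow n k ⟩
    1ℚ                                       ∎
    where
    open ℚ.≤-Reasoning
    k = suc k-1
    m<Wk : m < W ℕ.* k
    m<Wk = ℤ.drop‿+<+ (≡.subst₂ ℤ._<_ (ℤ.*-identityʳ (+ m)) (≡.sym (ℤ.pos-* W k)) (ℚ.drop-*<* r<W))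
    hm≤nk : h ℕ.* m ≤ n ℕ.* k
    hm≤nk = ℕ.≤-trans (ℕ.*-monoʳ-≤ h (ℕ.<⇒≤ m<Wk)) (ℕ.≤-trans
      (ℕ.≤-reflexive (≡.trans (≡.sym (ℕ.*-assoc h W k)) (≡.cong (ℕ._* k) (ℕ.*-comm h W))))
      (ℕ.*-monoˡ-≤ k Wh≤n))
  approximation-≤ {W} {h} {n} Wh≤n r@(mkℚ -[1+ m ] k-1 _) r<W = begin
    abs (+ n) ^ k                            ≡⟨ ℚ.*-identityʳ _ ⟨
    abs (+ n) ^ k ℚ.* pow 0                  ≤⟨ ℚ.*-monoˡ-≤-nonNeg (abs (+ n) ^ k) {{abs-^-nonNegative n k}} (pow-mono-≤ {0} {n ℕ.* k} z≤n) ⟩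
    abs (+ n) ^ k ℚ.* pow (n ℕ.* k)          ≡⟨ abs-^*pow n k ⟩
    pow 0                                    ≤⟨ pow-mono-≤ {0} {h ℕ.* suc m} z≤n ⟩
    pow (h ℕ.* suc m)                        ≡⟨ pow-^ h (suc m) ⟨
    pow h ^ suc m                            ∎
    where
    open ℚ.≤-Reasoning
    k = suc k-1

  -- Testing the cut at the single integer M below w is enough, and then the denominator is 1.
  approximation-order : ∀ {N h M w} → ℝ.Lower w ⌜ M ⌝ → _≤_^-_ (abs N) (pow h) w → + (h ℕ.* M) ℤ.≤ N
  approximation-order {N} {h} {M} M<w x≤ = abs*pow≤1 N (h ℕ.* M)
    (≡.subst (ℚ._≤ 1ℚ) (≡.cong₂ ℚ._*_ (ℚ.*-identityʳ (abs N)) (pow-^ h M)) (x≤ ⌜ M ⌝ M<w))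

-- Finite exponents and infinite limit superior.

module Construction {c ℓ} {p e q : ℕ} (p-prime : Prime p) (1≤e : 1 ≤ e) (q≡p^e : q ≡ p ℕ.^ e)
                    (F : FiniteField c ℓ q) (bits : ℕ → Bool) where

  open FiniteField F using (commutativeRing; 0≉1)
  open CommutativeRing commutativeRing hiding (refl)
  private module R = CommutativeRing commutativeRing
  open FieldProperties F using (to; from; from-to)
  open OrderBound {e = e} p-prime 1≤e q≡p^e F bits
  open LaurentSeries F
  open AbsoluteValues F 2≤q
  open import Algebra.Properties.Semiring.Exp 𝔸.semiring using () renaming (_^_ to _^𝔸_; ^-congʳ to ^𝔸-congʳ)

  ξ : Laurent F
  ξ = record { start = + 0 ; coeff = ζ }

  rep-ξ : Rep 0 ξ ζ
  rep-ξ n = reflexive (at-coef ξ n)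

  at-ξ : ∀ s → at ξ (+ (q ℕ.^ s)) ≡ word s
  at-ξ s = ≡.trans (at-coef ξ (+ (q ℕ.^ s))) (≡.trans (≡.cong ζ (ℕ.+-identityʳ (q ℕ.^ s))) (lacunary-power word s))

  -- The finitely many polynomials of height at most 1, for which H(P)^(-w) says nothing about w. An
  -- approximation outside this list has T-degree h ≥ 1.
  constants : ∀ n → List (F[T][X]≤ F n)
  constants n = List.map (λ i j → from (Fin.finToFun i j) ∷ []) (List.allFin (q ℕ.^ suc n))

  constants-complete : ∀ {n} (P : F[T][X]≤ F n) → (∀ i → DegreeAtMost 0 (P i)) →
                       ¬ All (λ Q → ¬ _≈ᴾ_ F P Q) (constants n)
  constants-complete {n} P deg all = All.lookup all
    (∈-map⁺ (λ i j → from (Fin.finToFun i j) ∷ []) (∈-allFin code)) equal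
    where
    code : Fin (q ℕ.^ suc n)
    code = Fin.funToFin λ j → to (T^[ 0 ] P j)
    equal : _≈ᴾ_ F P (λ j → from (Fin.finToFun code j) ∷ [])
    equal j zero    = trans (sym (from-to (T^[ 0 ] P j)))
      (reflexive (≡.cong from (≡.sym (Fin.finToFun-funToFin (λ j → to (T^[ 0 ] P j)) j))))
    equal j (suc k) = deg j (suc k) (s≤s z≤n)

  zero-or-maxDegree : ∀ {m} (P : Fin m → F[T] F) → (∀ i k → T^[ k ] P i ≈ 0#) ⊎
    (∃[ h ] ∃[ i ] (T^[ h ] P i ≉ 0# × (∀ j → DegreeAtMost h (P j))))
  zero-or-maxDegree {zero}  P = inj₁ λ ()
  zero-or-maxDegree {suc m} P with zero-or-degree (P Fin.zero) | zero-or-maxDegree (P ∘ Fin.suc)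
  ... | inj₁ P₀≈0 | inj₁ P₊≈0 = inj₁ λ { Fin.zero → P₀≈0 ; (Fin.suc i) → P₊≈0 i }
  ... | inj₁ P₀≈0 | inj₂ (h , i , lead , deg) = inj₂ (h , Fin.suc i , lead , λ
          { Fin.zero k _ → P₀≈0 k ; (Fin.suc j) → deg j })
  ... | inj₂ (h , lead , deg) | inj₁ P₊≈0 = inj₂ (h , Fin.zero , lead , λ
          { Fin.zero → deg ; (Fin.suc j) k _ → P₊≈0 j k })
  ... | inj₂ (h , lead , deg) | inj₂ (h′ , i , lead′ , deg′) with ℕ.≤-total h h′
  ...   | inj₁ h≤h′ = inj₂ (h′ , Fin.suc i , lead′ , λ
            { Fin.zero k h′<k → deg k (ℕ.≤-<-trans h≤h′ h′<k) ; (Fin.suc j) → deg′ j })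
  ...   | inj₂ h′≤h = inj₂ (h , Fin.zero , lead , λ
            { Fin.zero → deg ; (Fin.suc j) k h<k → deg′ j k (ℕ.≤-<-trans h′≤h h<k) })

  abs-embed-≤ : ∀ {g h x} → DegreeAtMost h g → ∣_∣≡_ F (embed F g) x → x ℚ.≤ pow h
  abs-embed-≤ {g} {h} deg abs≡x with abs⇒order {h} {embed F g} (rep-embed {h} {g} deg) abs≡x
  ... | inj₁ (_ , refl) = ℚ.<⇒≤ (ℚ.positive⁻¹ _ {{pow-positive h}})
  ... | inj₂ (N , ν , _ , ν≡N+h , refl) = abs-≤pow {N} {h}
          (≡.subst₂ ℤ._≤_ (ℤ.+-identityˡ (ℤ.- + h)) (back N (+ h))
            (ℤ.+-monoˡ-≤ (ℤ.- + h) (≡.subst (+ 0 ℤ.≤_) ν≡N+h (ℤ.+≤+ z≤n))))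
    where
    back : ∀ N h → N ℤ.+ h ℤ.- h ≡ N
    back = solve-∀

  abs-embed-leading : ∀ {g h} → T^[ h ] g ≉ 0# → DegreeAtMost h g → ∣_∣≡_ F (embed F g) (pow h)
  abs-embed-leading {g} {h} lead deg = ≡.subst (∣_∣≡_ F (embed F g))
    (≡.trans (≡.cong abs (ℤ.+-identityˡ (ℤ.- + h))) (abs-negative h))
    (order⇒abs {h} {embed F g} (rep-embed {h} {g} deg)
      ((λ z → lead (trans (reflexive (≡.sym (homogenise-≤ h g {0} z≤n))) z)) , λ _ ()))

  height≡ : ∀ {n h hgt} {P : F[T][X]≤ F n} {i} → T^[ h ] P i ≉ 0# → (∀ j → DegreeAtMost h (P j)) →
            Height_≡_ F P hgt → hgt ≡ pow h
  height≡ {P = P} {i} lead deg ((i₀ , abs≡) , upper) = ℚ.≤-antisym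
    (abs-embed-≤ {P i₀} (deg i₀) abs≡) (upper i _ (abs-embed-leading {P i} lead (deg i)))

  -- For h ≥ 1 the 1 in `width` is absorbed into h, so `width n h` is at most (3 + q^n) h.
  orderConstant : ℕ → ℕ
  orderConstant n = suc (base n ℕ.^ 3) ℕ.* (3 ℕ.+ q ℕ.^ n)

  order-bound-linear : ∀ n {h} → 1 ≤ h → width n h ℕ.+ base n ℕ.^ 3 ℕ.* width n h ≤ h ℕ.* orderConstant n
  order-bound-linear n {h} 1≤h = begin
    suc (base n ℕ.^ 3) ℕ.* width n h               ≤⟨ ℕ.*-monoʳ-≤ (suc (base n ℕ.^ 3)) (ℕ.+-monoˡ-≤ ((2 ℕ.+ q ℕ.^ n) ℕ.* h) 1≤h) ⟩
    suc (base n ℕ.^ 3) ℕ.* ((3 ℕ.+ q ℕ.^ n) ℕ.* h)   ≡⟨ ℕ.*-assoc (suc (base n ℕ.^ 3)) (3 ℕ.+ q ℕ.^ n) h ⟨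
    orderConstant n ℕ.* h                        ≡⟨ ℕ.*-comm (orderConstant n) h ⟩
    h ℕ.* orderConstant n                        ∎
    where open ℕ.≤-Reasoning

  exponent<+∞ : ∀ n → exponent F n ξ <+∞
  exponent<+∞ n = ⌜ orderConstant n ⌝ , λ (w , infinitely , M<w) →
    let (P , (x , hgt , abs≡x , hgt≡ , 0<x , x≤) , new) = infinitely (constants n)
    in impossible {w} P M<w abs≡x hgt≡ 0<x x≤ new
    where
    M = orderConstant n
    impossible : ∀ {w x hgt} (P : F[T][X]≤ F n) → ℝ.Lower w ⌜ M ⌝ → ∣_∣≡_ F (eval F P ξ) x →
                 Height_≡_ F P hgt → 0ℚ ℚ.< x → _≤_^-_ x hgt w →
                 ¬ All (λ Q → ¬ _≈ᴾ_ F P Q) (constants n)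
    impossible {w} {x} {hgt} P M<w abs≡x hgt≡ 0<x x≤ new = byDegree (zero-or-maxDegree P)
      where
      byDegree : ¬ ((∀ i k → T^[ k ] P i ≈ 0#) ⊎
                    (∃[ h ] ∃[ i ] (T^[ h ] P i ≉ 0# × (∀ j → DegreeAtMost h (P j)))))
      byDegree (inj₁ P≈0)                      = constants-complete P (λ i k _ → P≈0 i k) new
      byDegree (inj₂ (zero , _ , _ , deg))     = constants-complete P deg new
      byDegree (inj₂ (h@(suc _) , i , lead , deg)) =
        byOrder (abs⇒order {h} {eval F P ξ} {value} (rep-eval {n} {h} {ξ} P deg rep-ξ) abs≡x)
        where
        value : A.Series
        value = evaluate (suc n) (homogeniseP h P)
        nonzero : ¬ (homogeniseP h P 𝔸[X].≈ 𝔸[X].0#)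
        nonzero f≈0 = lead (trans (reflexive (≡.sym (≡.trans
          (≡.cong (λ f → f 0) (homogeniseP-toℕ h P i)) (homogenise-≤ h (P i) {0} z≤n)))) (f≈0 (toℕ i) 0))
        ν≤ : ∀ {ν} → OrderAt value ν → ν ≤ h ℕ.* M
        ν≤ {ν} (_ , low) = ℕ.≤-trans
          (order-bound n h (homogeniseP h P) (λ k n<k → 𝔸.reflexive (homogeniseP-> h P k n<k))
            (homogeniseP-deg h P) nonzero ν low)
          (order-bound-linear n {h} (s≤s z≤n))
        byOrder : ¬ ((value A.≋ 𝔸.0# × x ≡ 0ℚ) ⊎
                     (∃[ N ] ∃[ ν ] (OrderAt value ν × + ν ≡ N ℤ.+ + h × x ≡ abs N)))
        byOrder (inj₁ (_ , x≡0)) = ℚ.<-irrefl (≡.sym x≡0) 0<x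
        -- With |P(ξ)| = q^(-N) the approximation gives N ≥ h M, and clearing T^h adds h to the
        -- order. So ν ≥ h M + h exceeds the bound h M strictly, as h ≥ 1.
        byOrder (inj₂ (N , ν , order , ν≡N+h , refl)) = ℕ.<⇒≱ (ℕ.m<m+n (h ℕ.* M) {h} (s≤s z≤n))
          (ℕ.≤-trans (ℤ.drop‿+≤+ (≡.subst (+ (h ℕ.* M ℕ.+ h) ℤ.≤_) (≡.sym ν≡N+h) (ℤ.+-monoˡ-≤ (+ h) hM≤N)))
                     (ν≤ order))
          where
          hM≤N : + (h ℕ.* M) ℤ.≤ N
          hM≤N = approximation-order {N} {h} {M} {w} M<w
            (≡.subst (λ hgt → _≤_^-_ (abs N) hgt w) (height≡ {P = P} lead deg hgt≡) x≤)

  -- The series ζ - ζ^(q^w) vanishes strictly between the exponents q^(T 2) and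
  -- q^(T 4), so X - X^(q^w) minus a rational function is very small at ζ.
  module Approximation (j y D : ℕ) (D≡q^w : D ≡ q ℕ.^ 6 ℕ.^ j) where

    w : ℕ
    w = 6 ℕ.^ j

    T : ℕ → ℕ
    T d = (d ℕ.+ y ℕ.* 6) ℕ.* w

    -- For positions s strictly between T 2 and T 4, the letters at s and at s - w come from blocks
    -- whose first letters have digits 1, 2 and 3.
    h ν : ℕ
    h = q ℕ.^ T 2
    ν = q ℕ.^ T 4

    j<w : j < w
    j<w = n<6^n j

    1<D : 1 < D
    1<D = ≡.subst (1 <_) (≡.sym D≡q^w) (ℕ.≤-<-trans (ℕ.m^n>0 6 j) (n<q^n w))

    -- ζ′ is ζ^(q^w), and `truncation` removes from ε everything up to u^h. As the constant
    -- coefficient of a polynomial in X scaled by u^h, it stands for a rational function with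
    -- denominator T^h.
    ζ′ ε truncation : A.Series
    ζ′ = lacunary (A.shift w word)
    ε k = ζ k - ζ′ k
    truncation k with k ℕ.≤? h
    ... | yes _ = - ε k
    ... | no  _ = 0#

    truncation-vanishes : A.VanishesFrom (suc h) truncation
    truncation-vanishes k h<k with k ℕ.≤? h
    ... | yes k≤h = ⊥-elim (ℕ.<⇒≱ h<k k≤h)
    ... | no  _   = R.refl

    -- The only multiple of w strictly between T 1 and T 3 is T 2, where the digits 2 and 3 carry
    -- the same letter. All other positions are covered by periodicity.
    toeplitz-repeats : ∀ x → T 1 < x → x < T 3 → toeplitz (w ℕ.+ x) ≡ toeplitz x
    toeplitz-repeats x T1<x x<T3 with w ∣? x
    ... | no  w∤x = ≡.trans (≡.cong toeplitz (≡.trans (ℕ.+-comm w x) (≡.cong (x ℕ.+_) (≡.sym (ℕ.*-identityˡ w)))))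
            (toeplitz-periodic j x 1 (ℕ.<⇒≤ (ℕ.<-trans j<w (ℕ.≤-<-trans (ℕ.m≤m+n w _) T1<x))) w∤x)
    ... | yes (divides r refl) = ≡.subst (λ r → toeplitz (w ℕ.+ r ℕ.* w) ≡ toeplitz (r ℕ.* w)) (≡.sym r≡)
            (≡.trans (toeplitz-digit j y 2 (s≤s (s≤s (s≤s (s≤s z≤n)))))
                     (≡.sym (toeplitz-digit j y 1 (s≤s (s≤s (s≤s z≤n))))))
      where
      r≡ : r ≡ 2 ℕ.+ y ℕ.* 6
      r≡ = ℕ.≤-antisym (ℕ.s≤s⁻¹ (ℕ.*-cancelʳ-< w r (3 ℕ.+ y ℕ.* 6) x<T3))
                       (ℕ.*-cancelʳ-< w (1 ℕ.+ y ℕ.* 6) r T1<x)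

    q^-cancel-< : ∀ {a b} → q ℕ.^ a < q ℕ.^ b → a < b
    q^-cancel-< q^a<q^b = ℕ.≰⇒> λ b≤a → ℕ.<⇒≱ q^a<q^b (q^-mono-≤ b≤a)

    difference-≈0 : ∀ {a b} → a ≈ b → a - b ≈ 0#
    difference-≈0 a≈b = trans (+-congʳ a≈b) (-‿inverseʳ _)

    ε-power : ∀ x → ε (q ℕ.^ (w ℕ.+ x)) ≈ word (w ℕ.+ x) - word x
    ε-power x = reflexive (≡.cong₂ _-_ (lacunary-power word (w ℕ.+ x))
      (≡.trans (lacunary-power (A.shift w word) (w ℕ.+ x)) (A.shift-+ w word x)))

    ε-gap : ∀ k → h < k → k < ν → ε k ≈ 0#
    ε-gap k h<k k<ν = go (log? k)
      where
      go : Dec (∃[ s ] q ℕ.^ s ≡ k) → ε k ≈ 0#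
      go (no none) = difference-≈0 (reflexive
        (≡.trans (lacunary-other word k none′) (≡.sym (lacunary-other (A.shift w word) k none′))))
        where
        none′ : ∀ s → q ℕ.^ s ≢ k
        none′ s e = none (s , e)
      go (yes (s , refl)) = ≡.subst (λ s → ε (q ℕ.^ s) ≈ 0#) w+x≡s (trans (ε-power x)
        (difference-≈0 (reflexive (≡.cong ι (toeplitz-repeats x
          (ℕ.+-cancelˡ-< w (T 1) x (≡.subst (T 2 <_) (≡.sym w+x≡s) T2<s))
          (ℕ.+-cancelˡ-< w x (T 3) (≡.subst (_< T 4) (≡.sym w+x≡s) (q^-cancel-< k<ν))))))))
        where
        T2<s : T 2 < s
        T2<s = q^-cancel-< h<k
        x : ℕ
        x = s ∸ w
        w+x≡s : w ℕ.+ x ≡ s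
        w+x≡s = ℕ.m+[n∸m]≡n (ℕ.≤-trans (ℕ.m≤m+n w _) (ℕ.<⇒≤ T2<s))

    -- The repetition ends at T 4, where digit 4 meets digit 3. Hence the order is exactly ν and the
    -- value is not 0.
    ε-ν : ε ν ≈ 1#
    ε-ν = begin
      ε ν                        ≈⟨ ε-power (T 3) ⟩
      word (T 4) - word (T 3)    ≡⟨ ≡.cong₂ (λ a b → ι a - ι b) (toeplitz-digit j y 3 (s≤s (s≤s (s≤s (s≤s (s≤s z≤n))))))
                                                              (toeplitz-digit j y 2 (s≤s (s≤s (s≤s (s≤s z≤n))))) ⟩
      1# - 0#                    ≈⟨ +-congˡ -0#≈0# ⟩
      1# + 0#                    ≈⟨ +-identityʳ 1# ⟩
      1#                         ∎
      where
      open SetoidReasoning setoid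
      open import Algebra.Properties.Group +-group using () renaming (ε⁻¹≈ε to -0#≈0#)

    f : X.Series
    f = (monomial 0 truncation 𝔸[X].+ monomial 1 𝔸.1#) 𝔸[X].+ monomial D (𝔸.- 𝔸.1#)

    ζ^D : ζ ^𝔸 D 𝔸.≈ ζ′
    ζ^D = ≡.subst (λ D → ζ ^𝔸 D 𝔸.≈ ζ′) (≡.sym D≡q^w) (ζ-^ w)

    evaluate-f : evaluate (suc D) f 𝔸.≈ truncation 𝔸.+ ε
    evaluate-f = begin
      evaluate (suc D) f
        ≈⟨ eval-+ (suc D) (monomial 0 truncation 𝔸[X].+ monomial 1 𝔸.1#) (monomial D (𝔸.- 𝔸.1#)) ⟩
      evaluate (suc D) (monomial 0 truncation 𝔸[X].+ monomial 1 𝔸.1#) 𝔸.+ evaluate (suc D) (monomial D (𝔸.- 𝔸.1#))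
        ≈⟨ 𝔸.+-cong (𝔸.trans (eval-+ (suc D) (monomial 0 truncation) (monomial 1 𝔸.1#))
             (𝔸.+-cong (eval-monomial (suc D) 0 truncation (s≤s z≤n)) (eval-monomial (suc D) 1 𝔸.1# (ℕ.m<n⇒m<1+n 1<D))))
             (eval-monomial (suc D) D (𝔸.- 𝔸.1#) ℕ.≤-refl) ⟩
      (truncation 𝔸.* 𝔸.1# 𝔸.+ 𝔸.1# 𝔸.* (ζ 𝔸.* 𝔸.1#)) 𝔸.+ 𝔸.- 𝔸.1# 𝔸.* ζ ^𝔸 D
        ≈⟨ 𝔸.+-cong (𝔸.+-cong (𝔸.*-identityʳ truncation) (𝔸.trans (𝔸.*-identityˡ (ζ 𝔸.* 𝔸.1#)) (𝔸.*-identityʳ ζ)))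
                    (𝔸.trans (-1*x≈-x (ζ ^𝔸 D)) (𝔸.-‿cong ζ^D)) ⟩
      (truncation 𝔸.+ ζ) 𝔸.+ 𝔸.- ζ′
        ≈⟨ 𝔸.+-assoc truncation ζ (𝔸.- ζ′) ⟩
      truncation 𝔸.+ ε ∎
      where
      open SetoidReasoning 𝔸.setoid
      open import Algebra.Properties.Ring 𝔸.ring using (-1*x≈-x)

    h<ν : h < ν
    h<ν = q^-mono-< {T 2} {T 4} (ℕ.*-monoˡ-< w {{ℕ.>-nonZero (ℕ.m^n>0 6 j)}} (ℕ.+-monoˡ-< (y ℕ.* 6) {2} {4} (s≤s (s≤s (s≤s z≤n)))))

    order-f : OrderAt (evaluate (suc D) f) ν
    order-f = (λ f≈0 → 0≉1 (sym (trans (sym at-ν) f≈0))) , low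
      where
      at-ν : evaluate (suc D) f ν ≈ 1#
      at-ν = trans (evaluate-f ν) (trans (+-cong (truncation-vanishes ν h<ν) ε-ν) (+-identityˡ 1#))
      low : ∀ m → m < ν → evaluate (suc D) f m ≈ 0#
      low m m<ν = trans (evaluate-f m) (cases m m<ν)
        where
        cases : ∀ m → m < ν → truncation m + ε m ≈ 0#
        cases m m<ν with m ℕ.≤? h
        ... | yes _   = -‿inverseˡ (ε m)
        ... | no  m≰h = trans (+-identityˡ (ε m)) (ε-gap m (ℕ.≰⇒> m≰h) m<ν)

    const-vanishes : ∀ {a k} → A.VanishesFrom (suc k) (A.const a)
    const-vanishes (suc i) _ = R.refl

    f-degree : ∀ i → A.VanishesFrom (suc h) (f i)
    f-degree i = vanishesFrom-+ (vanishesFrom-+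
      (shift-const-closed (A.VanishesFrom (suc h)) zero-vanishes 0 truncation-vanishes i)
      (shift-const-closed (A.VanishesFrom (suc h)) zero-vanishes 1 const-vanishes i))
      (shift-const-closed (A.VanishesFrom (suc h)) zero-vanishes D
        (λ { (suc k) _ → difference-≈0′ }) i)
      where
      zero-vanishes : A.VanishesFrom (suc h) 𝔸.0#
      zero-vanishes _ _ = R.refl
      difference-≈0′ : - 0# ≈ 0#
      difference-≈0′ = trans (sym (+-identityˡ _)) (-‿inverseʳ 0#)

    -- After clearing denominators the coefficient of X is T^h, which makes the height exactly q^h.
    f-one : f 1 0 ≈ 1#
    f-one = trans (+-cong (+-identityˡ 1#) (reflexive (≡.cong (λ g → g 0) (X.shift-< D (X.const (𝔸.- 𝔸.1#)) 1 1<D))))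
                  (+-identityʳ 1#)

    P : F[T][X]≤ F D
    P i = dehomogenise h (f (toℕ i))

    P-degree : ∀ i → DegreeAtMost h (P i)
    P-degree i = dehomogenise-degree h (f (toℕ i))

    homogenise-P : ∀ i → i < suc D → homogeniseP h P i 𝔸.≈ f i
    homogenise-P i i≤D = ≡.subst (λ i → homogeniseP h P i 𝔸.≈ f i) (Fin.toℕ-fromℕ< i≤D)
      (𝔸.trans (𝔸.reflexive (homogeniseP-toℕ h P (Fin.fromℕ< i≤D)))
               (homogenise-dehomogenise (f-degree (toℕ (Fin.fromℕ< i≤D)))))

    one : Fin (suc D)
    one = Fin.fromℕ< (ℕ.m<n⇒m<1+n 1<D)

    P-leading : T^[ h ] P one ≈ 1#
    P-leading = begin
      T^[ h ] P one                            ≡⟨ T^-applyUpTo-< (λ k → f (toℕ one) (h ∸ k)) (suc h) ℕ.≤-refl ⟩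
      f (toℕ one) (h ∸ h)                      ≡⟨ ≡.cong₂ f (Fin.toℕ-fromℕ< (ℕ.m<n⇒m<1+n 1<D)) (ℕ.n∸n≡0 h) ⟩
      f 1 0                                    ≈⟨ f-one ⟩
      1#                                       ∎
      where open SetoidReasoning setoid

    P-leading≉0 : T^[ h ] P one ≉ 0#
    P-leading≉0 lead≈0 = 0≉1 (trans (sym lead≈0) P-leading)

    abs-eval : ∣_∣≡_ F (eval F P ξ) (abs (+ (ν ∸ h)))
    abs-eval = ≡.subst (λ N → ∣_∣≡_ F (eval F P ξ) (abs N))
      (≡.trans (ℤ.m-n≡m⊖n ν h) (ℤ.⊖-≥ (ℕ.<⇒≤ h<ν)))
      (order⇒abs {h} {eval F P ξ} (rep-cong {h} {eval F P ξ} (eval-cong (suc D) homogenise-P)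
        (rep-eval {D} {h} {ξ} P P-degree rep-ξ)) order-f)

    height : Height_≡_ F P (pow h)
    height = (one , abs-embed-leading {P one} P-leading≉0 (P-degree one)) , λ i x → abs-embed-≤ {P i} (P-degree i)

    -- ν / h is D^2, because T 4 and T 2 differ by 2 w and D = q^w. The factor T^h that clears the
    -- denominator costs the 1.
    W : ℕ
    W = D ℕ.* D ∸ 1

    Wh≡ν∸h : W ℕ.* h ≡ ν ∸ h
    Wh≡ν∸h = begin
      (D ℕ.* D ∸ 1) ℕ.* h                    ≡⟨ ℕ.*-distribʳ-∸ h (D ℕ.* D) 1 ⟩
      D ℕ.* D ℕ.* h ∸ 1 ℕ.* h                ≡⟨ ≡.cong₂ _∸_ D²h≡ν (ℕ.*-identityˡ h) ⟩
      ν ∸ h                                  ∎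
      where
      open ≡.≡-Reasoning
      D²h≡ν : D ℕ.* D ℕ.* h ≡ ν
      D²h≡ν = begin
        D ℕ.* D ℕ.* h              ≡⟨ ℕ.*-assoc D D h ⟩
        D ℕ.* (D ℕ.* h)            ≡⟨ ≡.cong (λ D → D ℕ.* (D ℕ.* h)) D≡q^w ⟩
        q ℕ.^ w ℕ.* (q ℕ.^ w ℕ.* h)    ≡⟨ ≡.cong (q ℕ.^ w ℕ.*_) (ℕ.^-distribˡ-+-* q w (T 2)) ⟨
        q ℕ.^ w ℕ.* q ℕ.^ T 3          ≡⟨ ℕ.^-distribˡ-+-* q w (T 3) ⟨
        ν                          ∎

    approximates : Approximates F ξ (rational ⌜ W ⌝) P
    approximates = abs (+ (ν ∸ h)) , pow h , abs-eval , height , abs-positive (+ (ν ∸ h))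
      , approximation-≤ {W} {h} (ℕ.≤-reflexive Wh≡ν∸h)

    totalLength : List (F[T][X]≤ F D) → ℕ
    totalLength = List.foldr (λ Q n → length (Q one) ℕ.+ n) 0

    -- The coefficient of X in P has T-degree h ≥ y, and y is at least the length of the coefficient
    -- of X in any listed polynomial.
    P-new : ∀ Qs → totalLength Qs ≤ y → All (λ Q → ¬ _≈ᴾ_ F P Q) Qs
    P-new []       _  = []
    P-new (Q ∷ Qs) ≤y = (λ P≈Q → P-leading≉0 (trans (P≈Q one h) (reflexive (T^-≥length (Q one) short))))
                      ∷ P-new Qs (ℕ.≤-trans (ℕ.m≤n+m (totalLength Qs) (length (Q one))) ≤y)
      where
      y≤T2 : y ≤ T 2
      y≤T2 = ℕ.≤-trans (ℕ.m≤m*n y 6) (ℕ.≤-trans (ℕ.m≤n+m (y ℕ.* 6) 2) (ℕ.m≤m*n (2 ℕ.+ y ℕ.* 6) w {{ℕ.>-nonZero (ℕ.m^n>0 6 j)}}))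
      short : length (Q one) ≤ h
      short = ℕ.≤-trans (ℕ.m≤m+n (length (Q one)) (totalLength Qs))
        (ℕ.≤-trans ≤y (ℕ.≤-trans y≤T2 (ℕ.<⇒≤ (n<q^n (T 2)))))

  -- Reduces to S n < n^2, that is S n ≤ n^2 - 1. The degree n is a variable tied to q^(6^j) by an
  -- equation, since the limit superior supplies it as a successor.
  exponent-large : ∀ j n .{{_ : NonZero n}} → n ≡ q ℕ.^ 6 ℕ.^ j → ∀ s S → s ℚ.< ⌜ S ⌝ → S < n →
                   exponent F n ξ (s ℚ.* (+ n ℚ./ 1))
  exponent-large j n n≡q^w s S s<S S<n = rational ⌜ W ⌝
    , (λ Qs → let open Approximation j (totalLength 0 n n≡q^w Qs) n n≡q^w in P , approximates , P-new Qs ℕ.≤-refl)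
    , small
    where
    open Approximation j using (totalLength)
    W = n ℕ.* n ∸ 1
    small : s ℚ.* (+ n ℚ./ 1) ℚ.< ⌜ W ⌝
    small = begin-strict
      s ℚ.* (+ n ℚ./ 1)      ≡⟨ ≡.cong (s ℚ.*_) (/1≡⌜⌝ n) ⟩
      s ℚ.* ⌜ n ⌝            <⟨ ℚ.*-monoˡ-<-pos ⌜ n ⌝ {{ℚ.positive (⌜⌝-mono-< (ℕ.>-nonZero⁻¹ n))}} s<S ⟩
      ⌜ S ⌝ ℚ.* ⌜ n ⌝        ≡⟨ ⌜⌝-* S n ⟨
      ⌜ S ℕ.* n ⌝            ≤⟨ ⌜⌝-mono-≤ (ℕ.m+n≤o⇒m≤o∸n (S ℕ.* n) (begin-ℕ S<n)) ⟩
      ⌜ W ⌝                  ∎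
      where
      open ℚ.≤-Reasoning
      begin-ℕ : S < n → S ℕ.* n ℕ.+ 1 ≤ n ℕ.* n
      begin-ℕ S<n = ℕ.≤-trans (ℕ.+-monoʳ-≤ (S ℕ.* n) (ℕ.>-nonZero⁻¹ n))
        (ℕ.≤-trans (ℕ.≤-reflexive (ℕ.+-comm (S ℕ.* n) n)) (ℕ.*-monoˡ-≤ n S<n))

  limsupExponent≡+∞ : limsupExponent F ξ ≡+∞
  -- The summand N of j makes the index at least N, and the summand S makes the degree larger than
  -- S.
  limsupExponent≡+∞ r = s , r<s , λ N → let j = S ℕ.+ N in
    ℕ.pred (D j) , ℕ.≤-trans (ℕ.m≤n+m N S) (ℕ.s≤s⁻¹ (≡.subst (j <_) (≡.sym (1+pred j)) (j<D j)))
    , exponent-large j (suc (ℕ.pred (D j))) (1+pred j) s S s<S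
        (≡.subst (S <_) (≡.sym (1+pred j)) (ℕ.≤-<-trans (ℕ.m≤m+n S N) (j<D j)))
    where
    s = r ℚ.+ 1ℚ
    r<s : r ℚ.< s
    r<s = ≡.subst (ℚ._< s) (ℚ.+-identityʳ r) (ℚ.+-monoʳ-< r (ℚ.positive⁻¹ 1ℚ))
    S = proj₁ (<⌜⌝ s)
    s<S = proj₂ (<⌜⌝ s)
    D : ℕ → ℕ
    D j = q ℕ.^ 6 ℕ.^ j
    j<D : ∀ j → j < D j
    j<D j = ℕ.<-trans (n<6^n j) (n<q^n (6 ℕ.^ j))
    1+pred : ∀ j → suc (ℕ.pred (D j)) ≡ D j
    1+pred j = ℕ.suc-pred (D j) {{ℕ.m^n≢0 q (6 ℕ.^ j)}}

  isTNumber : IsTNumber F ξ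
  isTNumber = limsupExponent≡+∞ , λ n _ → exponent<+∞ n

-- The diagonal argument.

open import Data.Nat.Base using (_^_)

theorem1p1 : ∀ {c ℓ : Level} (p e q : ℕ) → Prime p → 1 ≤ e → q ≡ p ^ e →
    (F : FiniteField c ℓ q) → Uncountable (_≈ᴸ_ F) (IsTNumber F)
theorem1p1 p e q p-prime 1≤e q≡p^e F (s , covers) =
  let (i , sᵢ≈ξ) = covers ξ isTNumber in differs i (sᵢ≈ξ (+ (q ^ (5 ℕ.* 6 ^ i))))
  where
  open FiniteField F using (_≈_; 0#; 1#; 0≉1; commutativeRing)
  open CommutativeRing commutativeRing using (sym; trans; reflexive)
  open FieldProperties F using (_≈?_)
  open LaurentSeries F using (at)
  flip : ∀ {x} → Dec (x ≈ 1#) → Bool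
  flip (yes _) = false
  flip (no  _) = true
  -- Position 5 · 6^i has digit 5 in place i and so carries bit i freely. The bit is chosen as 0
  -- when s i has coefficient 1 at the corresponding power of u, and as 1 otherwise.
  bits : ℕ → Bool
  bits i = flip (at (s i) (+ (q ^ (5 ℕ.* 6 ^ i))) ≈? 1#)
  open Construction {e = e} p-prime 1≤e q≡p^e F bits using (ξ; isTNumber; at-ξ)
  open OrderBound {e = e} p-prime 1≤e q≡p^e F bits using (ι; toeplitz-digit)
  at-ξ-bit : ∀ i → at ξ (+ (q ^ (5 ℕ.* 6 ^ i))) ≡ ι (bits i)
  at-ξ-bit i = ≡.trans (at-ξ (5 ℕ.* 6 ^ i)) (≡.cong ι (toeplitz-digit i 0 4 ℕ.≤-refl))
  differs : ∀ i → ¬ (at (s i) (+ (q ^ (5 ℕ.* 6 ^ i))) ≈ at ξ (+ (q ^ (5 ℕ.* 6 ^ i))))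
  differs i sᵢ≈ξ = decide (at (s i) (+ (q ^ (5 ℕ.* 6 ^ i))) ≈? 1#) (trans sᵢ≈ξ (reflexive (at-ξ-bit i)))
    where
    decide : ∀ {x} (d : Dec (x ≈ 1#)) → ¬ (x ≈ ι (flip d))
    decide (yes x≈1) x≈0 = 0≉1 (trans (sym x≈0) x≈1)
    decide (no  x≉1) x≈1 = x≉1 x≈1
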